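{- Let $m\ge 2$, let $\mathcal{H}_1,\mathcal{H}_2$ be nontrivial connected simple $m$-uniform hypergraphs, and let $\mathcal{H}=\mathcal{H}_1(u)\odot\mathcal{H}_2(u)$ be a coalescence of $\mathcal{H}_1$ and $\mathcal{H}_2$ at a vertex $u$. Then for every positive integer $d$, $$\mathrm{Tr}_d(\mathcal{H}_1(u)\odot\mathcal{H}_2(u);[u])=\sum_{d_1+d_2=d}\ \sum_{\substack{t_1\le d_1,\ t_2\le d_2\\ 0<t_1+t_2}}\frac{d}{t_1+t_2}\binom{t_1+t_2}{t_1}\,\frac{t_1}{d_1}\,\mathrm{Tr}_{d_1;t_1}(\mathcal{H}_1;[u])\,\frac{t_2}{d_2}\,\mathrm{Tr}_{d_2;t_2}(\mathcal{H}_2;[u]),$$ where $d_1,d_2,t_1,t_2$ range over nonnegative integers.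
   Context: An $m$-uniform hypergraph $\mathcal{H}=(V,E)$ has a finite vertex set $V$ and an edge set $E$ of $m$-element subsets of $V$ (no repeated edges); it is nontrivial if it has more than one vertex. The coalescence $\mathcal{H}_1(v_1)\odot\mathcal{H}_2(v_2)$ of two disjoint hypergraphs is obtained by identifying a vertex $v_1$ of $\mathcal{H}_1$ with a vertex $v_2$ of $\mathcal{H}_2$ to form a new vertex $u$; it is also written $\mathcal{H}_1(u)\odot\mathcal{H}_2(u)$. Let $\mathcal{H}$ be an $m$-uniform hypergraph on $n$ vertices, with a fixed total order on its vertices (for a coalescence, take the induced orders on $\mathcal{H}_1$ and $\mathcal{H}_2$). For an edge $e$ and $v\in e$, write $e(v)$ for the edge $e$ with root $v$. For $d\ge1$ let $\mathcal{F}_d(\mathcal{H})$ be the set of sequences $F=(e_1(v_1),\ldots,e_d(v_d))$ with $e_i\in E(\mathcal{H})$, $v_i\in e_i$ and $v_1\le\cdots\le v_d$ (repetitions allowed; edges with the same root may appear in any order, and different orders give different sequences). Let $R(F)$ be the directed multigraph that is the union, with multiplicities, of the stars $S_{e_i}(v_i)$, $i=1,\dots,d$, where $S_{e_i}(v_i)$ has vertex set $e_i$ and one arc $(v_i,w)$ for each $w\in e_i\setminus\{v_i\}$; its vertex set $V(F)$ is $\bigcup_i e_i$. Let $\mathcal{F}^{\epsilon}_d(\mathcal{H})$ be the set of $F\in\mathcal{F}_d(\mathcal{H})$ such that $R(F)$ is Eulerian (it has a closed directed walk traversing each arc exactly once). For $F\in\mathcal{F}^{\epsilon}_d(\mathcal{H})$,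 let $r_F(v)$ be the number of indices $i$ with $v_i=v$; let $d_F^+(v)=(m-1)r_F(v)$ be the outdegree of $v$ in $R(F)$; and let $\tau(F)$ be the number of arborescences of $R(F)$ with a fixed root $x$ (spanning trees in which every vertex other than $x$ has a directed path to $x$, parallel arcs being distinguished), which does not depend on $x$ since $R(F)$ is Eulerian. Put $$\omega(F)=d(m-1)^n\frac{\tau(F)}{\prod_{v\in V(F)}d_F^+(v)}.$$ For a vertex $u$ and $1\le t\le d$ define $$\mathrm{Tr}_d(\mathcal{H};[u])=\sum_{F\in\mathcal{F}^{\epsilon}_d(\mathcal{H}),\ r_F(u)>0}\omega(F),\qquad \mathrm{Tr}_{d;t}(\mathcal{H};[u])=\sum_{F\in\mathcal{F}^{\epsilon}_d(\mathcal{H}),\ r_F(u)=t}\omega(F).$$ Conventions: $\frac00:=1$ and $\mathrm{Tr}_{0;0}(\mathcal{H};[u]):=(m-1)^{n-1}$ when $\mathcal{H}$ has $n$ vertices. A term with $t_i=0$ and $d_i>0$ is zero because of the factor $t_i/d_i=0$. -}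

module Defs where

open import Data.Nat.Base as ℕ using (ℕ; zero; suc; NonZero)
import Data.Nat.Properties as ℕₚ
open import Data.Integer.Base using (+_)
open import Data.Rational.Base as ℚ using (ℚ; 0ℚ; 1ℚ)
open import Data.Fin.Base using (Fin) renaming (_<_ to _<ᶠ_)
import Data.Fin.Properties as Finₚ
open import Data.Fin.Subset using (Subset; ∣_∣; ⋃; _-_) renaming (_∈_ to _∈ˢ_)
open import Data.Fin.Subset.Properties using () renaming (_∈?_ to _∈ˢ?_)
open import Data.List.Base as List
  using (List; []; _∷_; _++_; map; foldr; filter; concatMap; length; product;
         allFin; upTo; cartesianProduct; cartesianProductWith)
open import Data.List.Membership.Propositional using (_∈_)
open import Data.List.Membership.Propositional.Properties
  using (∈-∃++; ∈-map⁺; ∈-map⁻; ∈-concatMap⁺; ∈-concatMap⁻)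
open import Data.List.Relation.Unary.All using (All)
open import Data.List.Relation.Unary.Any as Any using (Any; here; there)
open import Data.List.Relation.Unary.Unique.Propositional using (Unique)
open import Data.List.Relation.Binary.Permutation.Propositional
  using (_↭_; ↭-refl; ↭-sym; ↭-trans; prep; swap)
open import Data.List.Relation.Binary.Permutation.Propositional.Properties
  using (∈-resp-↭; ↭-empty-inv; drop-mid)
open import Data.Vec.Base as Vec using (Vec; []; _∷_; tabulate; toList)
open import Data.Vec.Relation.Unary.Linked using (Linked; linked?)
open import Data.Product.Base using (∃; _×_; _,_; proj₁; proj₂)
open import Data.Sum.Base using (_⊎_; inj₁; inj₂)
open import Function.Base using (_∘_)
open import Function.Bundles using (_⇔_)
open import Level using (Level)
open import Relation.Binary.Core using (_Preserves_⟶_)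
open import Relation.Binary.Construct.Closure.ReflexiveTransitive
  using (Star; ε; _◅_; _◅◅_; gmap)
open import Relation.Binary.Construct.Closure.Symmetric using (SymClosure; fwd; bwd)
open import Relation.Binary.Construct.Closure.Equivalence using (EqClosure)
open import Relation.Binary.PropositionalEquality
  using (_≡_; _≢_; refl)
open import Relation.Nullary using (¬_; Dec; yes; no; does)
open import Relation.Nullary.Decidable
  using (map′; ¬?; _×-dec_; _⊎-dec_; _→-dec_)

private
  variable
    a p : Level
    A : Set a
    m n n₁ n₂ d : ℕ

sequences : List A → (d : ℕ) → List (Vec A d)
sequences xs zero    = [] ∷ []
sequences xs (suc d) = cartesianProductWith _∷_ xs (sequences xs d)

-- Sublists are enumerated by position, so equal entries of the list at
-- different positions are distinguished.
sublists : List A → List (List A)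
sublists []       = [] ∷ []
sublists (x ∷ xs) = map (x ∷_) (sublists xs) ++ sublists xs

members : Subset n → List (Fin n)
members e = filter (_∈ˢ? e) (allFin _)

∑ : List A → (A → ℚ) → ℚ
∑ xs f = foldr ℚ._+_ 0ℚ (map f xs)

fromℕ : ℕ → ℚ
fromℕ k = + k ℚ./ 1

-- Quotient of natural numbers with 0 // 0 = 1.  The value of
-- suc _ // 0 is never used.
infixl 7 _//_
_//_ : ℕ → ℕ → ℚ
zero  // zero  = 1ℚ
suc _ // zero  = 0ℚ
k     // suc l = + k ℚ./ suc l

record Hypergraph (m n : ℕ) : Set where
  field
    edges   : List (Subset n)
    uniform : All (λ e → ∣ e ∣ ≡ m) edges
    simple  : Unique edges

open Hypergraph public

Adjacent : Hypergraph m n → Fin n → Fin n → Set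
Adjacent H v w = Any (λ e → v ∈ˢ e × w ∈ˢ e) (edges H)

Connected : Hypergraph m n → Set
Connected H = ∀ v w → Star (Adjacent H) v w

Nontrivial : Hypergraph m n → Set
Nontrivial {n = n} _ = 1 ℕ.< n

image : (Fin n₁ → Fin n) → Subset n₁ → Subset n
image ι e = tabulate λ v → does (Finₚ.any? λ i → (i ∈ˢ? e) ×-dec (ι i Finₚ.≟ v))

-- H is H₁ ⊙ H₂ with u₁ and u₂ identified.  H may carry any total order of
-- its vertices; since the embeddings are strictly monotone, the orders on
-- H₁ and H₂ are the induced ones.
record Coalescence (H₁ : Hypergraph m n₁) (u₁ : Fin n₁)
                   (H₂ : Hypergraph m n₂) (u₂ : Fin n₂)
                   (H : Hypergraph m n) : Set where
  field
    ι₁        : Fin n₁ → Fin n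
    ι₂        : Fin n₂ → Fin n
    monotone₁ : ι₁ Preserves _<ᶠ_ ⟶ _<ᶠ_
    monotone₂ : ι₂ Preserves _<ᶠ_ ⟶ _<ᶠ_
    covers    : ∀ v → (∃ λ i → ι₁ i ≡ v) ⊎ (∃ λ j → ι₂ j ≡ v)
    glued     : ι₁ u₁ ≡ ι₂ u₂
    separated : ∀ i j → ι₁ i ≡ ι₂ j → i ≡ u₁ × j ≡ u₂
    edges-⇔   : ∀ e → e ∈ edges H ⇔
                      (e ∈ map (image ι₁) (edges H₁) ⊎ e ∈ map (image ι₂) (edges H₂))

  vertex : Fin n
  vertex = ι₁ u₁

-- An arc (v , w) goes from v to w.
Arc : ℕ → Set
Arc n = Fin n × Fin n

-- Parallel arcs are repeated entries of the list of arcs.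
record Multidigraph (n : ℕ) : Set where
  field
    vertices : Subset n
    arcs     : List (Arc n)

open Multidigraph public

-- DirectedWalk v w v′: the list w is a directed walk from v to v′.
DirectedWalk : Fin n → List (Arc n) → Fin n → Set
DirectedWalk v []            v′ = v ≡ v′
DirectedWalk v ((x , y) ∷ w) v′ = v ≡ x × DirectedWalk y w v′

-- As DirectedWalk, but every arc may be traversed in either direction.
UndirectedWalk : Fin n → List (Arc n) → Fin n → Set
UndirectedWalk v []            v′ = v ≡ v′
UndirectedWalk v ((x , y) ∷ w) v′ =
  (v ≡ x × UndirectedWalk y w v′) ⊎ (v ≡ y × UndirectedWalk x w v′)

Eulerian : Multidigraph n → Set
Eulerian G = ∃ λ w → w ↭ arcs G × ∃ λ v → DirectedWalk v w v

_∋_⟶_ : List (Arc n) → Fin n → Fin n → Set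
T ∋ v ⟶ w = (v , w) ∈ T

Reaches : List (Arc n) → Fin n → Fin n → Set
Reaches T = Star (T ∋_⟶_)

-- The arcs c, distinct as entries of T, form a nonempty closed undirected walk.
HasCycle : List (Arc n) → Set
HasCycle T = ∃ λ c → ∃ λ rest → (c ++ rest) ↭ T × c ≢ [] × ∃ λ v → UndirectedWalk v c v

record IsTree (V : Subset n) (T : List (Arc n)) : Set where
  constructor tree
  field
    connected : ∀ v w → v ∈ˢ V → w ∈ˢ V → EqClosure (T ∋_⟶_) v w
    acyclic   : ¬ HasCycle T

-- T is only ever a sublist of arcs G, so its arcs join vertices of G.
record IsArborescence (G : Multidigraph n) (x : Fin n) (T : List (Arc n)) : Set where
  constructor arborescence
  field
    isTree  : IsTree (vertices G) T
    reaches : ∀ v → v ∈ˢ vertices G → v ≢ x → Reaches T v x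

permutations : List A → List (List A)
inserts      : A → List A → List (List A)

inserts x []       = (x ∷ []) ∷ []
inserts x (y ∷ ys) = (x ∷ y ∷ ys) ∷ map (y ∷_) (inserts x ys)

permutations []       = [] ∷ []
permutations (x ∷ xs) = concatMap (inserts x) (permutations xs)

private
  inserts-complete : ∀ (x : A) hs ts → hs ++ x ∷ ts ∈ inserts x (hs ++ ts)
  inserts-complete x []       []       = here refl
  inserts-complete x []       (t ∷ ts) = here refl
  inserts-complete x (h ∷ hs) ts       = there (∈-map⁺ (h ∷_) (inserts-complete x hs ts))

  inserts-sound : ∀ (x : A) ys {zs} → zs ∈ inserts x ys → zs ↭ x ∷ ys
  inserts-sound x []       (here refl) = ↭-refl
  inserts-sound x (y ∷ ys) (here refl) = ↭-refl
  inserts-sound x (y ∷ ys) (there zs∈) with ∈-map⁻ (y ∷_) zs∈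
  ... | ws , ws∈ , refl = ↭-trans (prep y (inserts-sound x ys ws∈)) (swap y x ↭-refl)

permutations-complete : ∀ {ys : List A} xs → ys ↭ xs → ys ∈ permutations xs
permutations-complete [] ys↭ with ↭-empty-inv ys↭
... | refl = here refl
permutations-complete (x ∷ xs) ys↭
  with hs , ts , refl ← ∈-∃++ (∈-resp-↭ (↭-sym ys↭) (here refl)) =
  ∈-concatMap⁺ (inserts x)
    (Any.map (λ { refl → inserts-complete x hs ts })
             (permutations-complete xs (drop-mid hs [] ys↭)))

permutations-sound : ∀ {ys : List A} xs → ys ∈ permutations xs → ys ↭ xs
permutations-sound []       (here refl) = ↭-refl
permutations-sound {ys = ys} (x ∷ xs) ys∈ =
  go (permutations xs) (λ zs∈ → permutations-sound xs zs∈)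
     (∈-concatMap⁻ (inserts x) {xs = permutations xs} ys∈)
  where
  go : ∀ zss → (∀ {zs} → zs ∈ zss → zs ↭ xs) →
       Any (λ zs → ys ∈ inserts x zs) zss → ys ↭ x ∷ xs
  go (zs ∷ _)   f (here ys∈′) = ↭-trans (inserts-sound x zs ys∈′) (prep x (f (here refl)))
  go (_ ∷ zss)  f (there q)   = go zss (f ∘ there) q

∃↭? : ∀ {P : List A → Set p} → (∀ w → Dec (P w)) → ∀ xs → Dec (∃ λ w → w ↭ xs × P w)
∃↭? {P = P} P? xs = map′ to from (Any.any? P? (permutations xs))
  where
  to : Any P (permutations xs) → ∃ λ w → w ↭ xs × P w
  to q = let w , w∈ , Pw = find′ q in w , permutations-sound xs w∈ , Pw
    where
    find′ : ∀ {zss} → Any P zss → ∃ λ w → w ∈ zss × P w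
    find′ (here px) = _ , here refl , px
    find′ (there q) = let w , w∈ , Pw = find′ q in w , there w∈ , Pw
  from : (∃ λ w → w ↭ xs × P w) → Any P (permutations xs)
  from (w , w↭ , Pw) = Any.map (λ { refl → Pw }) (permutations-complete xs w↭)

∃++? : ∀ {P : List A → Set p} → (∀ w → Dec (P w)) →
       ∀ zs → Dec (∃ λ c → ∃ λ rest → c ++ rest ≡ zs × P c)
∃++? P? [] = map′ (λ P[] → [] , [] , refl , P[])
                  (λ { ([] , _ , _ , P[]) → P[] }) (P? [])
∃++? {P = P} P? (z ∷ zs) = map′ to from (P? [] ⊎-dec ∃++? (λ c → P? (z ∷ c)) zs)
  where
  to : P [] ⊎ (∃ λ c → ∃ λ rest → c ++ rest ≡ zs × P (z ∷ c)) →
       ∃ λ c → ∃ λ rest → c ++ rest ≡ z ∷ zs × P c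
  to (inj₁ P[])                = [] , _ , refl , P[]
  to (inj₂ (c , r , refl , q)) = z ∷ c , r , refl , q
  from : (∃ λ c → ∃ λ rest → c ++ rest ≡ z ∷ zs × P c) →
         P [] ⊎ (∃ λ c → ∃ λ rest → c ++ rest ≡ zs × P (z ∷ c))
  from ([]    , _ , _    , P[]) = inj₁ P[]
  from (_ ∷ c , r , refl , q)   = inj₂ (c , r , refl , q)

directedWalk? : ∀ (v : Fin n) w v′ → Dec (DirectedWalk v w v′)
directedWalk? v []            v′ = v Finₚ.≟ v′
directedWalk? v ((x , y) ∷ w) v′ = (v Finₚ.≟ x) ×-dec directedWalk? y w v′

undirectedWalk? : ∀ (v : Fin n) w v′ → Dec (UndirectedWalk v w v′)
undirectedWalk? v []            v′ = v Finₚ.≟ v′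
undirectedWalk? v ((x , y) ∷ w) v′ =
  ((v Finₚ.≟ x) ×-dec undirectedWalk? y w v′) ⊎-dec
  ((v Finₚ.≟ y) ×-dec undirectedWalk? x w v′)

eulerian? : (G : Multidigraph n) → Dec (Eulerian G)
eulerian? G = ∃↭? (λ w → Finₚ.any? λ v → directedWalk? v w v) (arcs G)

private
  nonEmpty? : ∀ (xs : List A) → Dec (xs ≢ [])
  nonEmpty? []      = no (λ ne → ne refl)
  nonEmpty? (_ ∷ _) = yes (λ ())

hasCycle? : (T : List (Arc n)) → Dec (HasCycle T)
hasCycle? T = map′
  (λ { (zs , zs↭ , c , r , refl , q) → c , r , zs↭ , q })
  (λ { (c , r , c↭ , q) → c ++ r , c↭ , c , r , refl , q })
  (∃↭? (∃++? λ c → nonEmpty? c ×-dec Finₚ.any? λ v → undirectedWalk? v c v) T)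

-- A walk in (x , y) ∷ T either avoids the first arc or splits at its first
-- and last uses into two walks in T.
reaches? : ∀ (T : List (Arc n)) v w → Dec (Reaches T v w)
reaches? [] v w = map′ (λ { refl → ε }) (λ { ε → refl ; (() ◅ _) }) (v Finₚ.≟ w)
reaches? {n = n} ((x , y) ∷ T) v w =
  map′ to from (reaches? T v w ⊎-dec (reaches? T v x ×-dec reaches? T y w))
  where
  weaken : ∀ {v w} → Reaches T v w → Reaches ((x , y) ∷ T) v w
  weaken = gmap (λ z → z) there

  Split : Fin n → Set
  Split v = Reaches T v w ⊎ (Reaches T v x × Reaches T y w)

  to : ∀ {v} → Split v → Reaches ((x , y) ∷ T) v w
  to (inj₁ r)       = weaken r
  to (inj₂ (r , s)) = weaken r ◅◅ here refl ◅ weaken s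

  from : ∀ {v} → Reaches ((x , y) ∷ T) v w → Split v
  from ε = inj₁ ε
  from (here refl ◅ r) with from r
  ... | inj₁ s       = inj₂ (ε , s)
  ... | inj₂ (_ , s) = inj₂ (ε , s)
  from (there i ◅ r) with from r
  ... | inj₁ s       = inj₁ (i ◅ s)
  ... | inj₂ (q , s) = inj₂ (i ◅ q , s)

joined? : ∀ (T : List (Arc n)) v w → Dec (EqClosure (T ∋_⟶_) v w)
joined? {n = n} T v w = map′ (gmap (λ z → z) (⇐ T)) (gmap (λ z → z) (⇒ T)) (reaches? (both T) v w)
  where
  both : List (Arc n) → List (Arc n)
  both []            = []
  both ((x , y) ∷ T) = (x , y) ∷ (y , x) ∷ both T

  ⇐ : ∀ T {v w} → both T ∋ v ⟶ w → SymClosure (T ∋_⟶_) v w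
  ⇐ (_ ∷ T) (here refl)         = fwd (here refl)
  ⇐ (_ ∷ T) (there (here refl)) = bwd (here refl)
  ⇐ (_ ∷ T) (there (there i)) with ⇐ T i
  ... | fwd j = fwd (there j)
  ... | bwd j = bwd (there j)

  ⇒⁺ : ∀ T {v w} → T ∋ v ⟶ w → both T ∋ v ⟶ w
  ⇒⁺ (_ ∷ T) (here refl) = here refl
  ⇒⁺ (_ ∷ T) (there i)   = there (there (⇒⁺ T i))

  ⇒⁻ : ∀ T {v w} → T ∋ w ⟶ v → both T ∋ v ⟶ w
  ⇒⁻ (_ ∷ T) (here refl) = there (here refl)
  ⇒⁻ (_ ∷ T) (there i)   = there (there (⇒⁻ T i))

  ⇒ : ∀ T {v w} → SymClosure (T ∋_⟶_) v w → both T ∋ v ⟶ w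
  ⇒ T (fwd i) = ⇒⁺ T i
  ⇒ T (bwd i) = ⇒⁻ T i

isTree? : ∀ (V : Subset n) T → Dec (IsTree V T)
isTree? V T = map′ (λ (c , a) → tree c a) (λ (tree c a) → c , a)
  ((Finₚ.all? λ v → Finₚ.all? λ w → (v ∈ˢ? V) →-dec ((w ∈ˢ? V) →-dec joined? T v w))
   ×-dec ¬? (hasCycle? T))

isArborescence? : ∀ (G : Multidigraph n) x T → Dec (IsArborescence G x T)
isArborescence? G x T = map′ (λ (t , r) → arborescence t r) (λ (arborescence t r) → t , r)
  (isTree? (vertices G) T
   ×-dec Finₚ.all? λ v → (v ∈ˢ? vertices G) →-dec (¬? (v Finₚ.≟ x) →-dec reaches? T v x))

-- (e , v) is the edge e with root v.
RootedEdge : ℕ → Set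
RootedEdge n = Subset n × Fin n

root : RootedEdge n → Fin n
root = proj₂

rootedEdges : Hypergraph m n → List (RootedEdge n)
rootedEdges H = concatMap (λ e → map (e ,_) (members e)) (edges H)

𝓕 : Hypergraph m n → (d : ℕ) → List (Vec (RootedEdge n) d)
𝓕 H d = filter (linked? λ f g → root f Finₚ.≤? root g) (sequences (rootedEdges H) d)

star : RootedEdge n → List (Arc n)
star (e , v) = map (v ,_) (members (e - v))

V : Vec (RootedEdge n) d → Subset n
V F = ⋃ (map proj₁ (toList F))

R : Vec (RootedEdge n) d → Multidigraph n
R F = record { vertices = V F ; arcs = concatMap star (toList F) }

𝓕ᵋ : Hypergraph m n → (d : ℕ) → List (Vec (RootedEdge n) d)
𝓕ᵋ H d = filter (λ F → eulerian? (R F)) (𝓕 H d)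

r : Vec (RootedEdge n) d → Fin n → ℕ
r F v = Vec.count (λ f → root f Finₚ.≟ v) F

outdegree : ℕ → Vec (RootedEdge n) d → Fin n → ℕ
outdegree m F v = (m ℕ.∸ 1) ℕ.* r F v

-- The number of arborescences of R F does not depend on their root when
-- R F is Eulerian; the root is fixed to be the first root of F.
τ : .{{NonZero d}} → Vec (RootedEdge n) d → ℕ
τ {d = suc _} F@(f ∷ _) = length (filter (isArborescence? (R F) (root f)) (sublists (arcs (R F))))

-- For m ≥ 2 and Eulerian R F the denominator is positive.
ω : ℕ → .{{NonZero d}} → Vec (RootedEdge n) d → ℚ
ω {d = d} {n = n} m F =
  fromℕ (d ℕ.* (m ℕ.∸ 1) ℕ.^ n) ℚ.* (τ F // product (map (outdegree m F) (members (V F))))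

Tr : Hypergraph m n → (d : ℕ) → .{{NonZero d}} → Fin n → ℚ
Tr {m = m} H d u = ∑ (filter (λ F → 0 ℕₚ.<? r F u) (𝓕ᵋ H d)) (ω m)

-- Trₜ H d t u is Tr_{d;t}(H;[u]).  The value at d = 0 < t is never used.
Trₜ : Hypergraph m n → (d t : ℕ) → Fin n → ℚ
Trₜ {m = m} {n = n} H zero zero    u = fromℕ ((m ℕ.∸ 1) ℕ.^ (n ℕ.∸ 1))
Trₜ                 H zero (suc _) u = 0ℚ
Trₜ {m = m}         H d@(suc _) t  u = ∑ (filter (λ F → r F u ℕₚ.≟ t) (𝓕ᵋ H d)) (ω m)

splittings : ℕ → List (ℕ × ℕ)
splittings d = map (λ d₁ → d₁ , d ℕ.∸ d₁) (upTo (suc d))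

multiplicities : ℕ → ℕ → List (ℕ × ℕ)
multiplicities d₁ d₂ =
  filter (λ (t₁ , t₂) → 0 ℕₚ.<? (t₁ ℕ.+ t₂)) (cartesianProduct (upTo (suc d₁)) (upTo (suc d₂)))

{-# OPTIONS --safe #-}

-- Every arc of R(F) lies in H₁ or in H₂, and the two sides meet only in u.  Splitting a sequence F with
-- r_F(u) = t > 0 into its edges F₁ from H₁ and F₂ from H₂ therefore cuts a closed walk of R(F) based at u into
-- closed walks of R(F₁) and R(F₂) based at u, and such walks can be concatenated again; a nonempty side thus
-- has t_i = r_{F_i}(u) > 0.  Conversely a sorted pair (F₁ , F₂) has binomial(t₁ + t₂ , t₁) sorted shuffles,
-- because only the edges rooted at u can be interleaved in more than one way.  An arborescence of R(F) with
-- root u is a pair of arborescences with root u, so τ(F) = τ(F₁) τ(F₂); the degree products agree except for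
-- the factors (m - 1)(t₁ + t₂) and (m - 1) t₁, (m - 1) t₂ of u, and n₁ + n₂ = n + 1.  Hence
-- ω(F) / d = (t₁ + t₂)⁻¹ (t₁ / d₁) ω(F₁) (t₂ / d₂) ω(F₂).
--
-- That τ does not depend on the root is proved without determinants.  Let t(x) be the number of spanning
-- in-trees with root x.  An in-tree with root x plus an arc leaving x has a unique cycle, and removing the
-- arc of this cycle that enters x moves the root to its source; hence outdeg(x) t(x) is at most the sum of
-- t(y) over the arcs (y , x).  In a balanced strongly connected graph the maximum principle makes t constant.

module Submission where

open import Defs
open import Data.Nat using (ℕ; NonZero; _≤_; _+_)
open import Data.Nat.Combinatorics using (_C_)
open import Data.Rational using (_*_)
open import Data.Fin using (Fin)
open import Data.Product using (_,_)
open import Relation.Binary.PropositionalEquality using (_≡_)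

open import Algebra.Core using (Op₂)
open import Algebra.Structures using (IsCommutativeMonoid)
import Algebra.Properties.CommutativeSemigroup as CommutativeSemigroupProperties
open import Data.Bool using (Bool; true; false; if_then_else_; _∧_)
open import Data.Empty using (⊥)
import Data.Fin as F
import Data.Fin.Properties as Finₚ
open import Data.Fin.Subset using (Subset; ∣_∣; ⋃; _-_; _⊆_; ⁅_⁆; Nonempty) renaming (_∈_ to _∈ˢ_)
open import Data.Fin.Subset.Properties
  using (x∈p∪q⁺; x∈p∪q⁻; ∉⊥; x∈p∧x≢y⇒x∈p-y; p─q⊆p; x∈⁅x⁆; p⊆q⇒∣p∣≤∣q∣; ∣⁅x⁆∣≡1; ∣⊥∣≡0;
         ⊆-antisym; nonempty?; Empty-unique)
  renaming (_∈?_ to _∈ˢ?_)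
import Data.Integer as ℤ
import Data.Integer.Properties as ℤₚ
open import Data.List
  using (List; []; _∷_; _++_; map; filter; length; foldr; concatMap; cartesianProduct; cartesianProductWith; mapMaybe;
         allFin; upTo; applyUpTo)
open import Data.List.Membership.Propositional using (_∈_; _∉_; find; lose)
open import Data.List.Membership.Propositional.Properties
  using (∈-∃++; ∈-map⁺; ∈-map⁻; ∈-++⁺ˡ; ∈-++⁺ʳ; ∈-++⁻; ∈-filter⁺; ∈-filter⁻; ∈-concatMap⁺; ∈-concatMap⁻; ∈-allFin;
         ∈-upTo⁺; ∈-upTo⁻; ∈-cartesianProductWith⁻)
open import Data.List.Membership.Propositional.Properties.WithK using (unique∧set⇒bag)
import Data.List.Properties as Listₚ
open import Data.List.Relation.Binary.BagAndSetEquality using (∼bag⇒↭)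
open import Data.List.Relation.Binary.Permutation.Propositional as ↭
  using (_↭_; refl; prep; swap; ↭-sym; ↭-trans; ↭-reflexive; module PermutationReasoning)
open import Data.List.Relation.Binary.Permutation.Propositional.Properties as ↭ₚ
  using (∈-resp-↭; All-resp-↭; ↭-length; drop-∷; shift; shifts; filter-↭)
import Data.List.Relation.Binary.Permutation.Setoid.Properties as ↭ₛ
open import Data.List.Relation.Unary.All as All using (All; []; _∷_)
import Data.List.Relation.Unary.All.Properties as Allₚ
open import Data.List.Relation.Unary.AllPairs as AllPairs using (AllPairs; []; _∷_; allPairs?)
import Data.List.Relation.Unary.AllPairs.Properties as AllPairsₚ
open import Data.List.Relation.Unary.Any as Any using (Any; here; there)
import Data.List.Relation.Unary.Unique.DecPropositional as UniqueDec
open import Data.List.Relation.Unary.Unique.Propositional using (Unique)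
open import Data.List.Relation.Unary.Unique.Propositional.Properties as Uniqueₚ using (Unique[x∷xs]⇒x∉xs)
open import Data.Nat using (zero; suc; _<_; z≤n; s≤s)
import Data.Nat as ℕ
open import Data.Nat.Combinatorics using (nCn≡1; nCk+nC[k+1]≡[n+1]C[k+1])
open import Data.Nat.ListAction using (product)
import Data.Nat.Properties as ℕₚ
open import Data.List.Extrema ℕₚ.≤-totalOrder using (argmax; argmax-sel; f[xs]≤f[argmax])
open import Data.Nat.Solver using (module +-*-Solver)
open import Data.Product as Product× using (∃; _×_; proj₁; proj₂)
open import Data.Rational using (ℚ; 0ℚ; 1ℚ)
import Data.Rational as ℚ
import Data.Rational.Properties as ℚₚ
import Data.Rational.Unnormalised as ℚᵘ
open import Data.Rational.Unnormalised using (mkℚᵘ; *≡*)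
import Data.Rational.Unnormalised.Properties as ℚᵘₚ
open import Data.Sum using (_⊎_; inj₁; inj₂; isInj₁; isInj₂; [_,_]′)
open import Data.Vec using (Vec; []; _∷_; toList; here; there)
import Data.Vec as Vec
import Data.Vec.Properties as Vecₚ
open import Data.Vec.Relation.Unary.Linked using (Linked; []; [-]; _∷_; linked?)
open import Function using (_∘_; id; _⇔_; mk⇔; Equivalence)
open import Function.Definitions using (Injective)
open import Relation.Binary.Construct.Closure.Equivalence as Eq using (EqClosure)
open import Relation.Binary.Construct.Closure.ReflexiveTransitive using (ε; _◅_; _◅◅_; gmap)
open import Relation.Binary.Construct.Closure.Symmetric using (SymClosure; fwd; bwd)
open import Relation.Binary.Core using (_Preserves_⟶_)
open import Relation.Binary.Definitions using (tri<; tri≈; tri>)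
open import Relation.Binary.PropositionalEquality
  using (_≢_; refl; sym; trans; cong; cong₂; subst; setoid; module ≡-Reasoning)
open import Relation.Nullary using (¬_; Dec; yes; no; does; contradiction)
open import Relation.Nullary.Decidable
  using (¬?; _⊎-dec_; _×-dec_; _→-dec_; map′; does-⇔; dec-true; dec-false)
open import Relation.Unary using (Pred; Decidable)

-- Finite sums and products

-- The definition takes `τ` at the first root of `F`, whereas only arborescences rooted at the glued
-- vertex split into two; this gap is why independence of the root matters. Acyclicity is awkward
-- under gluing and under the exchange of arcs, so arborescences are replaced by in-trees, in which
-- every vertex but the root is the source of exactly one arc. Parallel arcs and repeated edges have
-- to be counted separately, so arcs and edges are kept in lists and compared up to permutation. The
-- conventions 0/0 = 1 and Tr_{0;0} = (m - 1)^(n - 1) make a side without edges obey the same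
-- formula as any other: t/d times ω is (m - 1)^(n - 1) times the degree of u times the number of
-- in-trees, divided by the degree product, where the degree of u is read as 1 if u is not a vertex
-- of the sequence. A nonempty Eulerian sequence on one side that never has root u is part of no F
-- counted on the left, and on the right its factor t/d is 0.

module BigOp {C : Set} {_∙_ : Op₂ C} {ε : C} (isCM : IsCommutativeMonoid _≡_ _∙_ ε) where
  open IsCommutativeMonoid isCM using (assoc; comm; identityˡ; identityʳ)
  open ≡-Reasoning

  private
    variable
      A B D : Set

  ⨁ : List A → (A → C) → C
  ⨁ xs f = foldr _∙_ ε (map f xs)

  -- A filter turned into neutral terms no longer affects the index list, so it commutes with the
  -- exchange of two sums.
  infixr 6 _when_
  _when_ : C → Bool → C
  c when b = if b then c else ε

  private
    interchange : ∀ a b c d → (a ∙ b) ∙ (c ∙ d) ≡ (a ∙ c) ∙ (b ∙ d)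
    interchange a b c d = begin
      (a ∙ b) ∙ (c ∙ d) ≡⟨ assoc a b _ ⟩
      a ∙ (b ∙ (c ∙ d)) ≡⟨ cong (a ∙_) (sym (assoc b c d)) ⟩
      a ∙ ((b ∙ c) ∙ d) ≡⟨ cong (λ z → a ∙ (z ∙ d)) (comm b c) ⟩
      a ∙ ((c ∙ b) ∙ d) ≡⟨ cong (a ∙_) (assoc c b d) ⟩
      a ∙ (c ∙ (b ∙ d)) ≡⟨ sym (assoc a c _) ⟩
      (a ∙ c) ∙ (b ∙ d) ∎

  ⨁-cong-∈ : ∀ (xs : List A) {f g} → (∀ {x} → x ∈ xs → f x ≡ g x) → ⨁ xs f ≡ ⨁ xs g
  ⨁-cong-∈ []       h = refl
  ⨁-cong-∈ (x ∷ xs) h = cong₂ _∙_ (h (here refl)) (⨁-cong-∈ xs (h ∘ there))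

  ⨁-cong : ∀ (xs : List A) {f g} → (∀ x → f x ≡ g x) → ⨁ xs f ≡ ⨁ xs g
  ⨁-cong xs h = ⨁-cong-∈ xs (λ {x} _ → h x)

  ⨁-ε : ∀ (xs : List A) → ⨁ xs (λ _ → ε) ≡ ε
  ⨁-ε []       = refl
  ⨁-ε (x ∷ xs) = trans (identityˡ _) (⨁-ε xs)

  ⨁-++ : ∀ (xs ys : List A) f → ⨁ (xs ++ ys) f ≡ ⨁ xs f ∙ ⨁ ys f
  ⨁-++ []       ys f = sym (identityˡ _)
  ⨁-++ (x ∷ xs) ys f = trans (cong (f x ∙_) (⨁-++ xs ys f)) (sym (assoc (f x) _ _))

  ⨁-∙ : ∀ (xs : List A) f g → ⨁ xs (λ x → f x ∙ g x) ≡ ⨁ xs f ∙ ⨁ xs g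
  ⨁-∙ []       f g = sym (identityˡ ε)
  ⨁-∙ (x ∷ xs) f g = trans (cong ((f x ∙ g x) ∙_) (⨁-∙ xs f g)) (interchange (f x) (g x) _ _)

  ⨁-swap : ∀ (xs : List A) (ys : List B) (f : A → B → C) →
           ⨁ xs (λ x → ⨁ ys (f x)) ≡ ⨁ ys (λ y → ⨁ xs (λ x → f x y))
  ⨁-swap []       ys f = sym (⨁-ε ys)
  ⨁-swap (x ∷ xs) ys f =
    trans (cong (⨁ ys (f x) ∙_) (⨁-swap xs ys f)) (sym (⨁-∙ ys (f x) _))

  ⨁-map : ∀ (g : A → B) xs f → ⨁ (map g xs) f ≡ ⨁ xs (f ∘ g)
  ⨁-map g []       f = refl
  ⨁-map g (x ∷ xs) f = cong (f (g x) ∙_) (⨁-map g xs f)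

  ⨁-cartesianProductWith : ∀ (g : A → B → D) xs ys f →
    ⨁ (cartesianProductWith g xs ys) f ≡ ⨁ xs (λ x → ⨁ ys (λ y → f (g x y)))
  ⨁-cartesianProductWith g []       ys f = refl
  ⨁-cartesianProductWith g (x ∷ xs) ys f =
    trans (⨁-++ (map (g x) ys) _ f)
          (cong₂ _∙_ (⨁-map (g x) ys f) (⨁-cartesianProductWith g xs ys f))

  ⨁-↭ : ∀ {xs ys : List A} f → xs ↭ ys → ⨁ xs f ≡ ⨁ ys f
  ⨁-↭ f refl         = refl
  ⨁-↭ f (prep x p)   = cong (f x ∙_) (⨁-↭ f p)
  ⨁-↭ f (swap x y p) =
    trans (sym (assoc (f x) (f y) _)) (trans (cong₂ _∙_ (comm (f x) (f y)) (⨁-↭ f p)) (assoc (f y) (f x) _))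
  ⨁-↭ f (↭.trans p q) = trans (⨁-↭ f p) (⨁-↭ f q)

  ⨁-filter : ∀ {ℓ} {P : Pred A ℓ} (P? : Decidable P) xs f →
             ⨁ (filter P? xs) f ≡ ⨁ xs (λ x → f x when does (P? x))
  ⨁-filter P? []       f = refl
  ⨁-filter P? (x ∷ xs) f with does (P? x)
  ... | true  = cong (f x ∙_) (⨁-filter P? xs f)
  ... | false = trans (⨁-filter P? xs f) (sym (identityˡ _))

  ⨁-when : ∀ (xs : List A) f b → ⨁ xs (λ x → f x when b) ≡ ⨁ xs f when b
  ⨁-when xs f true  = refl
  ⨁-when xs f false = ⨁-ε xs

module Sum     = BigOp ℕₚ.+-0-isCommutativeMonoid
module Product = BigOp ℕₚ.*-1-isCommutativeMonoid
module Sumℚ    = BigOp ℚₚ.+-0-isCommutativeMonoid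

*-distribˡ-Sum : ∀ {A : Set} c (xs : List A) f → c ℕ.* Sum.⨁ xs f ≡ Sum.⨁ xs (λ x → c ℕ.* f x)
*-distribˡ-Sum c []       f = ℕₚ.*-zeroʳ c
*-distribˡ-Sum c (x ∷ xs) f =
  trans (ℕₚ.*-distribˡ-+ c (f x) _) (cong ((c ℕ.* f x) +_) (*-distribˡ-Sum c xs f))

*-distribʳ-Sum : ∀ {A : Set} c (xs : List A) f → Sum.⨁ xs f ℕ.* c ≡ Sum.⨁ xs (λ x → f x ℕ.* c)
*-distribʳ-Sum c []       f = refl
*-distribʳ-Sum c (x ∷ xs) f =
  trans (ℕₚ.*-distribʳ-+ c (f x) _) (cong (f x ℕ.* c +_) (*-distribʳ-Sum c xs f))

*-distribˡ-∑ : ∀ {A : Set} c (xs : List A) f → c * ∑ xs f ≡ ∑ xs (λ x → c * f x)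
*-distribˡ-∑ c []       f = ℚₚ.*-zeroʳ c
*-distribˡ-∑ c (x ∷ xs) f =
  trans (ℚₚ.*-distribˡ-+ c (f x) _) (cong ((c * f x) ℚ.+_) (*-distribˡ-∑ c xs f))

*-distribʳ-∑ : ∀ {A : Set} c (xs : List A) f → ∑ xs f * c ≡ ∑ xs (λ x → f x * c)
*-distribʳ-∑ c []       f = ℚₚ.*-zeroˡ c
*-distribʳ-∑ c (x ∷ xs) f =
  trans (ℚₚ.*-distribʳ-+ c (f x) _) (cong (f x * c ℚ.+_) (*-distribʳ-∑ c xs f))

Sum-mono : ∀ {A : Set} (xs : List A) {f g : A → ℕ} → (∀ {x} → x ∈ xs → f x ≤ g x) → Sum.⨁ xs f ≤ Sum.⨁ xs g
Sum-mono []       h = z≤n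
Sum-mono (x ∷ xs) h = ℕₚ.+-mono-≤ (h (here refl)) (Sum-mono xs (h ∘ there))

length-filter≡Sum : ∀ {A : Set} {ℓ} {P : Pred A ℓ} (P? : Decidable P) xs →
                    length (filter P? xs) ≡ Sum.⨁ xs (λ x → 1 Sum.when does (P? x))
length-filter≡Sum P? []       = refl
length-filter≡Sum P? (x ∷ xs) with does (P? x)
... | true  = cong suc (length-filter≡Sum P? xs)
... | false = length-filter≡Sum P? xs

filter-⇔ : ∀ {A : Set} {ℓ} {P Q : Pred A ℓ} (P? : Decidable P) (Q? : Decidable Q) xs →
           (∀ {x} → x ∈ xs → P x ⇔ Q x) → filter P? xs ≡ filter Q? xs
filter-⇔ P? Q? []       h = refl
filter-⇔ P? Q? (x ∷ xs) h with does (P? x) | does (Q? x) | does-⇔ (h (here refl)) (P? x) (Q? x)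
... | true  | .true  | refl = cong (x ∷_) (filter-⇔ P? Q? xs (h ∘ there))
... | false | .false | refl = filter-⇔ P? Q? xs (h ∘ there)

-- Arborescences as in-trees

private
  variable
    A B : Set
    d k l n : ℕ

Unique-↭ : ∀ {A : Set} {xs ys : List A} → xs ↭ ys → Unique xs → Unique ys
Unique-↭ p = ↭ₛ.Unique-resp-↭ (setoid _) (↭.↭⇒↭ₛ p)

∈-∃↭ : ∀ {A : Set} {x : A} {xs} → x ∈ xs → ∃ λ ys → xs ↭ x ∷ ys
∈-∃↭ x∈ with hs , ts , refl ← ∈-∃++ x∈ = hs ++ ts , shift _ hs ts

filter-complement-↭ : ∀ {A : Set} {ℓ} {P : Pred A ℓ} (P? : Decidable P) xs →
                      filter P? xs ++ filter (¬? ∘ P?) xs ↭ xs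
filter-complement-↭ P? []       = refl
filter-complement-↭ P? (x ∷ xs) with does (P? x)
... | true  = prep x (filter-complement-↭ P? xs)
... | false = ↭-trans (shift x (filter P? xs) _) (prep x (filter-complement-↭ P? xs))

sources : List (Arc n) → List (Fin n)
sources = map proj₁

sources-functional : ∀ (T : List (Arc n)) → Unique (sources T) →
                     ∀ {v w w′} → (v , w) ∈ T → (v , w′) ∈ T → w ≡ w′
sources-functional (a ∷ T) (_ ∷ _)  (here refl) (here refl) = refl
sources-functional (a ∷ T) (a∉ ∷ _) (here refl) (there j)   = contradiction refl (All.lookup a∉ (∈-map⁺ proj₁ j))
sources-functional (a ∷ T) (a∉ ∷ _) (there i)   (here refl) = contradiction refl (All.lookup a∉ (∈-map⁺ proj₁ i))
sources-functional (a ∷ T) (_ ∷ us) (there i)   (there j)   = sources-functional T us i j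

Reaches-⊆ : ∀ {T T′ : List (Arc n)} → (∀ {a} → a ∈ T → a ∈ T′) → ∀ {v w} → Reaches T v w → Reaches T′ v w
Reaches-⊆ T⊆ = gmap id T⊆

-- The part of a path before its first use of `a` lies in `T` and ends at the source of `a`.
Reaches-first : ∀ {T : List (Arc n)} {a v w} → Reaches (a ∷ T) v w → Reaches T v w ⊎ Reaches T v (proj₁ a)
Reaches-first ε                = inj₁ ε
Reaches-first (here refl ◅ _)  = inj₂ ε
Reaches-first (there i ◅ p) with Reaches-first p
... | inj₁ q = inj₁ (i ◅ q)
... | inj₂ q = inj₂ (i ◅ q)

Reaches⇒EqClosure : ∀ {T : List (Arc n)} {v w} → Reaches T v w → EqClosure (T ∋_⟶_) v w
Reaches⇒EqClosure = gmap id fwd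

module _ {n : ℕ} (v : Fin n) where

  Incident : Arc n → Set
  Incident (x , y) = x ≡ v ⊎ y ≡ v

  incident? : Decidable Incident
  incident? (x , y) = (x Finₚ.≟ v) ⊎-dec (y Finₚ.≟ v)

  delete : List (Arc n) → List (Arc n)
  delete = filter (¬? ∘ incident?)

  private
    avoids : ∀ {T y z} → y ≢ v → z ≢ v → SymClosure (T ∋_⟶_) y z → SymClosure (delete T ∋_⟶_) y z
    avoids y≢ z≢ (fwd i) = fwd (∈-filter⁺ (¬? ∘ incident?) i λ { (inj₁ e) → y≢ e ; (inj₂ e) → z≢ e })
    avoids y≢ z≢ (bwd i) = bwd (∈-filter⁺ (¬? ∘ incident?) i λ { (inj₁ e) → z≢ e ; (inj₂ e) → y≢ e })

    stuck : ∀ {T w} → EqClosure (delete T ∋_⟶_) v w → v ≡ w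
    stuck ε = refl
    stuck {T} (fwd i ◅ _) = contradiction (inj₁ refl) (proj₂ (∈-filter⁻ (¬? ∘ incident?) {xs = T} i))
    stuck {T} (bwd i ◅ _) = contradiction (inj₂ refl) (proj₂ (∈-filter⁻ (¬? ∘ incident?) {xs = T} i))

    -- After its last departure from `v` a walk meets no arc at `v`, so the rest of it lives in a
    -- strictly smaller list of arcs.
    LastExit : List (Arc n) → Fin n → Set
    LastExit T w = v ≡ w ⊎ ∃ λ z → SymClosure (T ∋_⟶_) v z × EqClosure (delete T ∋_⟶_) z w

    lastExit′ : ∀ {T y w} → EqClosure (T ∋_⟶_) y w → EqClosure (delete T ∋_⟶_) y w ⊎ LastExit T w
    lastExit′ ε = inj₁ ε
    lastExit′ {T} {y} (_◅_ {j = z} s p) with lastExit′ p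
    ... | inj₂ q = inj₂ q
    ... | inj₁ q with y Finₚ.≟ v | z Finₚ.≟ v
    ...   | yes refl | _        = inj₂ (inj₂ (z , s , q))
    ...   | no _     | yes refl = inj₂ (inj₁ (stuck {T} q))
    ...   | no y≢    | no z≢    = inj₁ (avoids y≢ z≢ s ◅ q)

  lastExit : ∀ {T w} → EqClosure (T ∋_⟶_) v w → LastExit T w
  lastExit {T} p with lastExit′ p
  ... | inj₁ q = inj₁ (stuck {T} q)
  ... | inj₂ q = q

-- A walk is shortened to a trail by leaving its starting vertex only once, for the last time.
trail : ∀ (T : List (Arc n)) {v w} → EqClosure (T ∋_⟶_) v w →
        ∃ λ c → ∃ λ rest → c ++ rest ↭ T × UndirectedWalk v c w
trail T p = bounded (length T) T ℕₚ.≤-refl p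
  where
  bounded : ∀ k (T : List (Arc n)) → length T ≤ k → ∀ {v w} → EqClosure (T ∋_⟶_) v w →
            ∃ λ c → ∃ λ rest → c ++ rest ↭ T × UndirectedWalk v c w

  extend : ∀ k (T : List (Arc n)) → length T ≤ k → ∀ {v z w a} → a ∈ T → Incident v a →
           (∀ {c} → UndirectedWalk z c w → UndirectedWalk v (a ∷ c) w) →
           EqClosure (delete v T ∋_⟶_) z w →
           ∃ λ c → ∃ λ rest → c ++ rest ↭ T × UndirectedWalk v c w
  extend zero    [] _ () _ _ _
  extend (suc k) T T≤ {v} {a = a} a∈ av step p
    with bounded k (delete v T) (ℕₚ.≤-pred (ℕₚ.≤-trans (Listₚ.filter-notAll (¬? ∘ incident? v) T (lose a∈ λ f → f av)) T≤)) p
       | ∈-∃↭ (∈-filter⁺ (incident? v) a∈ av)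
  ... | c , rest , c↭ , walk | I , I↭ =
    a ∷ c , rest ++ I , perm , step walk
    where
    open ↭.PermutationReasoning
    perm : a ∷ c ++ rest ++ I ↭ T
    perm = begin
      a ∷ c ++ rest ++ I    ≡⟨ cong (a ∷_) (sym (Listₚ.++-assoc c rest I)) ⟩
      a ∷ (c ++ rest) ++ I  ↭⟨ ↭-sym (shift a (c ++ rest) I) ⟩
      (c ++ rest) ++ a ∷ I  ↭⟨ ↭ₚ.++⁺ c↭ (↭-sym I↭) ⟩
      delete v T ++ filter (incident? v) T ↭⟨ ↭ₚ.++-comm (delete v T) _ ⟩
      filter (incident? v) T ++ delete v T ↭⟨ filter-complement-↭ (incident? v) T ⟩
      T                     ∎

  bounded k T T≤ {v} p with lastExit v p
  ... | inj₁ refl             = [] , T , refl , refl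
  ... | inj₂ (z , fwd i , q)  = extend k T T≤ i (inj₁ refl) (λ walk → inj₁ (refl , walk)) q
  ... | inj₂ (z , bwd i , q)  = extend k T T≤ i (inj₂ refl) (λ walk → inj₂ (refl , walk)) q

UndirectedWalk-∷ʳ : ∀ (c : List (Arc n)) {u v w z} → UndirectedWalk u c v → UndirectedWalk v ((w , z) ∷ []) w →
                     UndirectedWalk u (c ++ (w , z) ∷ []) w
UndirectedWalk-∷ʳ []      refl            q = q
UndirectedWalk-∷ʳ (_ ∷ c) (inj₁ (e , p)) q = inj₁ (e , UndirectedWalk-∷ʳ c p q)
UndirectedWalk-∷ʳ (_ ∷ c) (inj₂ (e , p)) q = inj₂ (e , UndirectedWalk-∷ʳ c p q)

-- An undirected trail with distinct sources runs forwards and then backwards.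
private
  backward-part : ∀ (c : List (Arc n)) {v w} → Unique (v ∷ sources c) → UndirectedWalk v c w →
                  w ∈ v ∷ sources c × (∀ {a} → a ∈ c → proj₂ a ∈ v ∷ sources c)
  backward-part []            us refl = here refl , λ ()
  backward-part ((p , q) ∷ c) us        (inj₁ (refl , _)) = contradiction (here refl) (Unique[x∷xs]⇒x∉xs us)
  backward-part ((p , q) ∷ c) (_ ∷ us)  (inj₂ (refl , walk)) with backward-part c us walk
  ... | w∈ , targets = there w∈ , λ { (here refl) → here refl ; (there i) → there (targets i) }

  forward-part : ∀ (c : List (Arc n)) {v w} → Unique (sources c) → UndirectedWalk v c w →
                 (v ∈ w ∷ sources c × (∀ {a} → a ∈ c → proj₂ a ∈ w ∷ sources c)) ⊎ w ∈ sources c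
  forward-part []            us refl = inj₁ (here refl , λ ())
  forward-part ((p , q) ∷ c) us       (inj₂ (refl , walk)) = inj₂ (proj₁ (backward-part c us walk))
  forward-part {n} ((p , q) ∷ c) {w = w} (_ ∷ us) (inj₁ (refl , walk)) with forward-part c us walk
  ... | inj₂ w∈             = inj₂ (there w∈)
  ... | inj₁ (q∈ , targets) = inj₁ (there (here refl) , λ { (here refl) → weaken q∈ ; (there i) → weaken (targets i) })
    where
    weaken : ∀ {y : Fin n} → y ∈ w ∷ sources c → y ∈ w ∷ p ∷ sources c
    weaken (here e)  = here e
    weaken (there i) = there (there i)

-- The trail is a directed cycle, run forwards or backwards: if it left `v` forwards and came back
-- to `v` backwards, two of its arcs would have source `v`. In a directed cycle the target of an arc
-- is the source of an adjacent one.
closed-targets : ∀ (c : List (Arc n)) {v} → Unique (sources c) → UndirectedWalk v c v →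
                 ∀ {a} → a ∈ c → proj₂ a ∈ sources c
closed-targets []            us walk ()
closed-targets ((p , q) ∷ c) us@(_ ∷ us′) (inj₁ (refl , walk)) i with forward-part c us′ walk | i
... | inj₂ p∈             | _         = contradiction p∈ (Unique[x∷xs]⇒x∉xs us)
... | inj₁ (q∈ , targets) | here refl = q∈
... | inj₁ (q∈ , targets) | there j   = targets j
closed-targets ((p , q) ∷ c) us (inj₂ (refl , walk)) i with backward-part c us walk | i
... | v∈ , targets | here refl = v∈
... | v∈ , targets | there j   = targets j

-- Distinctness of `x ∷ sources T` says that no arc leaves the root and at most one leaves any other
-- vertex. Together with reachability this is a local substitute for acyclicity.
record InTree (V : Subset n) (x : Fin n) (T : List (Arc n)) : Set where
  constructor inTree
  field
    unique  : Unique (x ∷ sources T)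
    reaches : ∀ {v} → v ∈ˢ V → Reaches T v x

open InTree

Within : Subset n → List (Arc n) → Set
Within V T = ∀ {a} → a ∈ T → proj₁ a ∈ˢ V × proj₂ a ∈ˢ V

-- The sources on a cycle are closed under following their only outgoing arc, so a path that starts
-- on a cycle never gets to the root.
InTree-acyclic : ∀ {V : Subset n} {x T} → Within V T → InTree V x T → ¬ HasCycle T
InTree-acyclic _ _ ([] , _ , _ , ne , _) = ne refl
InTree-acyclic {x = x} {T} within (inTree us@(_ ∷ us′) reach) (c@((p , q) ∷ _) , rest , c↭ , _ , v , walk) =
  trapped (here refl) (reach (proj₁ (within (c⊆ (here refl)))))
  where
  c⊆ : ∀ {a} → a ∈ c → a ∈ T
  c⊆ i = ∈-resp-↭ c↭ (∈-++⁺ˡ i)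
  c-unique : Unique (sources c)
  c-unique = unique-++ˡ c (Unique-↭ (↭ₚ.map⁺ proj₁ (↭-sym c↭)) us′)
    where
    unique-++ˡ : ∀ c → Unique (sources (c ++ rest)) → Unique (sources c)
    unique-++ˡ []      _        = []
    unique-++ˡ (a ∷ c) (p ∷ us) =
      All.tabulate (λ i → All.lookup p (subst (_ ∈_) (sym (Listₚ.map-++ proj₁ c rest)) (∈-++⁺ˡ i))) ∷ unique-++ˡ c us
  trapped : ∀ {y} → y ∈ sources c → Reaches T y x → ⊥
  trapped y∈ ε with ∈-map⁻ proj₁ y∈
  ... | a , a∈ , refl = Unique[x∷xs]⇒x∉xs us (∈-map⁺ proj₁ (c⊆ a∈))
  trapped y∈ (i ◅ path) with ∈-map⁻ proj₁ y∈
  ... | a , a∈ , refl with sources-functional T us′ i (c⊆ a∈)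
  ...   | refl = trapped (closed-targets c c-unique walk a∈) path

private
  -- The hypothesis speaks of two positions in `T`, not of two different arcs, so that it also
  -- excludes parallel arcs.
  unique-sources : ∀ (T : List (Arc n)) → (∀ {v a b T′} → ¬ (T ↭ (v , a) ∷ (v , b) ∷ T′)) → Unique (sources T)
  unique-sources []            h = []
  unique-sources ((v , a) ∷ T) h = All.tabulate fresh ∷ unique-sources T tail
    where
    fresh : ∀ {w} → w ∈ sources T → v ≢ w
    fresh w∈ refl with ∈-map⁻ proj₁ w∈
    ... | (_ , b) , b∈ , refl with ∈-∃↭ b∈
    ...   | T′ , T↭ = h (prep _ T↭)
    tail : ∀ {w b c T′} → ¬ (T ↭ (w , b) ∷ (w , c) ∷ T′)
    tail p = h (↭-trans (prep _ p) (↭-trans (swap _ _ refl) (prep _ (swap _ _ refl))))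

-- An arc out of the root closes a cycle with a path from its target back to the root. Of two arcs
-- out of `v`, either one closes a cycle with a path back to `v`, or both targets reach the root
-- without these arcs; then a trail between the targets and the two arcs form a cycle.
acyclic⇒unique : ∀ {V : Subset n} {x T} → Within V T → ¬ HasCycle T →
                 (∀ {v} → v ∈ˢ V → Reaches T v x) → Unique (x ∷ sources T)
acyclic⇒unique {n} {V} {x} {T} within acyclic reach = All.tabulate rootless ∷ unique-sources T branching
  where
  loop : ∀ {v y T′} → T ↭ (v , y) ∷ T′ → Reaches T′ y v → ⊥
  loop T↭ path with trail _ (Reaches⇒EqClosure path)
  ... | c , rest , c↭ , walk =
    acyclic (_ ∷ c , rest , ↭-trans (prep _ c↭) (↭-sym T↭) , (λ ()) , _ , inj₁ (refl , walk))

  rootless : ∀ {v} → v ∈ sources T → x ≢ v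
  rootless v∈ refl with ∈-map⁻ proj₁ v∈
  ... | (_ , y) , a∈ , refl with ∈-∃↭ a∈
  -- The removed arc starts at the root itself, so both alternatives give a path to `x` that avoids
  -- it.
  ...   | T′ , T↭ with Reaches-first (Reaches-⊆ (∈-resp-↭ T↭) (reach (proj₂ (within a∈))))
  ...     | inj₁ path = loop T↭ path
  ...     | inj₂ path = loop T↭ path

  branching : ∀ {v a b T′} → ¬ (T ↭ (v , a) ∷ (v , b) ∷ T′)
  branching {v} {a} {b} {T′} T↭ = cases (escape (here refl)) (escape (there (here refl)))
    where
    escape : ∀ {y} → (v , y) ∈ (v , a) ∷ (v , b) ∷ T′ → Reaches T′ y x ⊎ Reaches T′ y v
    escape i with Reaches-first (Reaches-⊆ (∈-resp-↭ T↭) (reach (proj₂ (within (∈-resp-↭ (↭-sym T↭) i)))))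
    ... | inj₁ p = Reaches-first p
    ... | inj₂ p with Reaches-first p
    ...   | inj₁ q = inj₂ q
    ...   | inj₂ q = inj₂ q
    cases : Reaches T′ a x ⊎ Reaches T′ a v → Reaches T′ b x ⊎ Reaches T′ b v → ⊥
    cases (inj₂ p) _        = loop T↭ (Reaches-⊆ there p)
    cases (inj₁ p) (inj₂ q) = loop (↭-trans T↭ (swap _ _ refl)) (Reaches-⊆ there q)
    -- The two paths to the root may share arcs; `trail` selects arcs used at most once between `a`
    -- and `b`.
    cases (inj₁ p) (inj₁ q)
      with trail T′ (Reaches⇒EqClosure p ◅◅ Eq.symmetric _ (Reaches⇒EqClosure q))
    ... | c , rest , c↭ , walk =
      acyclic ((v , a) ∷ (c ++ (v , b) ∷ []) , rest , perm , (λ ()) , v ,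
               inj₁ (refl , UndirectedWalk-∷ʳ c walk (inj₂ (refl , refl))))
      where
      open ↭.PermutationReasoning
      perm : (v , a) ∷ (c ++ (v , b) ∷ []) ++ rest ↭ T
      perm = begin
        (v , a) ∷ (c ++ (v , b) ∷ []) ++ rest ≡⟨ cong (_ ∷_) (Listₚ.++-assoc c _ rest) ⟩
        (v , a) ∷ c ++ (v , b) ∷ rest         ↭⟨ prep _ (shift _ c rest) ⟩
        (v , a) ∷ (v , b) ∷ c ++ rest         ↭⟨ prep _ (prep _ c↭) ⟩
        (v , a) ∷ (v , b) ∷ T′                ↭⟨ ↭-sym T↭ ⟩
        T                                     ∎

IsArborescence⇔InTree : ∀ {G : Multidigraph n} {x T} → Within (vertices G) T →
                         IsArborescence G x T ⇔ InTree (vertices G) x T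
IsArborescence⇔InTree {n} {G} {x} {T} within = mk⇔ to from
  where
  to : IsArborescence G x T → InTree (vertices G) x T
  to (arborescence (tree _ acyclic) reach) = inTree (acyclic⇒unique within acyclic reach′) reach′
    where
    reach′ : ∀ {v} → v ∈ˢ vertices G → Reaches T v x
    reach′ {v} v∈ with v Finₚ.≟ x
    ... | yes refl = ε
    ... | no v≢x   = reach v v∈ v≢x
  from : InTree (vertices G) x T → IsArborescence G x T
  from t = arborescence
    (tree (λ v w v∈ w∈ → Reaches⇒EqClosure (reaches t v∈) ◅◅ Eq.symmetric _ (Reaches⇒EqClosure (reaches t w∈)))
          (InTree-acyclic within t))
    (λ v v∈ _ → reaches t v∈)

-- The number of in-trees and its independence of the root

InTree-↭ : ∀ {n} {V : Subset n} {x T T′} → T ↭ T′ → InTree V x T → InTree V x T′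
InTree-↭ p (inTree us reach) =
  inTree (Unique-↭ (prep _ (↭ₚ.map⁺ proj₁ p)) us) (Reaches-⊆ (∈-resp-↭ p) ∘ reach)

inTree? : ∀ {n} (V : Subset n) x T → Dec (InTree V x T)
inTree? V x T = map′ (λ (us , reach) → inTree us (λ {v} → reach v)) (λ (inTree us reach) → us , λ v → reach {v})
  (UniqueDec.unique? Finₚ._≟_ (x ∷ sources T) ×-dec Finₚ.all? λ v → (v ∈ˢ? V) →-dec reaches? T v x)

-- The arc (y , x) is the last one on the path from z to x, so that z still reaches y without it.
InTree-rotate : ∀ {n} {V : Subset n} {x z T} → z ∈ˢ V → InTree V x T →
                ∃ λ y → ∃ λ T′ → (y , x) ∷ T′ ↭ (x , z) ∷ T × InTree V y T′
InTree-rotate {V = V} {x} {z} {T} z∈ t@(inTree us reach) = by-last-arc (last-arc (reach z∈))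
  where
  last-arc : ∀ {v} → Reaches T v x → v ≡ x ⊎ ∃ λ y → (y , x) ∈ T × Reaches T v y
  last-arc ε = inj₁ refl
  last-arc (i ◅ p) with last-arc p
  ... | inj₁ refl          = inj₂ (_ , i , ε)
  ... | inj₂ (y , j , q)   = inj₂ (y , j , i ◅ q)

  by-last-arc : z ≡ x ⊎ (∃ λ y → (y , x) ∈ T × Reaches T z y) →
                ∃ λ y → ∃ λ T′ → (y , x) ∷ T′ ↭ (x , z) ∷ T × InTree V y T′
  -- The added arc is a loop at the root: it is the whole cycle and is taken away again.
  by-last-arc (inj₁ refl) = x , T , refl , t
  by-last-arc (inj₂ (y , i , z⟶y)) with ∈-∃↭ i
  ... | T′ , T↭ = y , (x , z) ∷ T′ , ↭-trans (swap _ _ refl) (prep _ (↭-sym T↭)) , inTree us′ reach′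
    where
    us′ : Unique (y ∷ x ∷ sources T′)
    us′ = Unique-↭ (↭-trans (prep x (↭ₚ.map⁺ proj₁ T↭)) (swap x y refl)) us
    z⟶y′ : Reaches T′ z y
    z⟶y′ with Reaches-first (Reaches-⊆ (∈-resp-↭ T↭) z⟶y)
    ... | inj₁ p = p
    ... | inj₂ p = p
    reach′ : ∀ {v} → v ∈ˢ V → Reaches ((x , z) ∷ T′) v y
    reach′ v∈ with Reaches-first (Reaches-⊆ (∈-resp-↭ T↭) (reach v∈))
    ... | inj₁ v⟶x = Reaches-⊆ there v⟶x ◅◅ here refl ◅ Reaches-⊆ there z⟶y′
    ... | inj₂ v⟶y = Reaches-⊆ there v⟶y

-- Sums over sublists and over marked entries

module _ {A : Set} where
  open Sum

  ↭-Invariant : (List A → ℕ) → Set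
  ↭-Invariant f = ∀ {S T} → S ↭ T → f S ≡ f T

  sublists-⊆ : ∀ (xs : List A) {S} → S ∈ sublists xs → ∀ {a} → a ∈ S → a ∈ xs
  sublists-⊆ []       (here refl) ()
  sublists-⊆ (x ∷ xs) S∈ a∈ with ∈-++⁻ (map (x ∷_) (sublists xs)) S∈
  ... | inj₂ S∈′ = there (sublists-⊆ xs S∈′ a∈)
  ... | inj₁ S∈′ with ∈-map⁻ (x ∷_) S∈′ | a∈
  ...   | S′ , S′∈ , refl | here refl = here refl
  ...   | S′ , S′∈ , refl | there a∈′ = there (sublists-⊆ xs S′∈ a∈′)

  Sum-sublists-∷ : ∀ (x : A) xs (f : List A → ℕ) → ⨁ (sublists (x ∷ xs)) f ≡ ⨁ (sublists xs) (f ∘ (x ∷_)) + ⨁ (sublists xs) f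
  Sum-sublists-∷ x xs f =
    trans (⨁-++ (map (x ∷_) (sublists xs)) _ f) (cong (_+ _) (⨁-map (x ∷_) (sublists xs) f))

  Sum-sublists-++ : ∀ xs ys (f : List A → ℕ) →
    ⨁ (sublists (xs ++ ys)) f ≡ ⨁ (sublists xs) (λ S → ⨁ (sublists ys) (λ T → f (S ++ T)))
  Sum-sublists-++ []       ys f = sym (ℕₚ.+-identityʳ _)
  Sum-sublists-++ (x ∷ xs) ys f = begin
    ⨁ (sublists (x ∷ xs ++ ys)) f
      ≡⟨ Sum-sublists-∷ x (xs ++ ys) f ⟩
    ⨁ (sublists (xs ++ ys)) (f ∘ (x ∷_)) + ⨁ (sublists (xs ++ ys)) f
      ≡⟨ cong₂ _+_ (Sum-sublists-++ xs ys _) (Sum-sublists-++ xs ys f) ⟩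
    _ ≡⟨ sym (Sum-sublists-∷ x xs _) ⟩
    ⨁ (sublists (x ∷ xs)) (λ S → ⨁ (sublists ys) (λ T → f (S ++ T))) ∎
    where open ≡-Reasoning

  -- Permuting a list also permutes the entries inside each sublist, hence the invariance of `f`.
  Sum-sublists-↭ : ∀ {xs ys : List A} (f : List A → ℕ) → ↭-Invariant f → xs ↭ ys → ⨁ (sublists xs) f ≡ ⨁ (sublists ys) f
  Sum-sublists-↭ f inv refl = refl
  Sum-sublists-↭ f inv (prep {xs} {ys} x p) = begin
    ⨁ (sublists (x ∷ xs)) f                               ≡⟨ Sum-sublists-∷ x xs f ⟩
    ⨁ (sublists xs) (f ∘ (x ∷_)) + ⨁ (sublists xs) f      ≡⟨ cong₂ _+_ (Sum-sublists-↭ _ (inv ∘ prep x) p) (Sum-sublists-↭ f inv p) ⟩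
    ⨁ (sublists ys) (f ∘ (x ∷_)) + ⨁ (sublists ys) f      ≡⟨ sym (Sum-sublists-∷ x ys f) ⟩
    ⨁ (sublists (x ∷ ys)) f                               ∎
    where open ≡-Reasoning
  Sum-sublists-↭ f inv (swap {xs} {ys} x y p) = begin
    ⨁ (sublists (x ∷ y ∷ xs)) f
      ≡⟨ four x y xs ⟩
    (s xs (f ∘ (x ∷_) ∘ (y ∷_)) + s xs (f ∘ (x ∷_))) + (s xs (f ∘ (y ∷_)) + s xs f)
      ≡⟨ cong₂ _+_ (cong₂ _+_ (trans (⨁-cong (sublists xs) (λ _ → inv (swap x y refl)))
                                      (Sum-sublists-↭ _ (inv ∘ prep y ∘ prep x) p))
                               (Sum-sublists-↭ _ (inv ∘ prep x) p))
                   (cong₂ _+_ (Sum-sublists-↭ _ (inv ∘ prep y) p) (Sum-sublists-↭ f inv p)) ⟩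
    (s ys (f ∘ (y ∷_) ∘ (x ∷_)) + s ys (f ∘ (x ∷_))) + (s ys (f ∘ (y ∷_)) + s ys f)
      ≡⟨ interchange (s ys (f ∘ (y ∷_) ∘ (x ∷_))) _ _ _ ⟩
    (s ys (f ∘ (y ∷_) ∘ (x ∷_)) + s ys (f ∘ (y ∷_))) + (s ys (f ∘ (x ∷_)) + s ys f)
      ≡⟨ sym (four y x ys) ⟩
    ⨁ (sublists (y ∷ x ∷ ys)) f ∎
    where
    open ≡-Reasoning
    s : List A → (List A → ℕ) → ℕ
    s xs = ⨁ (sublists xs)
    four : ∀ x y xs → s (x ∷ y ∷ xs) f ≡
           (s xs (f ∘ (x ∷_) ∘ (y ∷_)) + s xs (f ∘ (x ∷_))) + (s xs (f ∘ (y ∷_)) + s xs f)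
    four x y xs = trans (Sum-sublists-∷ x (y ∷ xs) f)
      (cong₂ _+_ (Sum-sublists-∷ y xs _) (Sum-sublists-∷ y xs f))
    open CommutativeSemigroupProperties ℕₚ.+-commutativeSemigroup using (interchange)
  Sum-sublists-↭ f inv (↭.trans p q) = trans (Sum-sublists-↭ f inv p) (Sum-sublists-↭ f inv q)

  -- One pick for each position, so that parallel arcs are picked separately.
  picks : List A → List (A × List A)
  picks []       = []
  picks (x ∷ xs) = (x , xs) ∷ map (λ (a , ys) → a , x ∷ ys) (picks xs)

  picks-↭ : ∀ xs {a ys} → (a , ys) ∈ picks xs → xs ↭ a ∷ ys
  picks-↭ (x ∷ xs) (here refl) = refl
  picks-↭ (x ∷ xs) (there i) with ∈-map⁻ _ i
  ... | (a , ys) , j , refl = ↭-trans (prep x (picks-↭ xs j)) (swap x a refl)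

  picks-complete : ∀ xs {a} → a ∈ xs → ∃ λ ys → (a , ys) ∈ picks xs
  picks-complete (x ∷ xs) (here refl) = xs , here refl
  picks-complete (x ∷ xs) (there i) with picks-complete xs i
  ... | ys , j = x ∷ ys , there (∈-map⁺ _ j)

  -- A form of distinctness of picks that tolerates repeated entries; it will show that two picks
  -- from one graph cannot both be a tree with an arc leaving its root.
  picks-later∈ : ∀ xs → AllPairs (λ (a , ys) (b , zs) → b ∈ ys) (picks xs)
  picks-later∈ []       = []
  picks-later∈ (x ∷ xs) =
    All.tabulate later ∷ AllPairsₚ.map⁺ (AllPairs.map there (picks-later∈ xs))
    where
    later : ∀ {p} → p ∈ map (λ (a , ys) → a , x ∷ ys) (picks xs) → proj₁ p ∈ xs
    later i with ∈-map⁻ _ i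
    ... | (b , zs) , j , refl = ∈-resp-↭ (↭-sym (picks-↭ xs j)) (here refl)

  Sum-picks-proj₁ : ∀ xs (f : A → ℕ) → ⨁ (picks xs) (f ∘ proj₁) ≡ ⨁ xs f
  Sum-picks-proj₁ []       f = refl
  Sum-picks-proj₁ (x ∷ xs) f =
    cong (f x +_) (trans (⨁-map _ (picks xs) _) (Sum-picks-proj₁ xs f))

  -- Double counting: a marked entry with a sublist of the other entries is a sublist with one
  -- marked entry.
  Sum-picks-sublists : ∀ xs (f : A → List A → ℕ) →
    ⨁ (picks xs) (λ (a , ys) → ⨁ (sublists ys) (f a)) ≡
    ⨁ (sublists xs) (λ S → ⨁ (picks S) (λ (a , T) → f a T))
  Sum-picks-sublists []       f = refl
  Sum-picks-sublists (x ∷ xs) f = begin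
    s (f x) + ⨁ (map _ (picks xs)) (λ (a , ys) → ⨁ (sublists ys) (f a))
      ≡⟨ cong (s (f x) +_) (⨁-map _ (picks xs) _) ⟩
    s (f x) + ⨁ (picks xs) (λ (a , ys) → ⨁ (sublists (x ∷ ys)) (f a))
      ≡⟨ cong (s (f x) +_) (⨁-cong (picks xs) λ (a , ys) → Sum-sublists-∷ x ys (f a)) ⟩
    s (f x) + ⨁ (picks xs) (λ (a , ys) → ⨁ (sublists ys) (f a ∘ (x ∷_)) + ⨁ (sublists ys) (f a))
      ≡⟨ cong (s (f x) +_) (⨁-∙ (picks xs) _ _) ⟩
    s (f x) + (⨁ (picks xs) (λ (a , ys) → ⨁ (sublists ys) (f a ∘ (x ∷_))) +
               ⨁ (picks xs) (λ (a , ys) → ⨁ (sublists ys) (f a)))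
      ≡⟨ cong (s (f x) +_) (cong₂ _+_ (Sum-picks-sublists xs (λ a → f a ∘ (x ∷_))) (Sum-picks-sublists xs f)) ⟩
    s (f x) + (s (λ S → ⨁ (picks S) (λ (a , T) → f a (x ∷ T))) + s (λ S → ⨁ (picks S) (λ (a , T) → f a T)))
      ≡⟨ sym (ℕₚ.+-assoc (s (f x)) _ _) ⟩
    (s (f x) + s (λ S → ⨁ (picks S) (λ (a , T) → f a (x ∷ T)))) + s (λ S → ⨁ (picks S) (λ (a , T) → f a T))
      ≡⟨ cong (_+ s (λ S → ⨁ (picks S) (λ (a , T) → f a T))) (sym (⨁-∙ (sublists xs) _ _)) ⟩
    s (λ S → f x S + ⨁ (picks S) (λ (a , T) → f a (x ∷ T))) + s (λ S → ⨁ (picks S) (λ (a , T) → f a T))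
      ≡⟨ cong (_+ s (λ S → ⨁ (picks S) (λ (a , T) → f a T)))
              (⨁-cong (sublists xs) λ S → cong (f x S +_) (sym (⨁-map _ (picks S) _))) ⟩
    s (λ S → ⨁ (picks (x ∷ S)) (λ (a , T) → f a T)) + s (λ S → ⨁ (picks S) (λ (a , T) → f a T))
      ≡⟨ sym (Sum-sublists-∷ x xs _) ⟩
    ⨁ (sublists (x ∷ xs)) (λ S → ⨁ (picks S) (λ (a , T) → f a T)) ∎
    where
    open ≡-Reasoning
    s : (List A → ℕ) → ℕ
    s = ⨁ (sublists xs)

  ∈⇒≤Sum : ∀ {xs : List A} {x} f → x ∈ xs → f x ≤ ⨁ xs f
  ∈⇒≤Sum f (here refl) = ℕₚ.m≤m+n _ _
  ∈⇒≤Sum f (there i)   = ℕₚ.≤-trans (∈⇒≤Sum f i) (ℕₚ.m≤n+m _ _)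

  -- The equality case that carries a maximum from a vertex to the sources of the arcs entering it.
  Sum-tight : ∀ (xs : List A) {f g} → (∀ {x} → x ∈ xs → f x ≤ g x) → ⨁ xs g ≤ ⨁ xs f →
              ∀ {x} → x ∈ xs → f x ≡ g x
  Sum-tight (x ∷ xs) {f} {g} f≤g g≤f (here refl) =
    ℕₚ.≤-antisym (f≤g (here refl))
      (ℕₚ.+-cancelʳ-≤ (⨁ xs f) (g x) (f x) (ℕₚ.≤-trans (ℕₚ.+-monoʳ-≤ (g x) (Sum-mono xs (f≤g ∘ there))) g≤f))
  Sum-tight (x ∷ xs) {f} {g} f≤g g≤f (there i) =
    Sum-tight xs (f≤g ∘ there)
      (ℕₚ.+-cancelˡ-≤ (f x) _ _ (ℕₚ.≤-trans (ℕₚ.+-monoˡ-≤ _ (f≤g (here refl))) g≤f)) i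

  Sum-at-most-one : ∀ {P : A → Set} (P? : Decidable P) xs → AllPairs (λ x y → P x → ¬ P y) xs →
                    ⨁ xs (λ x → 1 when does (P? x)) ≤ 1
  Sum-at-most-one P? []       []       = z≤n
  Sum-at-most-one P? (x ∷ xs) (p ∷ ps) with P? x
  ... | no _   = Sum-at-most-one P? xs ps
  ... | yes px = ℕₚ.≤-reflexive (cong suc (trans (⨁-cong-∈ xs none) (⨁-ε xs)))
    where
    none : ∀ {y} → y ∈ xs → (1 when does (P? y)) ≡ 0
    none {y} y∈ rewrite dec-false (P? y) (All.lookup p y∈ px) = refl

  maximum-∈ : ∀ (f : A → ℕ) {x} xs → x ∈ xs → ∃ λ y → y ∈ xs × (∀ {z} → z ∈ xs → f z ≤ f y)
  maximum-∈ f {x} xs x∈ = argmax f x xs , member (argmax-sel f x xs) , All.lookup (f[xs]≤f[argmax] x xs)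
    where
    member : argmax f x xs ≡ x ⊎ argmax f x xs ∈ xs → argmax f x xs ∈ xs
    member (inj₁ e) = subst (_∈ xs) (sym e) x∈
    member (inj₂ i) = i

Sum-sublists-map : ∀ {A B : Set} (g : A → B) xs (f : List B → ℕ) →
  Sum.⨁ (sublists (map g xs)) f ≡ Sum.⨁ (sublists xs) (f ∘ map g)
Sum-sublists-map g []       f = refl
Sum-sublists-map g (x ∷ xs) f = begin
  Sum.⨁ (sublists (g x ∷ map g xs)) f
    ≡⟨ Sum-sublists-∷ (g x) (map g xs) f ⟩
  Sum.⨁ (sublists (map g xs)) (f ∘ (g x ∷_)) + Sum.⨁ (sublists (map g xs)) f
    ≡⟨ cong₂ _+_ (Sum-sublists-map g xs _) (Sum-sublists-map g xs f) ⟩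
  _ ≡⟨ sym (Sum-sublists-∷ x xs _) ⟩
  Sum.⨁ (sublists (x ∷ xs)) (f ∘ map g) ∎
  where open ≡-Reasoning

-- Walks, balance and strong connectivity

-- Telescoping, written without subtraction: every inner vertex of the walk is the target of one arc
-- and the source of the next.
Sum-walk : ∀ {n} (f : Fin n → ℕ) w {v v′} → DirectedWalk v w v′ →
           Sum.⨁ w (f ∘ proj₁) + f v′ ≡ Sum.⨁ w (f ∘ proj₂) + f v
Sum-walk f []            refl = refl
Sum-walk f ((x , y) ∷ w) {v′ = v′} (refl , walk) = begin
  f x + s₁ + f v′    ≡⟨ ℕₚ.+-assoc (f x) s₁ _ ⟩
  f x + (s₁ + f v′)  ≡⟨ cong (f x +_) (Sum-walk f w walk) ⟩
  f x + (s₂ + f y)   ≡⟨ ℕₚ.+-comm (f x) _ ⟩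
  s₂ + f y + f x     ≡⟨ cong (_+ f x) (ℕₚ.+-comm s₂ (f y)) ⟩
  f y + s₂ + f x     ∎
  where
  open ≡-Reasoning
  s₁ = Sum.⨁ w (f ∘ proj₁)
  s₂ = Sum.⨁ w (f ∘ proj₂)

-- For `f` a multiple of the indicator of a vertex, this is the equality of its indegree and
-- outdegree.
closed-walk-balanced : ∀ {n} {A w : List (Arc n)} {v} → w ↭ A → DirectedWalk v w v →
                       ∀ f → Sum.⨁ A (f ∘ proj₁) ≡ Sum.⨁ A (f ∘ proj₂)
closed-walk-balanced {A = A} {w} {v} w↭ walk f = begin
  Sum.⨁ A (f ∘ proj₁) ≡⟨ sym (Sum.⨁-↭ _ w↭) ⟩
  Sum.⨁ w (f ∘ proj₁) ≡⟨ ℕₚ.+-cancelʳ-≡ (f v) _ _ (Sum-walk f w walk) ⟩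
  Sum.⨁ w (f ∘ proj₂) ≡⟨ Sum.⨁-↭ _ w↭ ⟩
  Sum.⨁ A (f ∘ proj₂) ∎
  where open ≡-Reasoning

walk-Reaches : ∀ {n} w {v v′ : Fin n} → DirectedWalk v w v′ → ∀ {x} → x ∈ sources w → Reaches w v x × Reaches w x v′
walk-Reaches ((x , y) ∷ w) (refl , walk) (here refl) = ε , here refl ◅ Reaches-⊆ there (through w walk)
  where
  through : ∀ w {v v′} → DirectedWalk v w v′ → Reaches w v v′
  through []      refl          = ε
  through (_ ∷ w) (refl , walk) = here refl ◅ Reaches-⊆ there (through w walk)
walk-Reaches ((x , y) ∷ w) (refl , walk) (there i) with walk-Reaches w walk i
... | p , q = here refl ◅ Reaches-⊆ there p , Reaches-⊆ there q

-- Counting in-trees with a given root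

module _ {n : ℕ} (V : Subset n) where
  open Sum

  treeCount : List (Arc n) → Fin n → ℕ
  treeCount A x = ⨁ (sublists A) (λ T → 1 when does (inTree? V x T))

  private
    inTree-invariant : ∀ x → ↭-Invariant (λ T → 1 when does (inTree? V x T))
    inTree-invariant x {S} {T} p =
      cong (1 when_) (does-⇔ (mk⇔ (InTree-↭ p) (InTree-↭ (↭-sym p))) (inTree? V x S) (inTree? V x T))

  treeCount-↭ : ∀ {A B} x → A ↭ B → treeCount A x ≡ treeCount B x
  treeCount-↭ x p = Sum-sublists-↭ _ (inTree-invariant x) p

  private
    -- No in-tree uses an arc that leaves its root.
    treeCount-out-arc : ∀ {A B a} → A ↭ a ∷ B → treeCount A (proj₁ a) ≡ treeCount B (proj₁ a)
    treeCount-out-arc {A} {B} {a} p = begin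
      treeCount A x ≡⟨ treeCount-↭ x p ⟩
      treeCount (a ∷ B) x ≡⟨ Sum-sublists-∷ a B _ ⟩
      ⨁ (sublists B) (λ T → 1 when does (inTree? V x (a ∷ T))) + treeCount B x
        ≡⟨ cong (_+ treeCount B x) (trans (⨁-cong (sublists B) none) (⨁-ε (sublists B))) ⟩
      treeCount B x ∎
      where
      open ≡-Reasoning
      x = proj₁ a
      none : ∀ T → (1 when does (inTree? V x (a ∷ T))) ≡ 0
      none T rewrite dec-false (inTree? V x (a ∷ T))
        (λ t → Unique[x∷xs]⇒x∉xs (InTree.unique t) (here refl)) = refl

    treeCount-mono : ∀ {A B a} x → A ↭ a ∷ B → treeCount B x ≤ treeCount A x
    treeCount-mono {A} {B} {a} x p =
      ℕₚ.≤-trans (ℕₚ.m≤n+m _ _) (ℕₚ.≤-reflexive (sym (trans (treeCount-↭ x p) (Sum-sublists-∷ a B _))))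

    -- An in-tree together with an arc leaving its root is a unicyclic graph S;
    -- the cycle passes through the root, and its arc into the root can be removed instead.
    module _ (x : Fin n) (S : List (Arc n)) (within : Within V S) where

      Leaving : Arc n × List (Arc n) → Set
      Leaving (a , T) = proj₁ a ≡ x × InTree V x T

      leaving? : Decidable Leaving
      leaving? (a , T) = (proj₁ a Finₚ.≟ x) ×-dec inTree? V x T

      Entering : Arc n × List (Arc n) → Set
      Entering (a , T) = proj₂ a ≡ x × InTree V (proj₁ a) T

      entering? : Decidable Entering
      entering? (a , T) = (proj₂ a Finₚ.≟ x) ×-dec inTree? V (proj₁ a) T

      -- The tree left over by the earlier pick contains the arc of the later one, and no arc of an
      -- in-tree leaves its root.
      at-most-one-leaving : AllPairs (λ p q → Leaving p → ¬ Leaving q) (picks S)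
      at-most-one-leaving = AllPairs.map
        (λ b∈ (_ , t) (b≡ , _) → Unique[x∷xs]⇒x∉xs (InTree.unique t) (subst (_∈ _) b≡ (∈-map⁺ proj₁ b∈)))
        (picks-later∈ S)

      some-entering : ∀ {p} → p ∈ picks S → Leaving p → ∃ λ q → q ∈ picks S × Entering q
      some-entering {(_ , z) , T} p∈ (refl , t)
        with InTree-rotate (proj₂ (within (∈-resp-↭ (↭-sym (picks-↭ S p∈)) (here refl)))) t
      ... | y , T′ , b∷T′↭ , t′
        with picks-complete S (∈-resp-↭ (↭-trans b∷T′↭ (↭-sym (picks-↭ S p∈))) (here refl))
      -- The remainder `T″` listed in `picks S` agrees with the rotated tree `T′` only up to order,
      -- which does not affect being an in-tree.
      ... | T″ , q∈ = _ , q∈ , refl ,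
        InTree-↭ (drop-∷ (↭-trans b∷T′↭ (↭-trans (↭-sym (picks-↭ S p∈)) (picks-↭ S q∈)))) t′

      leaving≤entering : ⨁ (picks S) (λ p → 1 when does (leaving? p)) ≤
                         ⨁ (picks S) (λ q → 1 when does (entering? q))
      leaving≤entering with Any.any? leaving? (picks S)
      ... | no none = ℕₚ.≤-trans (ℕₚ.≤-reflexive (trans (⨁-cong-∈ (picks S) zeros) (⨁-ε (picks S)))) z≤n
        where
        zeros : ∀ {p} → p ∈ picks S → (1 when does (leaving? p)) ≡ 0
        zeros {p} p∈ rewrite dec-false (leaving? p) (λ l → none (lose p∈ l)) = refl
      ... | yes some with find some
      ... | p , p∈ , l with some-entering p∈ l
      ... | q , q∈ , e =
        ℕₚ.≤-trans (Sum-at-most-one leaving? (picks S) at-most-one-leaving)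
          (ℕₚ.≤-trans (ℕₚ.≤-reflexive one) (∈⇒≤Sum _ q∈))
        where
        one : 1 ≡ (1 when does (entering? q))
        one rewrite dec-true (entering? q) e = refl

    -- The inequality form of the Markov chain tree theorem.
    treeCount-subharmonic : ∀ {A} → Within V A → ∀ x →
      ⨁ A (λ a → treeCount A x when does (proj₁ a Finₚ.≟ x)) ≤
      ⨁ A (λ a → treeCount A (proj₁ a) when does (proj₂ a Finₚ.≟ x))
    treeCount-subharmonic {A} within x = begin
      ⨁ A (λ a → treeCount A x when does (proj₁ a Finₚ.≟ x))
        ≡⟨ sym (Sum-picks-proj₁ A _) ⟩
      ⨁ (picks A) (λ (a , B) → treeCount A x when does (proj₁ a Finₚ.≟ x))
        -- For an arc leaving `x` the trees with root `x` may be counted without it; thus an arc and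
        -- a tree are chosen from disjoint positions, and double counting applies.
        ≡⟨ ⨁-cong-∈ (picks A) out ⟩
      ⨁ (picks A) (λ (a , B) → ⨁ (sublists B) (λ T → 1 when does ((proj₁ a Finₚ.≟ x) ×-dec inTree? V x T)))
        ≡⟨ Sum-picks-sublists A _ ⟩
      ⨁ (sublists A) (λ S → ⨁ (picks S) (λ (a , T) → 1 when does ((proj₁ a Finₚ.≟ x) ×-dec inTree? V x T)))
        ≤⟨ Sum-mono (sublists A) (λ {S} S∈ → leaving≤entering x S (within ∘ sublists-⊆ A S∈)) ⟩
      ⨁ (sublists A) (λ S → ⨁ (picks S) (λ (a , T) → 1 when does ((proj₂ a Finₚ.≟ x) ×-dec inTree? V (proj₁ a) T)))
        ≡⟨ sym (Sum-picks-sublists A _) ⟩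
      ⨁ (picks A) (λ (a , B) → ⨁ (sublists B) (λ T → 1 when does ((proj₂ a Finₚ.≟ x) ×-dec inTree? V (proj₁ a) T)))
        ≤⟨ Sum-mono (picks A) in′ ⟩
      ⨁ (picks A) (λ (a , B) → treeCount A (proj₁ a) when does (proj₂ a Finₚ.≟ x))
        ≡⟨ Sum-picks-proj₁ A _ ⟩
      ⨁ A (λ a → treeCount A (proj₁ a) when does (proj₂ a Finₚ.≟ x)) ∎
      where
      open ℕₚ.≤-Reasoning
      out : ∀ {p} → p ∈ picks A → (treeCount A x when does (proj₁ (proj₁ p) Finₚ.≟ x)) ≡
            ⨁ (sublists (proj₂ p)) (λ T → 1 when does ((proj₁ (proj₁ p) Finₚ.≟ x) ×-dec inTree? V x T))
      out {a , B} p∈ with proj₁ a Finₚ.≟ x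
      ... | yes refl = treeCount-out-arc (picks-↭ A p∈)
      ... | no _     = sym (⨁-ε (sublists B))
      in′ : ∀ {p} → p ∈ picks A →
            ⨁ (sublists (proj₂ p)) (λ T → 1 when does ((proj₂ (proj₁ p) Finₚ.≟ x) ×-dec inTree? V (proj₁ (proj₁ p)) T)) ≤
            (treeCount A (proj₁ (proj₁ p)) when does (proj₂ (proj₁ p) Finₚ.≟ x))
      in′ {a , B} p∈ with proj₂ a Finₚ.≟ x
      ... | yes refl = treeCount-mono (proj₁ a) (picks-↭ A p∈)
      ... | no _     = ℕₚ.≤-reflexive (⨁-ε (sublists B))

  -- The maximum principle: a subharmonic function on a balanced, strongly connected graph is constant.
  treeCount-root : ∀ {A} → Within V A → (∃ λ w → w ↭ A × ∃ λ v → DirectedWalk v w v) →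
                   ∀ {x y} → x ∈ sources A → y ∈ sources A → treeCount A x ≡ treeCount A y
  treeCount-root {A} within (w , w↭ , v , walk) {x} {y} x∈ y∈
    with maximum-∈ (treeCount A) (sources A) x∈
  ... | z , z∈ , max = trans (at-max x∈) (sym (at-max y∈))
    where
    M = treeCount A z
    backward : ∀ {a} → a ∈ A → treeCount A (proj₂ a) ≡ M → treeCount A (proj₁ a) ≡ M
    backward {a} a∈ eq = attained (Sum-tight A bounded tight a∈)
      where
      t = proj₂ a
      bounded : ∀ {b} → b ∈ A → (treeCount A (proj₁ b) when does (proj₂ b Finₚ.≟ t)) ≤ (M when does (proj₂ b Finₚ.≟ t))
      bounded {b} b∈ with does (proj₂ b Finₚ.≟ t)
      ... | true  = max (∈-map⁺ proj₁ b∈)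
      ... | false = z≤n
      -- By balance, `M` times the indegree of `t` is `M` times its outdegree. Since `t` attains
      -- `M`, subharmonicity bounds this by the sum over the sources.
      tight : ⨁ A (λ b → M when does (proj₂ b Finₚ.≟ t)) ≤ ⨁ A (λ b → treeCount A (proj₁ b) when does (proj₂ b Finₚ.≟ t))
      tight = begin
        ⨁ A (λ b → M when does (proj₂ b Finₚ.≟ t))
          ≡⟨ sym (closed-walk-balanced w↭ walk (λ y → M when does (y Finₚ.≟ t))) ⟩
        ⨁ A (λ b → M when does (proj₁ b Finₚ.≟ t))
          ≡⟨ cong (λ k → ⨁ A (λ b → k when does (proj₁ b Finₚ.≟ t))) (sym eq) ⟩
        ⨁ A (λ b → treeCount A t when does (proj₁ b Finₚ.≟ t))
          ≤⟨ treeCount-subharmonic within t ⟩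
        ⨁ A (λ b → treeCount A (proj₁ b) when does (proj₂ b Finₚ.≟ t)) ∎
        where open ℕₚ.≤-Reasoning
      attained : (treeCount A (proj₁ a) when does (t Finₚ.≟ t)) ≡ (M when does (t Finₚ.≟ t)) → treeCount A (proj₁ a) ≡ M
      attained e rewrite dec-true (t Finₚ.≟ t) refl = e
    along : ∀ {s} → Reaches A s z → treeCount A s ≡ M
    along ε       = refl
    along (i ◅ p) = backward i (along p)
    in-walk : ∀ {s} → s ∈ sources A → s ∈ sources w
    in-walk = ∈-resp-↭ (↭ₚ.map⁺ proj₁ (↭-sym w↭))
    at-max : ∀ {s} → s ∈ sources A → treeCount A s ≡ M
    -- The closed walk leads from `s` through its base `v` to the maximal vertex `z`, and maximality
    -- spreads backwards along this path.
    at-max s∈ = along (Reaches-⊆ (∈-resp-↭ w↭)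
      (proj₂ (walk-Reaches w walk (in-walk s∈)) ◅◅ proj₁ (walk-Reaches w walk (in-walk z∈))))

-- Gluing digraphs at a vertex

unique-set-↭ : ∀ {A : Set} {xs ys : List A} → Unique xs → Unique ys →
               (∀ {x} → x ∈ xs → x ∈ ys) → (∀ {x} → x ∈ ys → x ∈ xs) → xs ↭ ys
unique-set-↭ us vs xs⊆ ys⊆ = ∼bag⇒↭ (unique∧set⇒bag us vs (mk⇔ xs⊆ ys⊆))

∈-image⁺ : ∀ {ι : Fin k → Fin n} {e i} → i ∈ˢ e → ι i ∈ˢ image ι e
∈-image⁺ {ι = ι} {e} {i} i∈ = Vecₚ.lookup⇒[]= (ι i) _ (trans (Vecₚ.lookup∘tabulate _ (ι i))
  (dec-true (Finₚ.any? λ j → (j ∈ˢ? e) ×-dec (ι j Finₚ.≟ ι i)) (i , i∈ , refl)))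

∈-image⁻ : ∀ {ι : Fin k → Fin n} {e v} → v ∈ˢ image ι e → ∃ λ i → i ∈ˢ e × ι i ≡ v
∈-image⁻ {ι = ι} {e} {v} v∈ =
  witness (Finₚ.any? λ i → (i ∈ˢ? e) ×-dec (ι i Finₚ.≟ v)) (trans (sym (Vecₚ.lookup∘tabulate _ v)) (Vecₚ.[]=⇒lookup v∈))
  where
  witness : ∀ {P : Set} (P? : Dec P) → does P? ≡ true → P
  witness (yes p) _ = p

∈-members⁺ : ∀ {e : Subset n} {v} → v ∈ˢ e → v ∈ members e
∈-members⁺ {e = e} v∈ = ∈-filter⁺ (_∈ˢ? e) (∈-allFin _) v∈

∈-members⁻ : ∀ {e : Subset n} {v} → v ∈ members e → v ∈ˢ e
∈-members⁻ {e = e} v∈ = proj₂ (∈-filter⁻ (_∈ˢ? e) {xs = allFin _} v∈)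

members-unique : ∀ (e : Subset n) → Unique (members e)
members-unique e = Uniqueₚ.filter⁺ (_∈ˢ? e) (Uniqueₚ.allFin⁺ _)

∈-minus⁻ : ∀ {e : Subset n} {v w} → w ∈ˢ e - v → w ∈ˢ e × w ≢ v
∈-minus⁻ {e = e} {v} w∈ = p─q⊆p e ⁅ v ⁆ w∈ , λ { refl → removed e v w∈ }
  where
  removed : ∀ {n} (e : Subset n) v → ¬ v ∈ˢ e - v
  removed (_ Vec.∷ e) Fin.zero    ()
  removed (_ Vec.∷ e) (Fin.suc v) (there v∈) = removed e v v∈

-- What is symmetric in the two sides is kept apart from the hypergraphs and their orders; through
-- `flip-gluing` a lemma about one side serves for the other.
record Gluing (ι₁ : Fin k → Fin n) (u₁ : Fin k) (ι₂ : Fin l → Fin n) (u₂ : Fin l) : Set where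
  field
    injective₁ : Injective _≡_ _≡_ ι₁
    injective₂ : Injective _≡_ _≡_ ι₂
    glued      : ι₁ u₁ ≡ ι₂ u₂
    separated  : ∀ {i j} → ι₁ i ≡ ι₂ j → i ≡ u₁ × j ≡ u₂

flip-gluing : ∀ {ι₁ : Fin k → Fin n} {u₁} {ι₂ : Fin l → Fin n} {u₂} → Gluing ι₁ u₁ ι₂ u₂ → Gluing ι₂ u₂ ι₁ u₁
flip-gluing g = record
  { injective₁ = injective₂
  ; injective₂ = injective₁
  ; glued      = sym glued
  ; separated  = λ e → Product×.swap (separated (sym e))
  }
  where
  open Gluing g

mapArc : (Fin k → Fin n) → Arc k → Arc n
mapArc ι (x , y) = ι x , ι y

sources-mapArc : ∀ (ι : Fin k → Fin n) T → sources (map (mapArc ι) T) ≡ map ι (sources T)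
sources-mapArc ι []      = refl
sources-mapArc ι (_ ∷ T) = cong (_ ∷_) (sources-mapArc ι T)

Reaches-mapArc : ∀ (ι : Fin k → Fin n) {T v w} → Reaches T v w → Reaches (map (mapArc ι) T) (ι v) (ι w)
Reaches-mapArc ι = gmap ι (∈-map⁺ (mapArc ι))

-- The base vertex is a parameter here because tours are cut and joined at one prescribed vertex.
EulerTour : List (Arc n) → Fin n → Set
EulerTour A v = ∃ λ w → w ↭ A × DirectedWalk v w v

EulerTour-↭ : ∀ {A B : List (Arc n)} {v} → A ↭ B → EulerTour A v → EulerTour B v
EulerTour-↭ p (w , w↭ , walk) = w , ↭-trans w↭ p , walk

EulerTour-[] : ∀ {v : Fin n} → EulerTour [] v
EulerTour-[] = [] , refl , refl

DirectedWalk-++⁺ : ∀ w w′ {x y z : Fin n} → DirectedWalk x w y → DirectedWalk y w′ z → DirectedWalk x (w ++ w′) z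
DirectedWalk-++⁺ []      w′ refl       q = q
DirectedWalk-++⁺ (_ ∷ w) w′ (refl , p) q = refl , DirectedWalk-++⁺ w w′ p q

DirectedWalk-mapArc : ∀ (ι : Fin k → Fin n) w {x y} → DirectedWalk x w y → DirectedWalk (ι x) (map (mapArc ι) w) (ι y)
DirectedWalk-mapArc ι []      refl       = refl
DirectedWalk-mapArc ι (_ ∷ w) (refl , p) = refl , DirectedWalk-mapArc ι w p

EulerTour-rotate : ∀ {A : List (Arc n)} {v x} → EulerTour A v → x ∈ sources A → EulerTour A x
EulerTour-rotate {A = A} {v} {x} (w , w↭ , walk) x∈ with split w walk (∈-resp-↭ (↭ₚ.map⁺ proj₁ (↭-sym w↭)) x∈)
  where
  split : ∀ w {y} → DirectedWalk y w v → x ∈ sources w →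
          ∃ λ w₁ → ∃ λ w₂ → w ≡ w₁ ++ w₂ × DirectedWalk y w₁ x × DirectedWalk x w₂ v
  split w@(_ ∷ _) (refl , walk) (here refl) = [] , w , refl , refl , refl , walk
  split (a ∷ w)   (refl , walk) (there i) with split w walk i
  ... | w₁ , w₂ , refl , p , q = a ∷ w₁ , w₂ , refl , (refl , p) , q
... | w₁ , w₂ , refl , p , q = w₂ ++ w₁ , ↭-trans (↭ₚ.++-comm w₂ w₁) w↭ , DirectedWalk-++⁺ w₂ w₁ q p

EulerTour-target∈sources : ∀ {A : List (Arc n)} {v a} → EulerTour A v → a ∈ A → proj₂ a ∈ sources A
EulerTour-target∈sources {A = A} {v} (w , w↭ , walk) a∈ =
  ∈-resp-↭ (↭ₚ.map⁺ proj₁ w↭) (closed w walk (∈-resp-↭ (↭-sym w↭) a∈))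
  where
  targets : ∀ w {x} → DirectedWalk x w v → x ∈ v ∷ sources w × (∀ {a} → a ∈ w → proj₂ a ∈ v ∷ sources w)
  targets []      refl = here refl , λ ()
  targets (_ ∷ w) (refl , walk) with targets w walk
  ... | x∈ , ts = there (here refl) , λ { (here refl) → weaken x∈ ; (there i) → weaken (ts i) }
    where
    weaken : ∀ {x y} → x ∈ v ∷ sources w → x ∈ v ∷ y ∷ sources w
    weaken (here e)  = here e
    weaken (there i) = there (there i)
  closed : ∀ w → DirectedWalk v w v → ∀ {a} → a ∈ w → proj₂ a ∈ sources w
  closed (_ ∷ w) walk@(refl , _) a∈ with proj₂ (targets (_ ∷ w) walk) a∈
  ... | here e  = here e
  ... | there i = i

EulerTour-start : ∀ {A : List (Arc n)} {v a} → EulerTour A v → a ∈ A → v ∈ sources A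
EulerTour-start {v = v} (w , w↭ , walk) a∈ = ∈-resp-↭ (↭ₚ.map⁺ proj₁ w↭) (start w walk (∈-resp-↭ (↭-sym w↭) a∈))
  where
  start : ∀ w → DirectedWalk v w v → ∀ {a} → a ∈ w → v ∈ sources w
  start (_ ∷ _) (refl , _) _ = here refl

private
  lefts : ∀ {A B : Set} → List (A ⊎ B) → List A
  lefts = mapMaybe isInj₁

  rights : ∀ {A B : Set} → List (A ⊎ B) → List B
  rights = mapMaybe isInj₂

  lefts-tagged : ∀ {A B : Set} (xs : List A) (ys : List B) → lefts (map inj₁ xs ++ map inj₂ ys) ≡ xs
  lefts-tagged (x ∷ xs) ys       = cong (x ∷_) (lefts-tagged xs ys)
  lefts-tagged []       []       = refl
  lefts-tagged []       (y ∷ ys) = lefts-tagged [] ys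

  rights-tagged : ∀ {A B : Set} (xs : List A) (ys : List B) → rights (map inj₁ xs ++ map inj₂ ys) ≡ ys
  rights-tagged (x ∷ xs) ys       = rights-tagged xs ys
  rights-tagged []       []       = refl
  rights-tagged []       (y ∷ ys) = cong (y ∷_) (rights-tagged [] ys)

module _ {ι₁ : Fin k → Fin n} {u₁} {ι₂ : Fin l → Fin n} {u₂} (gluing : Gluing ι₁ u₁ ι₂ u₂) where
  open Gluing gluing

  glueArcs : List (Arc k) → List (Arc l) → List (Arc n)
  glueArcs S T = map (mapArc ι₁) S ++ map (mapArc ι₂) T

  EulerTour-glue : ∀ {S T} → EulerTour S u₁ → EulerTour T u₂ → EulerTour (glueArcs S T) (ι₁ u₁)
  EulerTour-glue (w₁ , w₁↭ , walk₁) (w₂ , w₂↭ , walk₂) =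
    glueArcs w₁ w₂ , ↭ₚ.++⁺ (↭ₚ.map⁺ _ w₁↭) (↭ₚ.map⁺ _ w₂↭) ,
    DirectedWalk-++⁺ (map (mapArc ι₁) w₁) _ (DirectedWalk-mapArc ι₁ w₁ walk₁)
      (subst (λ v → DirectedWalk v (map (mapArc ι₂) w₂) v) (sym glued) (DirectedWalk-mapArc ι₂ w₂ walk₂))

  -- Walks are split after tagging their arcs with the side they come from, since
  -- the endpoints of an arc in the glued graph need not determine that side.
  private
    toArc : Arc k ⊎ Arc l → Arc n
    toArc = [ mapArc ι₁ , mapArc ι₂ ]′

    -- While the walk moves on one side, its projection to the other side waits at the glued vertex.
    -- A change of side can happen only there, where both projections are at their base.
    walk-from₁ : ∀ W {i} → DirectedWalk (ι₁ i) (map toArc W) (ι₁ u₁) →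
                 DirectedWalk i (lefts W) u₁ × DirectedWalk u₂ (rights W) u₂
    walk-from₂ : ∀ W {j} → DirectedWalk (ι₂ j) (map toArc W) (ι₁ u₁) →
                 DirectedWalk u₁ (lefts W) u₁ × DirectedWalk j (rights W) u₂
    walk-from₁ [] e = injective₁ e , refl
    walk-from₁ (inj₁ _ ∷ W) (e , walk) with injective₁ e | walk-from₁ W walk
    ... | refl | p , q = (refl , p) , q
    walk-from₁ (inj₂ _ ∷ W) (e , walk) with separated e | walk-from₂ W walk
    ... | refl , refl | p , q = p , (refl , q)
    walk-from₂ [] e = refl , proj₂ (separated (sym e))
    walk-from₂ (inj₁ _ ∷ W) (e , walk) with separated (sym e) | walk-from₁ W walk
    ... | refl , refl | p , q = (refl , p) , q
    walk-from₂ (inj₂ _ ∷ W) (e , walk) with injective₂ e | walk-from₂ W walk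
    ... | refl | p , q = p , (refl , q)

  EulerTour-unglue : ∀ {S T} → EulerTour (glueArcs S T) (ι₁ u₁) → EulerTour S u₁ × EulerTour T u₂
  EulerTour-unglue {S} {T} (w , w↭ , walk) with ↭ₚ.↭-map-inv toArc (↭-trans (↭-reflexive tagged) (↭-sym w↭))
    where
    tagged : map toArc (map inj₁ S ++ map inj₂ T) ≡ glueArcs S T
    tagged = trans (Listₚ.map-++ toArc (map inj₁ S) _) (cong₂ _++_ (sym (Listₚ.map-∘ S)) (sym (Listₚ.map-∘ T)))
  ... | W , refl , ↭W with walk-from₁ W walk
  ... | p , q =
    (lefts W , subst (lefts W ↭_) (lefts-tagged S T) (mapMaybe-↭ isInj₁ (↭-sym ↭W)) , p) ,
    (rights W , subst (rights W ↭_) (rights-tagged S T) (mapMaybe-↭ isInj₂ (↭-sym ↭W)) , q)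
    where
    mapMaybe-↭ : ∀ {A B : Set} (f : A → _) {xs ys} → xs ↭ ys → mapMaybe {B = B} f xs ↭ mapMaybe f ys
    mapMaybe-↭ f p = ↭ₚ.catMaybes-↭ (↭ₚ.map⁺ f p)

  module _ {V : Subset n} {V₁ : Subset k} {V₂ : Subset l}
           (V⁺₁ : ∀ {i} → i ∈ˢ V₁ → ι₁ i ∈ˢ V) where

    -- A path that starts on side one can take an arc of side two only at the glued vertex. As this
    -- is the root, the path may be stopped there.
    InTree-unglue₁ : ∀ {S T} → InTree V (ι₁ u₁) (glueArcs S T) → InTree V₁ u₁ S
    InTree-unglue₁ {S} {T} (inTree (u∉ ∷ us) reach) = inTree (u₁∉ ∷ us₁) (back ∘ reach ∘ V⁺₁)
      where
      ιsources⊆ : ∀ {i} → i ∈ sources S → ι₁ i ∈ sources (glueArcs S T)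
      ιsources⊆ i∈ with ∈-map⁻ proj₁ i∈
      ... | a , a∈ , refl = ∈-map⁺ proj₁ (∈-++⁺ˡ (∈-map⁺ (mapArc ι₁) a∈))
      u₁∉ : All (u₁ ≢_) (sources S)
      u₁∉ = All.tabulate λ i∈ → λ { refl → All.lookup u∉ (ιsources⊆ i∈) refl }
      us₁ : Unique (sources S)
      us₁ = Uniqueₚ.map⁻ (subst Unique (sources-mapArc ι₁ S)
              (unique-++ˡ (sources (map (mapArc ι₁) S)) (subst Unique (Listₚ.map-++ proj₁ (map (mapArc ι₁) S) _) us)))
        where
        unique-++ˡ : ∀ {A : Set} (xs {ys} : List A) → Unique (xs ++ ys) → Unique xs
        unique-++ˡ []       _        = []
        unique-++ˡ (x ∷ xs) (p ∷ us) = All.tabulate (All.lookup p ∘ ∈-++⁺ˡ) ∷ unique-++ˡ xs us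
      back′ : ∀ {v i} → v ≡ ι₁ i → Reaches (glueArcs S T) v (ι₁ u₁) → Reaches S i u₁
      back′ e ε with injective₁ e
      ... | refl = ε
      back′ e (i ◅ p) with ∈-++⁻ (map (mapArc ι₁) S) i
      ... | inj₁ j with ∈-map⁻ (mapArc ι₁) j
      ...   | a , a∈ , refl with injective₁ e
      ...     | refl = a∈ ◅ back′ refl p
      back′ e (i ◅ p) | inj₂ j with ∈-map⁻ (mapArc ι₂) j
      ...   | a , a∈ , refl with separated (sym e)
      ...     | refl , _ = ε
      back : ∀ {i} → Reaches (glueArcs S T) (ι₁ i) (ι₁ u₁) → Reaches S i u₁
      back = back′ refl

    -- The only vertex common to both sides is the root, which is a source in neither tree, so the
    -- sources stay distinct.
    InTree-glue : (∀ {v} → v ∈ˢ V → (∃ λ i → i ∈ˢ V₁ × ι₁ i ≡ v) ⊎ (∃ λ j → j ∈ˢ V₂ × ι₂ j ≡ v)) →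
                  ∀ {S T} → InTree V₁ u₁ S → InTree V₂ u₂ T → InTree V (ι₁ u₁) (glueArcs S T)
    InTree-glue V⁻ {S} {T} (inTree us₁@(_ ∷ us₁′) reach₁) (inTree us₂@(_ ∷ us₂′) reach₂) = inTree us reach
      where
      sources-glue : sources (glueArcs S T) ≡ map ι₁ (sources S) ++ map ι₂ (sources T)
      sources-glue = trans (Listₚ.map-++ proj₁ (map (mapArc ι₁) S) _) (cong₂ _++_ (sources-mapArc ι₁ S) (sources-mapArc ι₂ T))
      disjoint : ∀ {v} → v ∈ map ι₁ (sources S) × v ∈ map ι₂ (sources T) → ⊥
      disjoint (p , q) with ∈-map⁻ ι₁ p | ∈-map⁻ ι₂ q
      ... | i , i∈ , refl | j , j∈ , e with separated e
      ...   | refl , refl = Unique[x∷xs]⇒x∉xs us₁ i∈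
      fresh : ∀ {v} → v ∈ map ι₁ (sources S) ++ map ι₂ (sources T) → ι₁ u₁ ≢ v
      fresh v∈ refl with ∈-++⁻ (map ι₁ (sources S)) v∈
      ... | inj₁ p with ∈-map⁻ ι₁ p
      ...   | i , i∈ , e with injective₁ e
      ...     | refl = Unique[x∷xs]⇒x∉xs us₁ i∈
      fresh v∈ refl | inj₂ q with ∈-map⁻ ι₂ q
      ...   | j , j∈ , e with separated e
      ...     | _ , refl = Unique[x∷xs]⇒x∉xs us₂ j∈
      us : Unique (ι₁ u₁ ∷ sources (glueArcs S T))
      us = subst (λ xs → Unique (ι₁ u₁ ∷ xs)) (sym sources-glue)
             (All.tabulate fresh ∷ Uniqueₚ.++⁺ (Uniqueₚ.map⁺ injective₁ us₁′) (Uniqueₚ.map⁺ injective₂ us₂′) disjoint)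
      reach : ∀ {v} → v ∈ˢ V → Reaches (glueArcs S T) v (ι₁ u₁)
      reach v∈ with V⁻ v∈
      ... | inj₁ (i , i∈ , refl) = Reaches-⊆ ∈-++⁺ˡ (Reaches-mapArc ι₁ (reach₁ i∈))
      ... | inj₂ (j , j∈ , refl) rewrite glued = Reaches-⊆ (∈-++⁺ʳ _) (Reaches-mapArc ι₂ (reach₂ j∈))

treeCount-glue : ∀ {ι₁ : Fin k → Fin n} {u₁} {ι₂ : Fin l → Fin n} {u₂} (gluing : Gluing ι₁ u₁ ι₂ u₂)
                 {V V₁ V₂} → (∀ {i} → i ∈ˢ V₁ → ι₁ i ∈ˢ V) → (∀ {j} → j ∈ˢ V₂ → ι₂ j ∈ˢ V) →
                 (∀ {v} → v ∈ˢ V → (∃ λ i → i ∈ˢ V₁ × ι₁ i ≡ v) ⊎ (∃ λ j → j ∈ˢ V₂ × ι₂ j ≡ v)) →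
                 ∀ A B → treeCount V (glueArcs gluing A B) (ι₁ u₁) ≡ treeCount V₁ A u₁ ℕ.* treeCount V₂ B u₂
treeCount-glue {ι₁ = ι₁} {u₁} {ι₂} {u₂} gluing {V} {V₁} {V₂} V⁺₁ V⁺₂ V⁻ A B = begin
  ⨁ (sublists (glueArcs gluing A B)) (λ T → [ inTree? V (ι₁ u₁) T ])
    ≡⟨ Sum-sublists-++ (map (mapArc ι₁) A) _ _ ⟩
  ⨁ (sublists (map (mapArc ι₁) A)) (λ S → ⨁ (sublists (map (mapArc ι₂) B)) (λ T → [ inTree? V (ι₁ u₁) (S ++ T) ]))
    ≡⟨ Sum-sublists-map (mapArc ι₁) A _ ⟩
  ⨁ (sublists A) (λ S → ⨁ (sublists (map (mapArc ι₂) B)) (λ T → [ inTree? V (ι₁ u₁) (map (mapArc ι₁) S ++ T) ]))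
    ≡⟨ ⨁-cong (sublists A) (λ S → Sum-sublists-map (mapArc ι₂) B _) ⟩
  ⨁ (sublists A) (λ S → ⨁ (sublists B) (λ T → [ inTree? V (ι₁ u₁) (glueArcs gluing S T) ]))
    ≡⟨ ⨁-cong (sublists A) (λ S → ⨁-cong (sublists B) (indicator S)) ⟩
  ⨁ (sublists A) (λ S → ⨁ (sublists B) (λ T → [ inTree? V₁ u₁ S ] ℕ.* [ inTree? V₂ u₂ T ]))
    ≡⟨ ⨁-cong (sublists A) (λ S → sym (*-distribˡ-Sum [ inTree? V₁ u₁ S ] (sublists B) _)) ⟩
  ⨁ (sublists A) (λ S → [ inTree? V₁ u₁ S ] ℕ.* treeCount V₂ B u₂)
    ≡⟨ sym (*-distribʳ-Sum (treeCount V₂ B u₂) (sublists A) _) ⟩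
  treeCount V₁ A u₁ ℕ.* treeCount V₂ B u₂ ∎
  where
  open Sum
  open ≡-Reasoning
  [_] : ∀ {P : Set} → Dec P → ℕ
  [ P? ] = 1 when does P?
  flipped : ∀ {S T} → InTree V (ι₁ u₁) (glueArcs gluing S T) → InTree V (ι₂ u₂) (glueArcs (flip-gluing gluing) T S)
  flipped {S} {T} t = subst (λ v → InTree V v (glueArcs (flip-gluing gluing) T S)) (Gluing.glued gluing)
    (InTree-↭ (↭ₚ.++-comm (map (mapArc ι₁) S) _) t)
  indicator : ∀ S T → [ inTree? V (ι₁ u₁) (glueArcs gluing S T) ] ≡ [ inTree? V₁ u₁ S ] ℕ.* [ inTree? V₂ u₂ T ]
  indicator S T = trans
    (cong (1 when_) (does-⇔
      (mk⇔ (λ t → InTree-unglue₁ gluing {V₂ = V₂} V⁺₁ {S} {T} t ,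
                  InTree-unglue₁ (flip-gluing gluing) {V₂ = V₁} V⁺₂ {T} {S} (flipped {S} {T} t))
           (λ (s , t) → InTree-glue gluing V⁺₁ V⁻ s t))
      (inTree? V (ι₁ u₁) (glueArcs gluing S T)) (inTree? V₁ u₁ S ×-dec inTree? V₂ u₂ T)))
    (and (does (inTree? V₁ u₁ S)) (does (inTree? V₂ u₂ T)))
    where
    and : ∀ b c → (1 when (b ∧ c)) ≡ (1 when b) ℕ.* (1 when c)
    and true  true  = refl
    and true  false = refl
    and false c     = refl

-- Lists of rooted edges

concatMap-↭ : ∀ {A B : Set} (f : A → List B) {xs ys} → xs ↭ ys → concatMap f xs ↭ concatMap f ys
concatMap-↭ f refl          = refl
concatMap-↭ f (prep x p)    = ↭ₚ.++⁺ˡ (f x) (concatMap-↭ f p)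
concatMap-↭ f (swap x y p)  = ↭-trans (shifts (f x) (f y)) (↭ₚ.++⁺ˡ (f y) (↭ₚ.++⁺ˡ (f x) (concatMap-↭ f p)))
concatMap-↭ f (↭.trans p q) = ↭-trans (concatMap-↭ f p) (concatMap-↭ f q)

module _ {n : ℕ} where

  -- Apart from being sorted, no condition or weight depends on the order of a sequence. The data of
  -- `R F` are therefore read off lists, which can be split, joined and permuted freely.
  arcsOf : List (RootedEdge n) → List (Arc n)
  arcsOf = concatMap star

  verticesOf : List (RootedEdge n) → Subset n
  verticesOf L = ⋃ (map proj₁ L)

  rootCount : List (RootedEdge n) → Fin n → ℕ
  rootCount L v = length (filter (λ f → root f Finₚ.≟ v) L)

  treesAt : List (RootedEdge n) → Fin n → ℕ
  treesAt L = treeCount (verticesOf L) (arcsOf L)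

  EulerianList : List (RootedEdge n) → Set
  EulerianList L = ∃ λ v → EulerTour (arcsOf L) v

  -- The second vertex is where `m ≥ 2` enters: the star of the edge has an arc, so a root in a list
  -- of edges is the source of some arc.
  record Valid (f : RootedEdge n) : Set where
    constructor valid
    field
      root∈  : root f ∈ˢ proj₁ f
      second : ∃ λ w → w ∈ˢ proj₁ f × w ≢ root f

  open Valid

  valid-∈ : ∀ {e v} → v ∈ˢ e → 2 ≤ ∣ e ∣ → Valid (e , v)
  valid-∈ {e} {v} v∈ 2≤ with Finₚ.any? (λ w → (w ∈ˢ? e) ×-dec ¬? (w Finₚ.≟ v))
  ... | yes second = valid v∈ second
  ... | no none    = contradiction (ℕₚ.≤-trans 2≤ (subst (∣ e ∣ ≤_) (∣⁅x⁆∣≡1 v) (p⊆q⇒∣p∣≤∣q∣ e⊆))) λ { (s≤s ()) }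
    where
    e⊆ : e ⊆ ⁅ v ⁆
    e⊆ {w} w∈ with w Finₚ.≟ v
    ... | yes refl = x∈⁅x⁆ v
    ... | no w≢    = contradiction (w , w∈ , w≢) none

  ∈-verticesOf⁺ : ∀ {L f v} → f ∈ L → v ∈ˢ proj₁ f → v ∈ˢ verticesOf L
  ∈-verticesOf⁺ (here refl) v∈ = x∈p∪q⁺ (inj₁ v∈)
  ∈-verticesOf⁺ (there i)   v∈ = x∈p∪q⁺ (inj₂ (∈-verticesOf⁺ i v∈))

  ∈-verticesOf⁻ : ∀ L {v} → v ∈ˢ verticesOf L → ∃ λ f → f ∈ L × v ∈ˢ proj₁ f
  ∈-verticesOf⁻ []      v∈ = contradiction v∈ ∉⊥
  ∈-verticesOf⁻ (f ∷ L) v∈ with x∈p∪q⁻ (proj₁ f) (verticesOf L) v∈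
  ... | inj₁ i = f , here refl , i
  ... | inj₂ j with ∈-verticesOf⁻ L j
  ...   | g , g∈ , i = g , there g∈ , i

  verticesOf-↭ : ∀ {L L′} → L ↭ L′ → verticesOf L ≡ verticesOf L′
  verticesOf-↭ p = ⊆-antisym (mono p) (mono (↭-sym p))
    where
    mono : ∀ {L L′} → L ↭ L′ → verticesOf L ⊆ verticesOf L′
    mono {L} p v∈ with ∈-verticesOf⁻ L v∈
    ... | f , f∈ , i = ∈-verticesOf⁺ (∈-resp-↭ p f∈) i

  arcsOf-↭ : ∀ {L L′} → L ↭ L′ → arcsOf L ↭ arcsOf L′
  arcsOf-↭ = concatMap-↭ star

  rootCount-↭ : ∀ {L L′} → L ↭ L′ → ∀ v → rootCount L v ≡ rootCount L′ v
  rootCount-↭ p v = ↭-length (filter-↭ _ p)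

  treesAt-↭ : ∀ {L L′} → L ↭ L′ → ∀ v → treesAt L v ≡ treesAt L′ v
  treesAt-↭ {L′ = L′} p v =
    trans (treeCount-↭ _ v (arcsOf-↭ p)) (cong (λ V → treeCount V (arcsOf L′) v) (verticesOf-↭ p))

  rootCount>0⁺ : ∀ {L f} → f ∈ L → 0 < rootCount L (root f)
  rootCount>0⁺ {L} {f} f∈ = Listₚ.filter-some _ (lose f∈ refl)

  rootCount>0⁻ : ∀ L {v} → 0 < rootCount L v → ∃ λ f → f ∈ L × root f ≡ v
  rootCount>0⁻ L {v} 0< with filter (λ f → root f Finₚ.≟ v) L in eq
  ... | f ∷ _ = f , ∈-filter⁻ (λ f → root f Finₚ.≟ v) (subst (f ∈_) (sym eq) (here refl))

  ∈-star⁺ : ∀ {e : Subset n} {v w} → w ∈ˢ e → w ≢ v → (v , w) ∈ star (e , v)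
  ∈-star⁺ w∈ w≢ = ∈-map⁺ _ (∈-members⁺ (x∈p∧x≢y⇒x∈p-y w∈ w≢))

  ∈-star⁻ : ∀ {f : RootedEdge n} {a} → a ∈ star f → proj₁ a ≡ root f × proj₂ a ∈ˢ proj₁ f × proj₂ a ≢ root f
  ∈-star⁻ {f} a∈ with ∈-map⁻ (root f ,_) a∈
  ... | w , w∈ , refl = refl , ∈-minus⁻ {e = proj₁ f} (∈-members⁻ w∈)

  ∈-arcsOf⁺ : ∀ {L f a} → f ∈ L → a ∈ star f → a ∈ arcsOf L
  ∈-arcsOf⁺ f∈ a∈ = ∈-concatMap⁺ star (lose f∈ a∈)

  ∈-arcsOf⁻ : ∀ L {a} → a ∈ arcsOf L → ∃ λ f → f ∈ L × a ∈ star f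
  ∈-arcsOf⁻ L a∈ = find (∈-concatMap⁻ star {xs = L} a∈)

  within-arcsOf : ∀ {L} → All Valid L → Within (verticesOf L) (arcsOf L)
  within-arcsOf {L} vs a∈ with ∈-arcsOf⁻ L a∈
  ... | f , f∈ , i with ∈-star⁻ {f} i
  ...   | refl , t∈ , _ = ∈-verticesOf⁺ f∈ (root∈ (All.lookup vs f∈)) , ∈-verticesOf⁺ f∈ t∈

  root∈sources : ∀ {L f} → All Valid L → f ∈ L → root f ∈ sources (arcsOf L)
  root∈sources vs f∈ with second (All.lookup vs f∈)
  ... | w , w∈ , w≢ = ∈-map⁺ proj₁ (∈-arcsOf⁺ f∈ (∈-star⁺ w∈ w≢))

  rootCount>0⇒∈sources : ∀ {L v} → All Valid L → 0 < rootCount L v → v ∈ sources (arcsOf L)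
  rootCount>0⇒∈sources {L} vs 0< with rootCount>0⁻ L 0<
  ... | f , f∈ , refl = root∈sources vs f∈

  ∈sources⇒rootCount>0 : ∀ {L v} → v ∈ sources (arcsOf L) → 0 < rootCount L v
  ∈sources⇒rootCount>0 {L} v∈ with ∈-map⁻ proj₁ v∈
  ... | a , a∈ , refl with ∈-arcsOf⁻ L a∈
  ...   | f , f∈ , i with ∈-star⁻ {f} i
  ...     | refl , _ = rootCount>0⁺ f∈

  -- A vertex that is not the root of its edge is the target of an arc, and a closed walk leaves
  -- every vertex that it enters. This makes the denominators of `ω` positive.
  vertex⇒rootCount>0 : ∀ {L v} → All Valid L → EulerianList L → v ∈ˢ verticesOf L → 0 < rootCount L v
  vertex⇒rootCount>0 {L} {v} vs (_ , tour) v∈ with ∈-verticesOf⁻ L v∈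
  ... | f , f∈ , i with v Finₚ.≟ root f
  ...   | yes refl = rootCount>0⁺ f∈
  ...   | no v≢    = ∈sources⇒rootCount>0 {L} (EulerTour-target∈sources tour (∈-arcsOf⁺ f∈ (∈-star⁺ i v≢)))

  treesAt-root : ∀ {L u v} → All Valid L → EulerianList L → 0 < rootCount L u → 0 < rootCount L v →
                 treesAt L u ≡ treesAt L v
  treesAt-root {L} vs (v , w , w↭ , walk) 0<u 0<v =
    treeCount-root (verticesOf L) (within-arcsOf vs) (w , w↭ , v , walk)
      (rootCount>0⇒∈sources vs 0<u) (rootCount>0⇒∈sources vs 0<v)

  EulerianList-↭ : ∀ {L L′} → L ↭ L′ → EulerianList L → EulerianList L′
  EulerianList-↭ p (v , tour) = v , EulerTour-↭ (arcsOf-↭ p) tour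

Anchored : ∀ {n} → List (RootedEdge n) → Fin n → Set
Anchored L v = L ≡ [] ⊎ 0 < rootCount L v

embed : (Fin k → Fin n) → RootedEdge k → RootedEdge n
embed ι (e , v) = image ι e , ι v

module _ {ι : Fin k → Fin n} (injective : Injective _≡_ _≡_ ι) where

  star-embed : ∀ f → star (embed ι f) ↭ map (mapArc ι) (star f)
  star-embed (e , v) =
    ↭-trans (↭ₚ.map⁺ (ι v ,_) members-image) (↭-reflexive (trans (sym (Listₚ.map-∘ ms)) (Listₚ.map-∘ ms)))
    where
    ms = members (e - v)
    to : ∀ {x} → x ∈ members (image ι e - ι v) → x ∈ map ι ms
    to x∈ with ∈-minus⁻ {e = image ι e} (∈-members⁻ x∈)
    ... | x∈e , x≢ with ∈-image⁻ {ι = ι} {e} x∈e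
    ...   | i , i∈ , refl = ∈-map⁺ ι (∈-members⁺ (x∈p∧x≢y⇒x∈p-y i∈ (λ { refl → x≢ refl })))
    from : ∀ {x} → x ∈ map ι ms → x ∈ members (image ι e - ι v)
    from x∈ with ∈-map⁻ ι x∈
    ... | i , i∈ , refl with ∈-minus⁻ {e = e} (∈-members⁻ i∈)
    ...   | i∈e , i≢ = ∈-members⁺ (x∈p∧x≢y⇒x∈p-y (∈-image⁺ i∈e) (i≢ ∘ injective))
    members-image : members (image ι e - ι v) ↭ map ι ms
    members-image = unique-set-↭ (members-unique _) (Uniqueₚ.map⁺ injective (members-unique _)) to from

  arcsOf-embed : ∀ L → arcsOf (map (embed ι) L) ↭ map (mapArc ι) (arcsOf L)
  arcsOf-embed []      = refl
  arcsOf-embed (f ∷ L) = ↭-trans (↭ₚ.++⁺ (star-embed f) (arcsOf-embed L))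
                                 (↭-reflexive (sym (Listₚ.map-++ (mapArc ι) (star f) _)))

  valid-embed : ∀ {f} → Valid f → Valid (embed ι f)
  valid-embed (valid r∈ (w , w∈ , w≢)) = valid (∈-image⁺ r∈) (ι w , ∈-image⁺ w∈ , w≢ ∘ injective)

  rootCount-embed : ∀ L v → rootCount (map (embed ι) L) (ι v) ≡ rootCount L v
  rootCount-embed []      v = refl
  rootCount-embed (f ∷ L) v with does (ι (root f) Finₚ.≟ ι v) | does (root f Finₚ.≟ v)
                              | does-⇔ (mk⇔ injective (cong ι)) (ι (root f) Finₚ.≟ ι v) (root f Finₚ.≟ v)
  ... | true  | .true  | refl = cong suc (rootCount-embed L v)
  ... | false | .false | refl = rootCount-embed L v

module _ {ι₁ : Fin k → Fin n} {u₁} {ι₂ : Fin l → Fin n} {u₂} (gluing : Gluing ι₁ u₁ ι₂ u₂) where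
  open Gluing gluing

  glueEdges : List (RootedEdge k) → List (RootedEdge l) → List (RootedEdge n)
  glueEdges L₁ L₂ = map (embed ι₁) L₁ ++ map (embed ι₂) L₂

  arcsOf-glue : ∀ L₁ L₂ → arcsOf (glueEdges L₁ L₂) ↭ glueArcs gluing (arcsOf L₁) (arcsOf L₂)
  arcsOf-glue L₁ L₂ = ↭-trans (↭-reflexive (Listₚ.concatMap-++ star (map (embed ι₁) L₁) _))
                              (↭ₚ.++⁺ (arcsOf-embed injective₁ L₁) (arcsOf-embed injective₂ L₂))

  valid-glue : ∀ {L₁ L₂} → All Valid L₁ → All Valid L₂ → All Valid (glueEdges L₁ L₂)
  valid-glue vs₁ vs₂ = Allₚ.++⁺ (Allₚ.map⁺ (All.map (valid-embed injective₁) vs₁)) (Allₚ.map⁺ (All.map (valid-embed injective₂) vs₂))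

  rootCount-glue : ∀ L₁ L₂ → rootCount (glueEdges L₁ L₂) (ι₁ u₁) ≡ rootCount L₁ u₁ + rootCount L₂ u₂
  rootCount-glue L₁ L₂ = begin
    rootCount (glueEdges L₁ L₂) (ι₁ u₁)
      ≡⟨ rootCount-++ (map (embed ι₁) L₁) _ (ι₁ u₁) ⟩
    rootCount (map (embed ι₁) L₁) (ι₁ u₁) + rootCount (map (embed ι₂) L₂) (ι₁ u₁)
      ≡⟨ cong₂ _+_ (rootCount-embed injective₁ L₁ u₁)
                   (trans (cong (rootCount (map (embed ι₂) L₂)) glued) (rootCount-embed injective₂ L₂ u₂)) ⟩
    rootCount L₁ u₁ + rootCount L₂ u₂ ∎
    where
    open ≡-Reasoning
    rootCount-++ : ∀ {n} (L L′ : List (RootedEdge n)) v → rootCount (L ++ L′) v ≡ rootCount L v + rootCount L′ v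
    rootCount-++ L L′ v = trans (cong length (Listₚ.filter-++ (λ f → root f Finₚ.≟ v) L L′)) (Listₚ.length-++ (filter _ L))

  rootCount-glue-≢ : ∀ L₁ L₂ {i} → i ≢ u₁ → rootCount (glueEdges L₁ L₂) (ι₁ i) ≡ rootCount L₁ i
  rootCount-glue-≢ L₁ L₂ {i} i≢ = begin
    length (filter P? (map (embed ι₁) L₁ ++ map (embed ι₂) L₂))
      ≡⟨ cong length (Listₚ.filter-++ P? (map (embed ι₁) L₁) _) ⟩
    length (filter P? (map (embed ι₁) L₁) ++ filter P? (map (embed ι₂) L₂))
      ≡⟨ cong (λ ys → length (filter P? (map (embed ι₁) L₁) ++ ys)) (Listₚ.filter-none P? (All.tabulate elsewhere)) ⟩
    length (filter P? (map (embed ι₁) L₁) ++ [])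
      ≡⟨ cong length (Listₚ.++-identityʳ (filter P? (map (embed ι₁) L₁))) ⟩
    rootCount (map (embed ι₁) L₁) (ι₁ i)
      ≡⟨ rootCount-embed injective₁ L₁ i ⟩
    rootCount L₁ i ∎
    where
    open ≡-Reasoning
    P? : ∀ (f : RootedEdge n) → Dec (root f ≡ ι₁ i)
    P? f = root f Finₚ.≟ ι₁ i
    elsewhere : ∀ {f} → f ∈ map (embed ι₂) L₂ → root f ≢ ι₁ i
    elsewhere f∈ e with ∈-map⁻ (embed ι₂) f∈
    ... | g , g∈ , refl = i≢ (proj₁ (separated (sym e)))

  vertices⁺₁ : ∀ {L₁ L₂ i} → i ∈ˢ verticesOf L₁ → ι₁ i ∈ˢ verticesOf (glueEdges L₁ L₂)
  vertices⁺₁ {L₁} i∈ with ∈-verticesOf⁻ L₁ i∈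
  ... | f , f∈ , j = ∈-verticesOf⁺ (∈-++⁺ˡ (∈-map⁺ (embed ι₁) f∈)) (∈-image⁺ j)

  vertices⁺₂ : ∀ {L₁ L₂ i} → i ∈ˢ verticesOf L₂ → ι₂ i ∈ˢ verticesOf (glueEdges L₁ L₂)
  vertices⁺₂ {L₁} {L₂} i∈ with ∈-verticesOf⁻ L₂ i∈
  ... | f , f∈ , j = ∈-verticesOf⁺ (∈-++⁺ʳ (map (embed ι₁) L₁) (∈-map⁺ (embed ι₂) f∈)) (∈-image⁺ j)

  vertices⁻ : ∀ {L₁ L₂ v} → v ∈ˢ verticesOf (glueEdges L₁ L₂) →
              (∃ λ i → i ∈ˢ verticesOf L₁ × ι₁ i ≡ v) ⊎ (∃ λ j → j ∈ˢ verticesOf L₂ × ι₂ j ≡ v)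
  vertices⁻ {L₁} {L₂} v∈ with ∈-verticesOf⁻ (glueEdges L₁ L₂) v∈
  ... | f , f∈ , i with ∈-++⁻ (map (embed ι₁) L₁) f∈
  ...   | inj₁ j with ∈-map⁻ (embed ι₁) j
  ...     | g , g∈ , refl with ∈-image⁻ {ι = ι₁} {proj₁ g} i
  ...       | x , x∈ , e = inj₁ (x , ∈-verticesOf⁺ g∈ x∈ , e)
  vertices⁻ {L₁} {L₂} v∈ | f , f∈ , i | inj₂ j with ∈-map⁻ (embed ι₂) j
  ...     | g , g∈ , refl with ∈-image⁻ {ι = ι₂} {proj₁ g} i
  ...       | x , x∈ , e = inj₂ (x , ∈-verticesOf⁺ g∈ x∈ , e)

  treesAt-glue : ∀ L₁ L₂ → treesAt (glueEdges L₁ L₂) (ι₁ u₁) ≡ treesAt L₁ u₁ ℕ.* treesAt L₂ u₂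
  treesAt-glue L₁ L₂ = trans
    (treeCount-↭ _ (ι₁ u₁) (arcsOf-glue L₁ L₂))
    (treeCount-glue gluing {V₁ = verticesOf L₁} {verticesOf L₂}
      (vertices⁺₁ {L₁} {L₂}) (vertices⁺₂ {L₁} {L₂}) (vertices⁻ {L₁} {L₂}) (arcsOf L₁) (arcsOf L₂))

  EulerianList-glue : ∀ {L₁ L₂} → All Valid L₁ → All Valid L₂ →
                      Anchored L₁ u₁ → Anchored L₂ u₂ →
                      EulerianList L₁ → EulerianList L₂ → EulerianList (glueEdges L₁ L₂)
  EulerianList-glue {L₁} {L₂} vs₁ vs₂ a₁ a₂ e₁ e₂ =
    _ , EulerTour-↭ (↭-sym (arcsOf-glue L₁ L₂)) (EulerTour-glue gluing (at a₁ vs₁ e₁) (at a₂ vs₂ e₂))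
    where
    at : ∀ {n} {L : List (RootedEdge n)} {v} → Anchored L v → All Valid L → EulerianList L → EulerTour (arcsOf L) v
    at (inj₁ refl) _  _           = EulerTour-[]
    at (inj₂ 0<)   vs (_ , tour)  = EulerTour-rotate tour (rootCount>0⇒∈sources vs 0<)

  EulerianList-unglue : ∀ {L₁ L₂} → All Valid L₁ → All Valid L₂ →
                        EulerianList (glueEdges L₁ L₂) → 0 < rootCount (glueEdges L₁ L₂) (ι₁ u₁) →
                        (EulerianList L₁ × Anchored L₁ u₁) ×
                        (EulerianList L₂ × Anchored L₂ u₂)
  EulerianList-unglue {L₁} {L₂} vs₁ vs₂ (_ , tour) 0<
    -- The tour is first moved to the glued vertex, which it leaves because of `0<`.
    with EulerTour-unglue gluing {arcsOf L₁} {arcsOf L₂} (EulerTour-↭ (arcsOf-glue L₁ L₂)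
           (EulerTour-rotate tour (rootCount>0⇒∈sources (valid-glue vs₁ vs₂) 0<)))
  ... | tour₁ , tour₂ = ((_ , tour₁) , anchored L₁ vs₁ tour₁) , ((_ , tour₂) , anchored L₂ vs₂ tour₂)
    where
    anchored : ∀ {n} (L : List (RootedEdge n)) {v} → All Valid L → EulerTour (arcsOf L) v → Anchored L v
    anchored []        _  _    = inj₁ refl
    anchored L@(f ∷ _) vs tour with ∈-map⁻ proj₁ (root∈sources {L = L} {f} vs (here refl))
    ... | a , a∈ , _ = inj₂ (∈sources⇒rootCount>0 {L = L} (EulerTour-start tour a∈))

-- The weight ω of a glued list

//-suc : ∀ a b → a // suc b ≡ ℤ.+ a ℚ./ suc b
//-suc zero    b = refl
//-suc (suc a) b = refl

-- Positive denominators keep the convention `0 // 0 = 1` out of the arithmetic of fractions.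
//-cross : ∀ a b c d → 0 < b → 0 < d → a ℕ.* d ≡ c ℕ.* b → a // b ≡ c // d
//-cross a (suc b) c (suc d) _ _ e = begin
  a // suc b          ≡⟨ //-suc a b ⟩
  ℤ.+ a ℚ./ suc b       ≡⟨ ℚₚ.fromℚᵘ-cong {mkℚᵘ (ℤ.+ a) b} {mkℚᵘ (ℤ.+ c) d} (*≡* cross) ⟩
  ℤ.+ c ℚ./ suc d       ≡⟨ sym (//-suc c d) ⟩
  c // suc d          ∎
  where
  open ≡-Reasoning
  cross : ℤ.+ a ℤ.* ℤ.+ suc d ≡ ℤ.+ c ℤ.* ℤ.+ suc b
  cross = trans (sym (ℤₚ.pos-* a (suc d))) (trans (cong ℤ.+_ e) (ℤₚ.pos-* c (suc b)))

//-* : ∀ a b c d → 0 < b → 0 < d → (a // b) * (c // d) ≡ (a ℕ.* c) // (b ℕ.* d)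
//-* a (suc b) c (suc d) _ _ = trans (cong₂ _*_ (//-suc a b) (//-suc c d))
  (trans (ℚₚ.toℚᵘ-injective homo) (sym (//-suc (a ℕ.* c) _)))
  where
  open ℚᵘₚ.≃-Reasoning
  p = mkℚᵘ (ℤ.+ a) b
  q = mkℚᵘ (ℤ.+ c) d
  homo : ℚ.toℚᵘ (ℚ.fromℚᵘ p * ℚ.fromℚᵘ q) ℚᵘ.≃ ℚ.toℚᵘ (ℤ.+ (a ℕ.* c) ℚ./ (suc b ℕ.* suc d))
  homo = begin
    ℚ.toℚᵘ (ℚ.fromℚᵘ p * ℚ.fromℚᵘ q)                 ≈⟨ ℚₚ.toℚᵘ-homo-* (ℚ.fromℚᵘ p) (ℚ.fromℚᵘ q) ⟩
    ℚ.toℚᵘ (ℚ.fromℚᵘ p) ℚᵘ.* ℚ.toℚᵘ (ℚ.fromℚᵘ q)     ≈⟨ ℚᵘₚ.*-cong (ℚₚ.toℚᵘ-fromℚᵘ p) (ℚₚ.toℚᵘ-fromℚᵘ q) ⟩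
    p ℚᵘ.* q                                         ≡⟨ cong (λ z → mkℚᵘ z (d + b ℕ.* suc d)) (sym (ℤₚ.pos-* a c)) ⟩
    mkℚᵘ (ℤ.+ (a ℕ.* c)) (d + b ℕ.* suc d)             ≈⟨ ℚᵘₚ.≃-sym (ℚₚ.toℚᵘ-fromℚᵘ (mkℚᵘ (ℤ.+ (a ℕ.* c)) (d + b ℕ.* suc d))) ⟩
    ℚ.toℚᵘ (ℤ.+ (a ℕ.* c) ℚ./ (suc b ℕ.* suc d))       ∎

fromℕ≡// : ∀ a → fromℕ a ≡ a // 1
fromℕ≡// a = sym (//-suc a 0)

fromℕ-*-// : ∀ a c d → 0 < d → fromℕ a * (c // d) ≡ (a ℕ.* c) // d
fromℕ-*-// a c d 0<d = trans (cong (_* (c // d)) (fromℕ≡// a))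
  (trans (//-* a 1 c d (s≤s z≤n) 0<d) (cong ((a ℕ.* c) //_) (ℕₚ.*-identityˡ d)))

product>0 : ∀ {A : Set} (f : A → ℕ) xs → (∀ {x} → x ∈ xs → 0 < f x) → 0 < product (map f xs)
product>0 f []       _ = s≤s z≤n
product>0 f (x ∷ xs) h = ℕₚ.*-mono-≤ (h (here refl)) (product>0 f xs (h ∘ there))

module _ (m : ℕ) {n : ℕ} where

  degreeProduct : List (RootedEdge n) → ℕ
  degreeProduct L = product (map (λ v → (m ℕ.∸ 1) ℕ.* rootCount L v) (members (verticesOf L)))

  -- With the factor 1 outside the vertex set, the degree product runs over all vertices and can be
  -- regrouped along the two embeddings.
  degreeFactor : List (RootedEdge n) → Fin n → ℕ
  degreeFactor L v = ((m ℕ.∸ 1) ℕ.* rootCount L v) Product.when does (v ∈ˢ? verticesOf L)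

  degreeProduct≡Product : ∀ L → degreeProduct L ≡ Product.⨁ (allFin n) (degreeFactor L)
  degreeProduct≡Product L = Product.⨁-filter (_∈ˢ? verticesOf L) (allFin n) _

  degreeProduct>0 : 2 ≤ m → ∀ {L} → All Valid L → EulerianList L → 0 < degreeProduct L
  degreeProduct>0 2≤m {L} vs e = product>0 _ (members (verticesOf L))
    λ v∈ → ℕₚ.*-mono-≤ (ℕₚ.∸-monoˡ-≤ 1 2≤m) (vertex⇒rootCount>0 vs e (∈-members⁻ {e = verticesOf L} v∈))

  degreeFactor-root : ∀ {L v} → All Valid L → 0 < rootCount L v → degreeFactor L v ≡ (m ℕ.∸ 1) ℕ.* rootCount L v
  degreeFactor-root {L} {v} vs 0< with rootCount>0⁻ L 0<
  ... | f , f∈ , refl rewrite dec-true (v ∈ˢ? verticesOf L) (∈-verticesOf⁺ f∈ (Valid.root∈ (All.lookup vs f∈))) = refl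

  degreeFactor-[] : ∀ v → degreeFactor [] v ≡ 1
  degreeFactor-[] v rewrite dec-false (v ∈ˢ? verticesOf {n} []) ∉⊥ = refl

  degreeProduct-[] : degreeProduct [] ≡ 1
  degreeProduct-[] = trans (degreeProduct≡Product [])
    (trans (Product.⨁-cong (allFin n) degreeFactor-[]) (Product.⨁-ε (allFin n)))

  degreeFactor-↭ : ∀ {L L′} → L ↭ L′ → ∀ v → degreeFactor L v ≡ degreeFactor L′ v
  degreeFactor-↭ p v rewrite verticesOf-↭ p | rootCount-↭ p v = refl

  degreeProduct-↭ : ∀ {L L′} → L ↭ L′ → degreeProduct L ≡ degreeProduct L′
  degreeProduct-↭ {L} {L′} p = trans (degreeProduct≡Product L)
    (trans (Product.⨁-cong (allFin n) (degreeFactor-↭ p)) (sym (degreeProduct≡Product L′)))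

treesAt-[] : ∀ {n} (v : Fin n) → treesAt [] v ≡ 1
treesAt-[] {n} v rewrite dec-true (inTree? (verticesOf {n} []) v []) (inTree ([] ∷ []) (λ v∈ → contradiction v∈ ∉⊥)) = refl

degreeFactor-glue : ∀ m {ι₁ : Fin k → Fin n} {u₁} {ι₂ : Fin l → Fin n} {u₂} (gluing : Gluing ι₁ u₁ ι₂ u₂) →
                    ∀ L₁ L₂ {i} → i ≢ u₁ → degreeFactor m (glueEdges gluing L₁ L₂) (ι₁ i) ≡ degreeFactor m L₁ i
degreeFactor-glue m {ι₁} {u₁} {ι₂} gluing L₁ L₂ {i} i≢
  rewrite rootCount-glue-≢ gluing L₁ L₂ i≢ =
  cong (((m ℕ.∸ 1) ℕ.* rootCount L₁ i) Product.when_)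
    (does-⇔ (mk⇔ back (vertices⁺₁ gluing {L₁} {L₂})) (ι₁ i ∈ˢ? verticesOf (glueEdges gluing L₁ L₂)) (i ∈ˢ? verticesOf L₁))
  where
  open Gluing gluing
  back : ι₁ i ∈ˢ verticesOf (glueEdges gluing L₁ L₂) → i ∈ˢ verticesOf L₁
  back i∈ with vertices⁻ gluing {L₁} {L₂} i∈
  ... | inj₁ (j , j∈ , e) = subst (_∈ˢ verticesOf L₁) (injective₁ e) j∈
  ... | inj₂ (j , j∈ , e) = contradiction (proj₁ (separated (sym e))) i≢

-- The shared vertex has one factor in the glued list and one on each side; the
-- identity is cross-multiplied by these factors so that no division occurs.
degreeProduct-glue : ∀ m {ι₁ : Fin k → Fin n} {u₁} {ι₂ : Fin l → Fin n} {u₂} (gluing : Gluing ι₁ u₁ ι₂ u₂) →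
  ι₁ u₁ ∷ allFin n ↭ map ι₁ (allFin k) ++ map ι₂ (allFin l) →
  ∀ L₁ L₂ → let L = glueEdges gluing L₁ L₂ in 0 < degreeFactor m L (ι₁ u₁) →
  degreeProduct m L ℕ.* (degreeFactor m L₁ u₁ ℕ.* degreeFactor m L₂ u₂) ≡
  degreeFactor m L (ι₁ u₁) ℕ.* (degreeProduct m L₁ ℕ.* degreeProduct m L₂)
degreeProduct-glue {k} {n} {l} m {ι₁} {u₁} {ι₂} {u₂} gluing vertices↭ L₁ L₂ 0<φ = goal
  where
  open ≡-Reasoning
  L  = glueEdges gluing L₁ L₂
  L′ = glueEdges (flip-gluing gluing) L₂ L₁
  φ  = degreeFactor m L (ι₁ u₁)
  φ₁ = degreeFactor m L₁ u₁
  φ₂ = degreeFactor m L₂ u₂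
  D  = degreeProduct m L
  rest : ∀ {n} (u : Fin n) → List (Fin n)
  rest u = proj₁ (∈-∃↭ (∈-allFin u))
  rest-↭ : ∀ {n} (u : Fin n) → allFin n ↭ u ∷ rest u
  rest-↭ u = proj₂ (∈-∃↭ (∈-allFin u))
  rest-≢ : ∀ {n} {u i : Fin n} → i ∈ rest u → i ≢ u
  rest-≢ {n} {u} i∈ refl = Unique[x∷xs]⇒x∉xs (Unique-↭ (rest-↭ u) (Uniqueₚ.allFin⁺ n)) i∈
  P₁ = Product.⨁ (rest u₁) (degreeFactor m L₁)
  P₂ = Product.⨁ (rest u₂) (degreeFactor m L₂)
  split : ∀ {n} L (u : Fin n) → degreeProduct m L ≡ degreeFactor m L u ℕ.* Product.⨁ (rest u) (degreeFactor m L)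
  split L u = trans (degreeProduct≡Product m L) (Product.⨁-↭ (degreeFactor m L) (rest-↭ u))
  side₁ : Product.⨁ (map ι₁ (allFin k)) (degreeFactor m L) ≡ φ ℕ.* P₁
  side₁ = trans (Product.⨁-map ι₁ (allFin k) (degreeFactor m L))
    (trans (Product.⨁-↭ (degreeFactor m L ∘ ι₁) (rest-↭ u₁))
      (cong (φ ℕ.*_) (Product.⨁-cong-∈ (rest u₁) (λ i∈ → degreeFactor-glue m gluing L₁ L₂ (rest-≢ i∈)))))
  side₂ : Product.⨁ (map ι₂ (allFin l)) (degreeFactor m L) ≡ φ ℕ.* P₂
  side₂ = trans (Product.⨁-map ι₂ (allFin l) (degreeFactor m L))
    (trans (Product.⨁-↭ (degreeFactor m L ∘ ι₂) (rest-↭ u₂))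
      (cong₂ ℕ._*_ (cong (degreeFactor m L) (sym (Gluing.glued gluing)))
        (Product.⨁-cong-∈ (rest u₂) (λ {j} j∈ → trans (degreeFactor-↭ m {L = L} {L′} (↭ₚ.++-comm (map (embed ι₁) L₁) _) (ι₂ j))
          (degreeFactor-glue m (flip-gluing gluing) L₂ L₁ (rest-≢ j∈))))))
  D≡ : D ≡ φ ℕ.* (P₁ ℕ.* P₂)
  -- With the glued vertex listed once more, the vertices are exactly those of both sides; the extra
  -- factor `φ` is cancelled afterwards.
  D≡ = ℕₚ.*-cancelˡ-≡ _ _ φ {{ℕ.>-nonZero 0<φ}} (begin
    φ ℕ.* D
      ≡⟨ cong (φ ℕ.*_) (degreeProduct≡Product m L) ⟩
    Product.⨁ (ι₁ u₁ ∷ allFin n) (degreeFactor m L)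
      ≡⟨ Product.⨁-↭ (degreeFactor m L) vertices↭ ⟩
    Product.⨁ (map ι₁ (allFin k) ++ map ι₂ (allFin l)) (degreeFactor m L)
      ≡⟨ Product.⨁-++ (map ι₁ (allFin k)) _ (degreeFactor m L) ⟩
    _ ≡⟨ cong₂ ℕ._*_ side₁ side₂ ⟩
    (φ ℕ.* P₁) ℕ.* (φ ℕ.* P₂)
      ≡⟨ solve 3 (λ x y z → (x :* y) :* (x :* z) := x :* (x :* (y :* z))) refl φ P₁ P₂ ⟩
    φ ℕ.* (φ ℕ.* (P₁ ℕ.* P₂)) ∎)
    where open +-*-Solver
  goal : D ℕ.* (φ₁ ℕ.* φ₂) ≡ φ ℕ.* (degreeProduct m L₁ ℕ.* degreeProduct m L₂)
  goal = begin
    D ℕ.* (φ₁ ℕ.* φ₂)                        ≡⟨ cong (ℕ._* (φ₁ ℕ.* φ₂)) D≡ ⟩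
    φ ℕ.* (P₁ ℕ.* P₂) ℕ.* (φ₁ ℕ.* φ₂)        ≡⟨ solve 5 (λ x y z s t → x :* (y :* z) :* (s :* t) := x :* ((s :* y) :* (t :* z)))
                                                       refl φ P₁ P₂ φ₁ φ₂ ⟩
    φ ℕ.* ((φ₁ ℕ.* P₁) ℕ.* (φ₂ ℕ.* P₂))      ≡⟨ cong (φ ℕ.*_) (cong₂ ℕ._*_ (sym (split L₁ u₁)) (sym (split L₂ u₂))) ⟩
    φ ℕ.* (degreeProduct m L₁ ℕ.* degreeProduct m L₂) ∎
    where open +-*-Solver

r≡rootCount : ∀ {d} (F : Vec (RootedEdge n) d) v → r F v ≡ rootCount (toList F) v
r≡rootCount []      v = refl
r≡rootCount (f ∷ F) v with does (root f Finₚ.≟ v)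
... | true  = cong suc (r≡rootCount F v)
... | false = r≡rootCount F v

τ≡treesAt : ∀ {d} (f : RootedEdge n) (F : Vec (RootedEdge n) d) → All Valid (f ∷ toList F) →
            τ (f ∷ F) ≡ treesAt (f ∷ toList F) (root f)
τ≡treesAt f F vs = trans
  (cong length (filter-⇔ (isArborescence? (R (f ∷ F)) (root f)) (inTree? (V (f ∷ F)) (root f)) (sublists as)
    (λ T∈ → IsArborescence⇔InTree {G = R (f ∷ F)} (within-arcsOf vs ∘ sublists-⊆ as T∈))))
  (length-filter≡Sum (inTree? (V (f ∷ F)) (root f)) (sublists as))
  where as = arcsOf (f ∷ toList F)

-- Independence of the root moves the count in `τ` from the first root of `F`, which varies with
-- `F`, to the chosen `u`.
ω-at : ∀ {m d} → 2 ≤ m → (F : Vec (RootedEdge n) (suc d)) {u : Fin n} → let L = toList F in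
       All Valid L → EulerianList L → 0 < rootCount L u →
       ω m F ≡ (suc d ℕ.* (m ℕ.∸ 1) ℕ.^ n ℕ.* treesAt L u) // degreeProduct m L
ω-at {n} {m} {d} 2≤m F@(f ∷ F′) {u} vs e 0< = begin
  fromℕ c * (τ F // product (map (outdegree m F) (members (V F))))
    ≡⟨ cong₂ (λ t D → fromℕ c * (t // D)) (trans (τ≡treesAt f F′ vs) (treesAt-root vs e (rootCount>0⁺ {L = L} {f} (here refl)) 0<))
        (cong product (Listₚ.map-cong (λ v → cong ((m ℕ.∸ 1) ℕ.*_) (r≡rootCount F v)) (members (V F)))) ⟩
  fromℕ c * (treesAt L u // degreeProduct m L)
    ≡⟨ fromℕ-*-// c (treesAt L u) _ (degreeProduct>0 m 2≤m vs e) ⟩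
  (c ℕ.* treesAt L u) // degreeProduct m L ∎
  where
  open ≡-Reasoning
  L = toList F
  c = suc d ℕ.* (m ℕ.∸ 1) ℕ.^ n

-- The summand of Trₜ, with the convention Tr_{0;0} = (m - 1)^(n - 1) included.
ω⁺ : ∀ {d} → ℕ → Vec (RootedEdge n) d → ℚ
ω⁺ {n} {zero}  m F = fromℕ ((m ℕ.∸ 1) ℕ.^ (n ℕ.∸ 1))
ω⁺ {n} {suc d} m F = ω m F

-- Scaling by t / d makes the case d = 0 an instance of the same formula.
scaled-ω⁺ : ∀ {m d} → 2 ≤ m → (F : Vec (RootedEdge n) d) {u : Fin n} → let L = toList F in
            All Valid L → EulerianList L → Anchored L u →
            (rootCount L u // d) * ω⁺ m F ≡
            ((m ℕ.∸ 1) ℕ.^ (n ℕ.∸ 1) ℕ.* (degreeFactor m L u ℕ.* treesAt L u)) // degreeProduct m L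
scaled-ω⁺ {n} {m} {zero} 2≤m [] {u} vs e a = begin
  1ℚ * fromℕ (q ℕ.^ (n ℕ.∸ 1))                                  ≡⟨ ℚₚ.*-identityˡ _ ⟩
  fromℕ (q ℕ.^ (n ℕ.∸ 1))                                       ≡⟨ fromℕ≡// (q ℕ.^ (n ℕ.∸ 1)) ⟩
  (q ℕ.^ (n ℕ.∸ 1)) // 1                                        ≡⟨ cong₂ _//_ (sym numerator) (sym (degreeProduct-[] m {n})) ⟩
  (q ℕ.^ (n ℕ.∸ 1) ℕ.* (degreeFactor m [] u ℕ.* treesAt [] u)) // degreeProduct m {n} [] ∎
  where
  open ≡-Reasoning
  q = m ℕ.∸ 1
  numerator : q ℕ.^ (n ℕ.∸ 1) ℕ.* (degreeFactor m [] u ℕ.* treesAt [] u) ≡ q ℕ.^ (n ℕ.∸ 1)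
  numerator rewrite degreeFactor-[] m u | treesAt-[] u = ℕₚ.*-identityʳ _
scaled-ω⁺ {suc n} {m} {suc d} 2≤m F@(_ ∷ _) {u} vs e (inj₂ 0<) = begin
  (t // suc d) * ω m F
    ≡⟨ cong ((t // suc d) *_) (ω-at 2≤m F vs e 0<) ⟩
  (t // suc d) * ((suc d ℕ.* q ℕ.^ suc n ℕ.* T) // D)
    ≡⟨ //-* t (suc d) _ D (s≤s z≤n) 0<D ⟩
  (t ℕ.* (suc d ℕ.* q ℕ.^ suc n ℕ.* T)) // (suc d ℕ.* D)
    -- The length `suc d` cancels, and one factor `q` of `q ^ suc n` joins `t` to form the degree of
    -- `u`.
    ≡⟨ //-cross (t ℕ.* (suc d ℕ.* q ℕ.^ suc n ℕ.* T)) (suc d ℕ.* D) (q ℕ.^ n ℕ.* (q ℕ.* t ℕ.* T)) D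
        (ℕₚ.*-mono-≤ {1} {suc d} (s≤s z≤n) 0<D) 0<D
        (solve 6 (λ t s q p T D → t :* (s :* (q :* p) :* T) :* D := p :* (q :* t :* T) :* (s :* D)) refl t (suc d) q (q ℕ.^ n) T D) ⟩
  (q ℕ.^ n ℕ.* (q ℕ.* t ℕ.* T)) // D
    ≡⟨ cong (λ φ → (q ℕ.^ n ℕ.* (φ ℕ.* T)) // D) (sym (degreeFactor-root m vs 0<)) ⟩
  (q ℕ.^ n ℕ.* (degreeFactor m L u ℕ.* T)) // D ∎
  where
  open ≡-Reasoning
  open +-*-Solver
  L = toList F
  q = m ℕ.∸ 1
  t = rootCount L u
  T = treesAt L u
  D = degreeProduct m L
  0<D = degreeProduct>0 m 2≤m vs e

-- Each side contributes its power of `q` and its own degree factor of the glued vertex. The one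
-- remaining `q` of `q ^ n` cancels against the `q` in the degree of that vertex in the glued list,
-- which leaves the sum of the multiplicities in the denominator.
ω-glue : ∀ {m} → 2 ≤ m → ∀ {ι₁ : Fin k → Fin n} {u₁} {ι₂ : Fin l → Fin n} {u₂} (gluing : Gluing ι₁ u₁ ι₂ u₂) →
  ι₁ u₁ ∷ allFin n ↭ map ι₁ (allFin k) ++ map ι₂ (allFin l) →
  ∀ {d d₁ d₂} (F : Vec (RootedEdge n) d) .{{_ : NonZero d}} (F₁ : Vec (RootedEdge k) d₁) (F₂ : Vec (RootedEdge l) d₂) →
  let L₁ = toList F₁; L₂ = toList F₂ in
  toList F ↭ glueEdges gluing L₁ L₂ → All Valid L₁ → All Valid L₂ → EulerianList L₁ → EulerianList L₂ →
  Anchored L₁ u₁ → Anchored L₂ u₂ → 0 < rootCount L₁ u₁ + rootCount L₂ u₂ →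
  ω m F ≡ (d // (rootCount L₁ u₁ + rootCount L₂ u₂)) *
          (((rootCount L₁ u₁ // d₁) * ω⁺ m F₁) * ((rootCount L₂ u₂ // d₂) * ω⁺ m F₂))
ω-glue {suc k} {n} {suc l} {m} 2≤m {ι₁} {u₁} {ι₂} {u₂} gluing vertices↭ {suc d} {d₁} {d₂}
  F F₁ F₂ F↭ vs₁ vs₂ e₁ e₂ a₁ a₂ 0<t = begin
  ω m F
    ≡⟨ ω-at 2≤m F vs e (subst (0 <_) (sym t≡) 0<t) ⟩
  (suc d ℕ.* q ℕ.^ n ℕ.* treesAt (toList F) u) // degreeProduct m (toList F)
    ≡⟨ cong₂ _//_ (cong₂ (λ x y → suc d ℕ.* x ℕ.* y) qⁿ (trans (treesAt-↭ F↭ u) (treesAt-glue gluing L₁ L₂))) (degreeProduct-↭ m F↭) ⟩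
  (suc d ℕ.* (q ℕ.* (q ℕ.^ k ℕ.* q ℕ.^ l)) ℕ.* (T₁ ℕ.* T₂)) // D
    ≡⟨ //-cross (suc d ℕ.* (q ℕ.* (q ℕ.^ k ℕ.* q ℕ.^ l)) ℕ.* (T₁ ℕ.* T₂)) D (suc d ℕ.* (A₁ ℕ.* A₂)) (t ℕ.* (D₁ ℕ.* D₂))
         0<D (ℕₚ.*-mono-≤ 0<t 0<D₁D₂) cross ⟩
  (suc d ℕ.* (A₁ ℕ.* A₂)) // (t ℕ.* (D₁ ℕ.* D₂))
    ≡⟨ sym (//-* (suc d) t (A₁ ℕ.* A₂) (D₁ ℕ.* D₂) 0<t 0<D₁D₂) ⟩
  (suc d // t) * ((A₁ ℕ.* A₂) // (D₁ ℕ.* D₂))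
    ≡⟨ cong ((suc d // t) *_) (sym (//-* A₁ D₁ A₂ D₂ 0<D₁ 0<D₂)) ⟩
  (suc d // t) * ((A₁ // D₁) * (A₂ // D₂))
    ≡⟨ cong ((suc d // t) *_) (cong₂ _*_ (sym (scaled-ω⁺ 2≤m F₁ vs₁ e₁ a₁)) (sym (scaled-ω⁺ 2≤m F₂ vs₂ e₂ a₂))) ⟩
  (suc d // t) * (((rootCount L₁ u₁ // d₁) * ω⁺ m F₁) * ((rootCount L₂ u₂ // d₂) * ω⁺ m F₂)) ∎
  where
  open ≡-Reasoning
  u = ι₁ u₁
  q = m ℕ.∸ 1
  L₁ = toList F₁
  L₂ = toList F₂
  L = glueEdges gluing L₁ L₂
  t = rootCount L₁ u₁ + rootCount L₂ u₂
  T₁ = treesAt L₁ u₁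
  T₂ = treesAt L₂ u₂
  φ₁ = degreeFactor m L₁ u₁
  φ₂ = degreeFactor m L₂ u₂
  D₁ = degreeProduct m L₁
  D₂ = degreeProduct m L₂
  D  = degreeProduct m L
  A₁ = q ℕ.^ k ℕ.* (φ₁ ℕ.* T₁)
  A₂ = q ℕ.^ l ℕ.* (φ₂ ℕ.* T₂)
  vs : All Valid (toList F)
  vs = All-resp-↭ (↭-sym F↭) (valid-glue gluing vs₁ vs₂)
  eL : EulerianList L
  eL = EulerianList-glue gluing vs₁ vs₂ a₁ a₂ e₁ e₂
  e : EulerianList (toList F)
  e = EulerianList-↭ (↭-sym F↭) eL
  t≡ : rootCount (toList F) u ≡ t
  t≡ = trans (rootCount-↭ F↭ u) (rootCount-glue gluing L₁ L₂)
  0<D₁ = degreeProduct>0 m 2≤m vs₁ e₁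
  0<D₂ = degreeProduct>0 m 2≤m vs₂ e₂
  0<D = degreeProduct>0 m 2≤m (valid-glue gluing vs₁ vs₂) eL
  0<D₁D₂ = ℕₚ.*-mono-≤ 0<D₁ 0<D₂
  φ≡ : degreeFactor m L u ≡ q ℕ.* t
  φ≡ = trans (degreeFactor-root m (valid-glue gluing vs₁ vs₂) (subst (0 <_) (sym (rootCount-glue gluing L₁ L₂)) 0<t))
             (cong (q ℕ.*_) (rootCount-glue gluing L₁ L₂))
  degrees : D ℕ.* (φ₁ ℕ.* φ₂) ≡ q ℕ.* t ℕ.* (D₁ ℕ.* D₂)
  degrees = trans (degreeProduct-glue m gluing vertices↭ L₁ L₂
      (subst (0 <_) (sym φ≡) (ℕₚ.*-mono-≤ (ℕₚ.∸-monoˡ-≤ 1 2≤m) 0<t)))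
    (cong (ℕ._* (D₁ ℕ.* D₂)) φ≡)
  n≡ : n ≡ suc (k + l)
  n≡ = ℕₚ.suc-injective (begin
    suc n                                        ≡⟨ cong suc (sym (Listₚ.length-tabulate {n = n} id)) ⟩
    length (ι₁ u₁ ∷ allFin n)                    ≡⟨ ↭-length vertices↭ ⟩
    length (map ι₁ (allFin (suc k)) ++ map ι₂ (allFin (suc l)))
      ≡⟨ Listₚ.length-++ (map ι₁ (allFin (suc k))) ⟩
    length (map ι₁ (allFin (suc k))) + length (map ι₂ (allFin (suc l)))
      ≡⟨ cong₂ _+_ (trans (Listₚ.length-map ι₁ (allFin (suc k))) (Listₚ.length-tabulate {n = suc k} id))
                   (trans (Listₚ.length-map ι₂ (allFin (suc l))) (Listₚ.length-tabulate {n = suc l} id)) ⟩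
    suc k + suc l                                ≡⟨ cong suc (ℕₚ.+-suc k l) ⟩
    suc (suc (k + l))                            ∎)
  qⁿ : q ℕ.^ n ≡ q ℕ.* (q ℕ.^ k ℕ.* q ℕ.^ l)
  qⁿ = trans (cong (q ℕ.^_) n≡) (cong (q ℕ.*_) (ℕₚ.^-distribˡ-+-* q k l))
  cross : suc d ℕ.* (q ℕ.* (q ℕ.^ k ℕ.* q ℕ.^ l)) ℕ.* (T₁ ℕ.* T₂) ℕ.* (t ℕ.* (D₁ ℕ.* D₂)) ≡ suc d ℕ.* (A₁ ℕ.* A₂) ℕ.* D
  cross = begin
    suc d ℕ.* (q ℕ.* (q ℕ.^ k ℕ.* q ℕ.^ l)) ℕ.* (T₁ ℕ.* T₂) ℕ.* (t ℕ.* (D₁ ℕ.* D₂))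
      ≡⟨ solve 8 (λ s q x y T₁ T₂ t E → s :* (q :* (x :* y)) :* (T₁ :* T₂) :* (t :* E) :=
                                         s :* (x :* y :* (T₁ :* T₂)) :* (q :* t :* E)) refl
           (suc d) q (q ℕ.^ k) (q ℕ.^ l) T₁ T₂ t (D₁ ℕ.* D₂) ⟩
    suc d ℕ.* (q ℕ.^ k ℕ.* q ℕ.^ l ℕ.* (T₁ ℕ.* T₂)) ℕ.* (q ℕ.* t ℕ.* (D₁ ℕ.* D₂))
      ≡⟨ cong (suc d ℕ.* (q ℕ.^ k ℕ.* q ℕ.^ l ℕ.* (T₁ ℕ.* T₂)) ℕ.*_) (sym degrees) ⟩
    suc d ℕ.* (q ℕ.^ k ℕ.* q ℕ.^ l ℕ.* (T₁ ℕ.* T₂)) ℕ.* (D ℕ.* (φ₁ ℕ.* φ₂))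
      ≡⟨ solve 8 (λ s x y T₁ T₂ D φ₁ φ₂ → s :* (x :* y :* (T₁ :* T₂)) :* (D :* (φ₁ :* φ₂)) :=
                                           s :* ((x :* (φ₁ :* T₁)) :* (y :* (φ₂ :* T₂))) :* D) refl
           (suc d) (q ℕ.^ k) (q ℕ.^ l) T₁ T₂ D φ₁ φ₂ ⟩
    suc d ℕ.* (A₁ ℕ.* A₂) ℕ.* D ∎
    where open +-*-Solver

open Sumℚ using () renaming (⨁-cong to ∑-cong; ⨁-cong-∈ to ∑-cong-∈; ⨁-∙ to ∑-+; ⨁-++ to ∑-++; ⨁-swap to ∑-swap;
  ⨁-map to ∑-map; ⨁-ε to ∑-0; ⨁-↭ to ∑-↭; ⨁-filter to ∑-filter; ⨁-cartesianProductWith to ∑-cartesianProductWith)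

-- Sequences as sorted shuffles

open Sumℚ using (_when_)
  renaming (⨁-cong to ∑-cong; ⨁-cong-∈ to ∑-cong-∈; ⨁-∙ to ∑-+; ⨁-++ to ∑-++; ⨁-swap to ∑-swap; ⨁-map to ∑-map;
            ⨁-ε to ∑-0; ⨁-↭ to ∑-↭; ⨁-filter to ∑-filter; ⨁-when to ∑-when;
            ⨁-cartesianProductWith to ∑-cartesianProductWith)

-- Meant for sequences whose first entry comes from the left list, as `∑-splittings-∷ʳ` is for the
-- right list: the term split off is the one in which no such entry exists.
∑-splittings-∷ : ∀ d (h : ℕ × ℕ → ℚ) →
  ∑ (splittings (suc d)) h ≡ h (0 , suc d) ℚ.+ ∑ (splittings d) (λ (a , b) → h (suc a , b))
∑-splittings-∷ d h = cong (h (0 , suc d) ℚ.+_) (begin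
  ∑ (map (λ a → a , suc d ℕ.∸ a) (applyUpTo suc (suc d))) h
    ≡⟨ cong (λ xs → ∑ xs h) (Listₚ.map-applyUpTo suc (λ a → a , suc d ℕ.∸ a) (suc d)) ⟩
  ∑ (applyUpTo (λ a → suc a , d ℕ.∸ a) (suc d)) h
    ≡⟨ cong (λ xs → ∑ xs h) (sym (Listₚ.map-applyUpTo id (λ a → suc a , d ℕ.∸ a) (suc d))) ⟩
  ∑ (map (λ a → suc a , d ℕ.∸ a) (upTo (suc d))) h
    ≡⟨ ∑-map (λ a → suc a , d ℕ.∸ a) (upTo (suc d)) h ⟩
  ∑ (upTo (suc d)) (λ a → h (suc a , d ℕ.∸ a))
    ≡⟨ sym (∑-map (λ a → a , d ℕ.∸ a) (upTo (suc d)) (λ (a , b) → h (suc a , b))) ⟩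
  ∑ (splittings d) (λ (a , b) → h (suc a , b)) ∎)
  where open ≡-Reasoning

∑-splittings-∷ʳ : ∀ d (h : ℕ × ℕ → ℚ) →
  ∑ (splittings (suc d)) h ≡ ∑ (splittings d) (λ (a , b) → h (a , suc b)) ℚ.+ h (suc d , 0)
∑-splittings-∷ʳ d h = begin
  ∑ (splittings (suc d)) h
    ≡⟨ ∑-map (λ a → a , suc d ℕ.∸ a) (upTo (suc (suc d))) h ⟩
  ∑ (upTo (suc (suc d))) g
    ≡⟨ cong (λ xs → ∑ xs g) (sym (Listₚ.upTo-∷ʳ (suc d))) ⟩
  ∑ (upTo (suc d) ++ suc d ∷ []) g
    ≡⟨ ∑-++ (upTo (suc d)) _ g ⟩
  ∑ (upTo (suc d)) g ℚ.+ (g (suc d) ℚ.+ 0ℚ)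
    ≡⟨ cong₂ ℚ._+_ (∑-cong-∈ (upTo (suc d)) λ {a} a∈ → cong (λ b → h (a , b)) (ℕₚ.+-∸-assoc 1 (ℕₚ.≤-pred (∈-upTo⁻ a∈))))
                   (trans (ℚₚ.+-identityʳ _) (cong (λ b → h (suc d , b)) (ℕₚ.n∸n≡0 d))) ⟩
  ∑ (upTo (suc d)) (λ a → h (a , suc (d ℕ.∸ a))) ℚ.+ h (suc d , 0)
    ≡⟨ cong (ℚ._+ h (suc d , 0)) (sym (∑-map (λ a → a , d ℕ.∸ a) (upTo (suc d)) (λ (a , b) → h (a , suc b)))) ⟩
  ∑ (splittings d) (λ (a , b) → h (a , suc b)) ℚ.+ h (suc d , 0) ∎
  where
  open ≡-Reasoning
  g : ℕ → ℚ
  g a = h (a , suc d ℕ.∸ a)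

-- The empty list unless d is the sum of the two lengths.
interleave  : ∀ d → List A → List A → List (Vec A d)
interleaveˡ : ∀ d → List A → List A → List (Vec A (suc d))
interleaveʳ : ∀ d → List A → List A → List (Vec A (suc d))
interleave zero    []      []      = [] ∷ []
interleave zero    _       _       = []
interleave (suc d) xs      ys      = interleaveˡ d xs ys ++ interleaveʳ d xs ys
interleaveˡ d []       ys = []
interleaveˡ d (x ∷ xs) ys = map (x ∷_) (interleave d xs ys)
interleaveʳ d xs []       = []
interleaveʳ d xs (y ∷ ys) = map (y ∷_) (interleave d xs ys)

interleave-↭ : ∀ d {xs ys : List A} {zs} → zs ∈ interleave d xs ys → toList zs ↭ xs ++ ys
interleave-↭ zero {[]} {[]} (here refl) = refl
interleave-↭ (suc d) {xs} {ys} zs∈ with ∈-++⁻ (interleaveˡ d xs ys) zs∈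
interleave-↭ (suc d) {x ∷ xs} {ys} zs∈ | inj₁ i with ∈-map⁻ (x ∷_) i
... | ws , ws∈ , refl = prep x (interleave-↭ d ws∈)
interleave-↭ (suc d) {xs} {y ∷ ys} zs∈ | inj₂ i with ∈-map⁻ (y ∷_) i
... | ws , ws∈ , refl = ↭-trans (prep y (interleave-↭ d ws∈)) (↭-sym (shift y xs ys))

∑-sequences-suc : ∀ (xs : List A) d (f : Vec A (suc d) → ℚ) →
                  ∑ (sequences xs (suc d)) f ≡ ∑ xs (λ x → ∑ (sequences xs d) (λ v → f (x ∷ v)))
∑-sequences-suc xs d f = ∑-cartesianProductWith _∷_ xs (sequences xs d) f

∑-sequences-↭ : ∀ {xs ys : List A} → xs ↭ ys → ∀ d (f : Vec A d → ℚ) → ∑ (sequences xs d) f ≡ ∑ (sequences ys d) f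
∑-sequences-↭ p zero    f = refl
∑-sequences-↭ {xs = xs} {ys} p (suc d) f = begin
  ∑ (sequences xs (suc d)) f                            ≡⟨ ∑-sequences-suc xs d f ⟩
  ∑ xs (λ x → ∑ (sequences xs d) (λ v → f (x ∷ v)))     ≡⟨ ∑-cong xs (λ x → ∑-sequences-↭ p d _) ⟩
  ∑ xs (λ x → ∑ (sequences ys d) (λ v → f (x ∷ v)))     ≡⟨ ∑-↭ _ p ⟩
  ∑ ys (λ x → ∑ (sequences ys d) (λ v → f (x ∷ v)))     ≡⟨ sym (∑-sequences-suc ys d f) ⟩
  ∑ (sequences ys (suc d)) f                            ∎
  where open ≡-Reasoning

∑-sequences-map : ∀ (g : B → A) xs d (f : Vec A d → ℚ) →
                  ∑ (sequences (map g xs) d) f ≡ ∑ (sequences xs d) (f ∘ Vec.map g)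
∑-sequences-map g xs zero    f = refl
∑-sequences-map g xs (suc d) f = begin
  ∑ (sequences (map g xs) (suc d)) f
    ≡⟨ ∑-sequences-suc (map g xs) d f ⟩
  ∑ (map g xs) (λ x → ∑ (sequences (map g xs) d) (λ v → f (x ∷ v)))
    ≡⟨ ∑-map g xs _ ⟩
  ∑ xs (λ x → ∑ (sequences (map g xs) d) (λ v → f (g x ∷ v)))
    ≡⟨ ∑-cong xs (λ x → ∑-sequences-map g xs d _) ⟩
  ∑ xs (λ x → ∑ (sequences xs d) (λ v → f (g x ∷ Vec.map g v)))
    ≡⟨ sym (∑-sequences-suc xs d _) ⟩
  ∑ (sequences xs (suc d)) (f ∘ Vec.map g) ∎
  where open ≡-Reasoning

∈-sequences⁻ : ∀ (xs : List A) d {v} → v ∈ sequences xs d → All (_∈ xs) (toList v)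
∈-sequences⁻ xs zero    (here refl) = []
∈-sequences⁻ xs (suc d) v∈ with ∈-cartesianProductWith⁻ _∷_ xs (sequences xs d) v∈
... | x , w , x∈ , w∈ , refl = x∈ ∷ ∈-sequences⁻ xs d w∈

module _ (xs ys : List A) where
  open ≡-Reasoning

  private
    interleavings : ∀ d → (Vec A d → ℚ) → ℕ × ℕ → ℚ
    interleavings d f (a , b) =
      ∑ (sequences xs a) λ v → ∑ (sequences ys b) λ w → ∑ (interleave d (toList v) (toList w)) f

    fromˡ fromʳ : ∀ d → (Vec A (suc d) → ℚ) → ℕ × ℕ → ℚ
    fromˡ d f (a , b) =
      ∑ (sequences xs a) λ v → ∑ (sequences ys b) λ w → ∑ (interleaveˡ d (toList v) (toList w)) f
    fromʳ d f (a , b) =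
      ∑ (sequences xs a) λ v → ∑ (sequences ys b) λ w → ∑ (interleaveʳ d (toList v) (toList w)) f

    interleavings-suc : ∀ d f ab → interleavings (suc d) f ab ≡ fromˡ d f ab ℚ.+ fromʳ d f ab
    interleavings-suc d f (a , b) = begin
      interleavings (suc d) f (a , b)
        ≡⟨ ∑-cong (sequences xs a) (λ v → ∑-cong (sequences ys b) λ w → ∑-++ (interleaveˡ d (toList v) (toList w)) _ f) ⟩
      _ ≡⟨ ∑-cong (sequences xs a) (λ v → ∑-+ (sequences ys b) _ _) ⟩
      _ ≡⟨ ∑-+ (sequences xs a) _ _ ⟩
      fromˡ d f (a , b) ℚ.+ fromʳ d f (a , b) ∎

    fromˡ-zero : ∀ d f b → fromˡ d f (0 , b) ≡ 0ℚ
    fromˡ-zero d f b = trans (ℚₚ.+-identityʳ _) (∑-0 (sequences ys b))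

    fromʳ-zero : ∀ d f a → fromʳ d f (a , 0) ≡ 0ℚ
    fromʳ-zero d f a = trans (∑-cong (sequences xs a) (λ v → ℚₚ.+-identityʳ _))
      (trans (∑-cong (sequences xs a) (λ v → empty (toList v))) (∑-0 (sequences xs a)))
      where
      empty : ∀ zs → ∑ (interleaveʳ d zs []) f ≡ 0ℚ
      empty []      = refl
      empty (_ ∷ _) = refl

    fromˡ-suc : ∀ d f a b → fromˡ d f (suc a , b) ≡ ∑ xs (λ x → interleavings d (λ v → f (x ∷ v)) (a , b))
    fromˡ-suc d f a b = trans (∑-sequences-suc xs a _)
      (∑-cong xs λ x → ∑-cong (sequences xs a) λ v → ∑-cong (sequences ys b) λ w →
        ∑-map (x ∷_) (interleave d (toList v) (toList w)) f)

    fromʳ-suc : ∀ d f a b → fromʳ d f (a , suc b) ≡ ∑ ys (λ y → interleavings d (λ v → f (y ∷ v)) (a , b))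
    fromʳ-suc d f a b = begin
      fromʳ d f (a , suc b)
        ≡⟨ ∑-cong (sequences xs a) (λ v → ∑-sequences-suc ys b _) ⟩
      ∑ (sequences xs a) (λ v → ∑ ys λ y → ∑ (sequences ys b) λ w → ∑ (interleaveʳ d (toList v) (y ∷ toList w)) f)
        ≡⟨ ∑-cong (sequences xs a) (λ v → ∑-cong ys λ y → ∑-cong (sequences ys b) λ w →
             ∑-interleaveʳ (toList v) y (toList w)) ⟩
      ∑ (sequences xs a) (λ v → ∑ ys λ y → ∑ (sequences ys b) λ w → ∑ (interleave d (toList v) (toList w)) (λ z → f (y ∷ z)))
        ≡⟨ ∑-swap (sequences xs a) ys _ ⟩
      ∑ ys (λ y → interleavings d (λ v → f (y ∷ v)) (a , b)) ∎
      where
      ∑-interleaveʳ : ∀ vs y ws → ∑ (interleaveʳ d vs (y ∷ ws)) f ≡ ∑ (interleave d vs ws) (λ z → f (y ∷ z))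
      ∑-interleaveʳ []       y ws = ∑-map (y ∷_) (interleave d [] ws) f
      ∑-interleaveʳ (v ∷ vs) y ws = ∑-map (y ∷_) (interleave d (v ∷ vs) ws) f

    absorbˡ : ∀ {p} q → p ≡ 0ℚ → p ℚ.+ q ≡ q
    absorbˡ q refl = ℚₚ.+-identityˡ q

    absorbʳ : ∀ {p} q → p ≡ 0ℚ → q ℚ.+ p ≡ q
    absorbʳ q refl = ℚₚ.+-identityʳ q

  -- The first entry comes from `xs` or from `ys`, and the interleavings are divided in the same way
  -- by their first entry; the rest is induction on `d`.
  ∑-sequences-++ : ∀ d (f : Vec A d → ℚ) → ∑ (sequences (xs ++ ys) d) f ≡
    ∑ (splittings d) λ (a , b) →
      ∑ (sequences xs a) λ v → ∑ (sequences ys b) λ w → ∑ (interleave d (toList v) (toList w)) f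
  ∑-sequences-++ zero    f = sym (trans (ℚₚ.+-identityʳ _) (trans (ℚₚ.+-identityʳ _) (ℚₚ.+-identityʳ _)))
  ∑-sequences-++ (suc d) f = begin
    ∑ (sequences (xs ++ ys) (suc d)) f
      ≡⟨ ∑-sequences-suc (xs ++ ys) d f ⟩
    ∑ (xs ++ ys) (λ x → ∑ (sequences (xs ++ ys) d) (λ v → f (x ∷ v)))
      ≡⟨ ∑-cong (xs ++ ys) (λ x → ∑-sequences-++ d _) ⟩
    ∑ (xs ++ ys) (λ x → ∑ (splittings d) (interleavings d (λ v → f (x ∷ v))))
      ≡⟨ ∑-++ xs ys _ ⟩
    ∑ xs (λ x → ∑ (splittings d) (interleavings d (λ v → f (x ∷ v)))) ℚ.+
    ∑ ys (λ y → ∑ (splittings d) (interleavings d (λ v → f (y ∷ v))))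
      ≡⟨ cong₂ ℚ._+_ (∑-swap xs (splittings d) _) (∑-swap ys (splittings d) _) ⟩
    ∑ (splittings d) (λ ab → ∑ xs (λ x → interleavings d (λ v → f (x ∷ v)) ab)) ℚ.+
    ∑ (splittings d) (λ ab → ∑ ys (λ y → interleavings d (λ v → f (y ∷ v)) ab))
      ≡⟨ cong₂ ℚ._+_ (∑-cong (splittings d) (λ (a , b) → sym (fromˡ-suc d f a b)))
                     (∑-cong (splittings d) (λ (a , b) → sym (fromʳ-suc d f a b))) ⟩
    ∑ (splittings d) (λ (a , b) → fromˡ d f (suc a , b)) ℚ.+ ∑ (splittings d) (λ (a , b) → fromʳ d f (a , suc b))
      -- Each sum lacks one splitting of `suc d`. With no entry from the list concerned nothing can
      -- come first from it, so the missing term is zero and may be added.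
      ≡⟨ cong₂ ℚ._+_ (sym (absorbˡ (∑ (splittings d) (λ (a , b) → fromˡ d f (suc a , b))) (fromˡ-zero d f (suc d))))
                     (sym (absorbʳ (∑ (splittings d) (λ (a , b) → fromʳ d f (a , suc b))) (fromʳ-zero d f (suc d)))) ⟩
    (fromˡ d f (0 , suc d) ℚ.+ ∑ (splittings d) (λ (a , b) → fromˡ d f (suc a , b))) ℚ.+
    (∑ (splittings d) (λ (a , b) → fromʳ d f (a , suc b)) ℚ.+ fromʳ d f (suc d , 0))
      ≡⟨ cong₂ ℚ._+_ (sym (∑-splittings-∷ d (fromˡ d f))) (sym (∑-splittings-∷ʳ d (fromʳ d f))) ⟩
    ∑ (splittings (suc d)) (fromˡ d f) ℚ.+ ∑ (splittings (suc d)) (fromʳ d f)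
      ≡⟨ sym (∑-+ (splittings (suc d)) (fromˡ d f) (fromʳ d f)) ⟩
    ∑ (splittings (suc d)) (λ ab → fromˡ d f ab ℚ.+ fromʳ d f ab)
      ≡⟨ ∑-cong (splittings (suc d)) (λ ab → sym (interleavings-suc d f ab)) ⟩
    ∑ (splittings (suc d)) (interleavings (suc d) f) ∎

module _ {n : ℕ} where

  infix 4 _≼_
  _≼_ : RootedEdge n → RootedEdge n → Set
  f ≼ g = root f F.≤ root g

  _≼?_ : ∀ f g → Dec (f ≼ g)
  f ≼? g = root f Finₚ.≤? root g

  -- `Linked` compares neighbours, and interleaving changes who is a neighbour; a comparison of all
  -- pairs passes to both parts.
  Sorted : List (RootedEdge n) → Set
  Sorted = AllPairs _≼_

  sorted? : ∀ L → Dec (Sorted L)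
  sorted? = allPairs? _≼?_

  Linked⇒Sorted : ∀ {d} {F : Vec (RootedEdge n) d} → Linked _≼_ F → Sorted (toList F)
  Linked⇒Sorted []                     = []
  Linked⇒Sorted [-]                    = [] ∷ []
  Linked⇒Sorted (f≼g ∷ F@(_ ∷ _))      = case (Linked⇒Sorted F) f≼g
    where
    case : ∀ {f g L} → Sorted (g ∷ L) → f ≼ g → Sorted (f ∷ g ∷ L)
    case s@(g≼ ∷ _) f≼g = (f≼g ∷ All.map (ℕₚ.≤-trans f≼g) g≼) ∷ s
  Linked⇒Sorted (f≼g ∷ [-])            = (f≼g ∷ []) ∷ [] ∷ []

  Sorted⇒Linked : ∀ {d} {F : Vec (RootedEdge n) d} → Sorted (toList F) → Linked _≼_ F
  Sorted⇒Linked {F = []}        []               = []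
  Sorted⇒Linked {F = f ∷ []}    _                = [-]
  Sorted⇒Linked {F = f ∷ g ∷ F} ((f≼g ∷ _) ∷ s)  = f≼g ∷ Sorted⇒Linked s

  private
    _when-sorted_ : ∀ {d} → ℕ → Vec (RootedEdge n) d → ℕ
    c when-sorted F = c Sum.when does (sorted? (toList F))

    sortedCount : ∀ {d} → List (Vec (RootedEdge n) d) → ℕ
    sortedCount Fs = Sum.⨁ Fs (1 when-sorted_)

    sortedCount-none : ∀ {d} (Fs : List (Vec (RootedEdge n) d)) → (∀ {F} → F ∈ Fs → ¬ Sorted (toList F)) → sortedCount Fs ≡ 0
    sortedCount-none Fs h = trans (Sum.⨁-cong-∈ Fs λ {F} F∈ →
      cong (1 Sum.when_) (dec-false (sorted? (toList F)) (h F∈))) (Sum.⨁-ε Fs)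

    sortedCount-∷ : ∀ {d} f (Fs : List (Vec (RootedEdge n) d)) → (∀ {F} → F ∈ Fs → All (f ≼_) (toList F)) →
                    sortedCount (map (f ∷_) Fs) ≡ sortedCount Fs
    sortedCount-∷ f Fs h = trans (Sum.⨁-map (f ∷_) Fs _) (Sum.⨁-cong-∈ Fs λ {F} F∈ →
      cong (1 Sum.when_) (does-⇔ (mk⇔ (λ { (_ ∷ s) → s }) (h F∈ ∷_)) (sorted? (f ∷ toList F)) (sorted? (toList F))))

    sortedCount-∷-none : ∀ {d} f g (Fs : List (Vec (RootedEdge n) d)) → (∀ {F} → F ∈ Fs → g ∈ toList F) → ¬ f ≼ g →
                         sortedCount (map (f ∷_) Fs) ≡ 0
    sortedCount-∷-none f g Fs h f⋠g = sortedCount-none (map (f ∷_) Fs) none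
      where
      none : ∀ {F} → F ∈ map (f ∷_) Fs → ¬ Sorted (toList F)
      none F∈ s with ∈-map⁻ (f ∷_) F∈ | s
      ... | G , G∈ , refl | f≼ ∷ _ = f⋠g (All.lookup f≼ (h G∈))

    All-interleave : ∀ d {P : RootedEdge n → Set} {L₁ L₂ F} → All P L₁ → All P L₂ → F ∈ interleave d L₁ L₂ → All P (toList F)
    All-interleave d p q F∈ = All-resp-↭ (↭-sym (interleave-↭ d F∈)) (Allₚ.++⁺ p q)

  Sorted-interleave⁻ : ∀ d {L₁ L₂ F} → F ∈ interleave d L₁ L₂ → Sorted (toList F) → Sorted L₁ × Sorted L₂
  Sorted-interleave⁻ zero {[]} {[]} _ _ = [] , []
  Sorted-interleave⁻ (suc d) {L₁} {L₂} F∈ s with ∈-++⁻ (interleaveˡ d L₁ L₂) F∈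
  Sorted-interleave⁻ (suc d) {f ∷ L₁} {L₂} F∈ s | inj₁ i with ∈-map⁻ (f ∷_) i | s
  ... | G , G∈ , refl | f≼ ∷ s′ with Sorted-interleave⁻ d G∈ s′
  ...   | s₁ , s₂ = Allₚ.++⁻ˡ L₁ (All-resp-↭ (interleave-↭ d G∈) f≼) ∷ s₁ , s₂
  Sorted-interleave⁻ (suc d) {L₁} {f ∷ L₂} F∈ s | inj₂ i with ∈-map⁻ (f ∷_) i | s
  ... | G , G∈ , refl | f≼ ∷ s′ with Sorted-interleave⁻ d G∈ s′
  ...   | s₁ , s₂ = s₁ , Allₚ.++⁻ʳ L₁ (All-resp-↭ (interleave-↭ d G∈) f≼) ∷ s₂

  rootCount-∷-≡ : ∀ (f : RootedEdge n) L {v} → root f ≡ v → rootCount (f ∷ L) v ≡ suc (rootCount L v)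
  rootCount-∷-≡ f L {v} e rewrite dec-true (root f Finₚ.≟ v) e = refl

  rootCount-∷-≢ : ∀ (f : RootedEdge n) L {v} → root f ≢ v → rootCount (f ∷ L) v ≡ rootCount L v
  rootCount-∷-≢ f L {v} e rewrite dec-false (root f Finₚ.≟ v) e = refl

  module _ (u : Fin n) where

    private
      all-chosen : ∀ k {b} → b ≡ 0 → (k + b) C k ≡ 1
      all-chosen k refl = trans (cong (_C k) (ℕₚ.+-identityʳ k)) (nCn≡1 k)

      none-chosen : ∀ b {k} → k ≡ 0 → (k + b) C k ≡ 1
      none-chosen b refl = refl

    Meet : List (RootedEdge n) → List (RootedEdge n) → Set
    Meet L₁ L₂ = ∀ {f g} → f ∈ L₁ → g ∈ L₂ → root f ≡ root g → root f ≡ u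

    -- Pascal's rule: edges with equal roots in both lists can come in either order.
    sorted-interleavings : ∀ d {L₁ L₂} → length L₁ + length L₂ ≡ d → Meet L₁ L₂ → Sorted L₁ → Sorted L₂ →
      Sum.⨁ (interleave d L₁ L₂) (λ F → 1 Sum.when does (sorted? (toList F))) ≡
      (rootCount L₁ u + rootCount L₂ u) C rootCount L₁ u
    sorted-interleavings zero {[]} {[]} _ _ _ _ = refl
    sorted-interleavings (suc d) {[]} {g ∷ L₂} len meet [] s₂@(g≼ ∷ s₂′) = begin
      sortedCount (map (g ∷_) (interleave d [] L₂))
        ≡⟨ sortedCount-∷ g (interleave d [] L₂) (All-interleave d [] g≼) ⟩
      sortedCount (interleave d [] L₂)
        ≡⟨ sorted-interleavings d (ℕₚ.suc-injective len) (λ ()) [] s₂′ ⟩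
      (rootCount L₂ u) C 0
        ≡⟨⟩
      (rootCount (g ∷ L₂) u) C 0 ∎
      where open ≡-Reasoning
    sorted-interleavings (suc d) {f ∷ L₁} {[]} len meet s₁@(f≼ ∷ s₁′) [] = begin
      sortedCount (map (f ∷_) (interleave d L₁ []) ++ [])
        ≡⟨ cong sortedCount (Listₚ.++-identityʳ (map (f ∷_) (interleave d L₁ []))) ⟩
      sortedCount (map (f ∷_) (interleave d L₁ []))
        ≡⟨ sortedCount-∷ f (interleave d L₁ []) (All-interleave d f≼ []) ⟩
      sortedCount (interleave d L₁ [])
        ≡⟨ sorted-interleavings d (ℕₚ.suc-injective len) (λ _ ()) s₁′ [] ⟩
      (rootCount L₁ u + 0) C rootCount L₁ u
        ≡⟨ all-chosen (rootCount L₁ u) refl ⟩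
      1 ≡⟨ sym (all-chosen (rootCount (f ∷ L₁) u) refl) ⟩
      (rootCount (f ∷ L₁) u + 0) C rootCount (f ∷ L₁) u ∎
      where open ≡-Reasoning
    sorted-interleavings (suc d) {f ∷ L₁} {g ∷ L₂} len meet s₁@(f≼ ∷ s₁′) s₂@(g≼ ∷ s₂′) =
      trans (Sum.⨁-++ (map (f ∷_) (interleave d L₁ (g ∷ L₂))) (map (g ∷_) (interleave d (f ∷ L₁) L₂)) _)
            (by-order (ℕₚ.<-cmp (F.toℕ (root f)) (F.toℕ (root g))))
      where
      open ≡-Reasoning
      left  = sortedCount (map (f ∷_) (interleave d L₁ (g ∷ L₂)))
      right = sortedCount (map (g ∷_) (interleave d (f ∷ L₁) L₂))
      a = rootCount L₁ u
      b = rootCount L₂ u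
      left≡ : f ≼ g → left ≡ (a + rootCount (g ∷ L₂) u) C a
      left≡ f≼g = trans
        (sortedCount-∷ f (interleave d L₁ (g ∷ L₂)) (All-interleave d f≼ (f≼g ∷ All.map (ℕₚ.≤-trans f≼g) g≼)))
        (sorted-interleavings d (ℕₚ.suc-injective len) (λ i j → meet (there i) j) s₁′ s₂)
      right≡ : g ≼ f → right ≡ (rootCount (f ∷ L₁) u + b) C rootCount (f ∷ L₁) u
      right≡ g≼f = trans
        (sortedCount-∷ g (interleave d (f ∷ L₁) L₂) (All-interleave d (g≼f ∷ All.map (ℕₚ.≤-trans g≼f) f≼) g≼))
        (sorted-interleavings d (ℕₚ.suc-injective (trans (sym (ℕₚ.+-suc (length (f ∷ L₁)) (length L₂))) len))
          (λ i j → meet i (there j)) s₁ s₂′)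
      left-none : ¬ f ≼ g → left ≡ 0
      left-none = sortedCount-∷-none f g (interleave d L₁ (g ∷ L₂))
        λ F∈ → ∈-resp-↭ (↭-sym (interleave-↭ d F∈)) (∈-++⁺ʳ L₁ (here refl))
      right-none : ¬ g ≼ f → right ≡ 0
      right-none = sortedCount-∷-none g f (interleave d (f ∷ L₁) L₂)
        λ F∈ → ∈-resp-↭ (↭-sym (interleave-↭ d F∈)) (∈-++⁺ˡ {ys = L₂} (here refl))
      above : ∀ {f g : RootedEdge n} {L} → root f F.< root g → All (g ≼_) L → rootCount (g ∷ L) (root f) ≡ 0
      above {f} {g} {L} f<g g≼ = cong length (Listₚ.filter-none (λ h → root h Finₚ.≟ root f) {xs = g ∷ L}
        ((λ e → ℕₚ.<⇒≢ f<g (cong F.toℕ (sym e))) ∷ All.map (λ g≼h e → ℕₚ.<⇒≱ f<g (subst (root g F.≤_) e g≼h)) g≼))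
      by-order : _ → left + right ≡ (rootCount (f ∷ L₁) u + rootCount (g ∷ L₂) u) C rootCount (f ∷ L₁) u
      -- Only `f` can come first. If its root is `u`, all roots of the other list lie above `u`, and
      -- both binomial coefficients are 1; otherwise `f` does not change the count. The case `g<f`
      -- is the mirror image.
      by-order (tri< f<g _ _) = begin
        left + right                              ≡⟨ cong₂ _+_ (left≡ (ℕₚ.<⇒≤ f<g)) (right-none (ℕₚ.<⇒≱ f<g)) ⟩
        (a + rootCount (g ∷ L₂) u) C a + 0        ≡⟨ ℕₚ.+-identityʳ _ ⟩
        (a + rootCount (g ∷ L₂) u) C a            ≡⟨ drop-f (root f Finₚ.≟ u) ⟩
        (rootCount (f ∷ L₁) u + rootCount (g ∷ L₂) u) C rootCount (f ∷ L₁) u ∎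
        where
        drop-f : Dec (root f ≡ u) → (a + rootCount (g ∷ L₂) u) C a ≡
                 (rootCount (f ∷ L₁) u + rootCount (g ∷ L₂) u) C rootCount (f ∷ L₁) u
        drop-f (no f≢) = cong (λ x → (x + rootCount (g ∷ L₂) u) C x) (sym (rootCount-∷-≢ f L₁ f≢))
        drop-f (yes refl) = trans (all-chosen a (above {f} {g} {L₂} f<g g≼))
          (sym (all-chosen (rootCount (f ∷ L₁) u) (above {f} {g} {L₂} f<g g≼)))
      by-order (tri> _ _ g<f) = begin
        left + right                              ≡⟨ cong₂ _+_ (left-none (ℕₚ.<⇒≱ g<f)) (right≡ (ℕₚ.<⇒≤ g<f)) ⟩
        (rootCount (f ∷ L₁) u + b) C rootCount (f ∷ L₁) u ≡⟨ drop-g (root g Finₚ.≟ u) ⟩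
        (rootCount (f ∷ L₁) u + rootCount (g ∷ L₂) u) C rootCount (f ∷ L₁) u ∎
        where
        drop-g : Dec (root g ≡ u) → (rootCount (f ∷ L₁) u + b) C rootCount (f ∷ L₁) u ≡
                 (rootCount (f ∷ L₁) u + rootCount (g ∷ L₂) u) C rootCount (f ∷ L₁) u
        drop-g (no g≢) = cong (λ x → (rootCount (f ∷ L₁) u + x) C rootCount (f ∷ L₁) u) (sym (rootCount-∷-≢ g L₂ g≢))
        drop-g (yes refl) = trans (none-chosen b (above {g} {f} {L₁} g<f f≼))
          (sym (none-chosen (rootCount (g ∷ L₂) u) (above {g} {f} {L₁} g<f f≼)))
      by-order (tri≈ _ f≡g _) = begin
        left + right
          ≡⟨ cong₂ _+_ (left≡ (ℕₚ.≤-reflexive f≡g)) (right≡ (ℕₚ.≤-reflexive (sym f≡g))) ⟩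
        (a + rootCount (g ∷ L₂) u) C a + (rootCount (f ∷ L₁) u + b) C rootCount (f ∷ L₁) u
          ≡⟨ cong₂ (λ x y → (a + x) C a + (y + b) C y) g-count f-count ⟩
        (a + suc b) C a + (suc a + b) C suc a
          ≡⟨ cong (λ x → x C a + (suc a + b) C suc a) (ℕₚ.+-suc a b) ⟩
        (suc (a + b)) C a + (suc (a + b)) C suc a
          ≡⟨ nCk+nC[k+1]≡[n+1]C[k+1] (suc (a + b)) a ⟩
        (suc (suc (a + b))) C suc a
          ≡⟨ cong (λ x → (suc x) C suc a) (sym (ℕₚ.+-suc a b)) ⟩
        (suc a + suc b) C suc a
          ≡⟨ cong₂ (λ x y → (x + y) C x) (sym f-count) (sym g-count) ⟩
        (rootCount (f ∷ L₁) u + rootCount (g ∷ L₂) u) C rootCount (f ∷ L₁) u ∎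
        where
        f≡u : root f ≡ u
        f≡u = meet (here refl) (here refl) (Finₚ.toℕ-injective f≡g)
        f-count : rootCount (f ∷ L₁) u ≡ suc a
        f-count = rootCount-∷-≡ f L₁ f≡u
        g-count : rootCount (g ∷ L₂) u ≡ suc b
        g-count = rootCount-∷-≡ g L₂ (trans (sym (Finₚ.toℕ-injective f≡g)) f≡u)

-- The coalescence

monotone⇒injective : ∀ {ι : Fin k → Fin n} → ι Preserves F._<_ ⟶ F._<_ → Injective _≡_ _≡_ ι
monotone⇒injective mono {i} {j} e with Finₚ.<-cmp i j
... | tri< i<j _ _ = contradiction (cong F.toℕ e) (ℕₚ.<⇒≢ (mono i<j))
... | tri≈ _ i≡j _ = i≡j
... | tri> _ _ j<i = contradiction (cong F.toℕ (sym e)) (ℕₚ.<⇒≢ (mono j<i))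

monotone-≤ : ∀ {ι : Fin k → Fin n} → ι Preserves F._<_ ⟶ F._<_ → ∀ {i j} → i F.≤ j ⇔ ι i F.≤ ι j
monotone-≤ {ι = ι} mono {i} {j} = mk⇔ to from
  where
  to : i F.≤ j → ι i F.≤ ι j
  to i≤j with Finₚ.<-cmp i j
  ... | tri< i<j _ _  = ℕₚ.<⇒≤ (mono i<j)
  ... | tri≈ _ refl _ = ℕₚ.≤-refl
  ... | tri> _ _ j<i  = contradiction i≤j (ℕₚ.<⇒≱ j<i)
  from : ι i F.≤ ι j → i F.≤ j
  from p with Finₚ.<-cmp i j
  ... | tri< i<j _ _  = ℕₚ.<⇒≤ i<j
  ... | tri≈ _ refl _ = ℕₚ.≤-refl
  ... | tri> _ _ j<i  = contradiction p (ℕₚ.<⇒≱ (mono j<i))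

Sorted-embed : ∀ {ι : Fin k → Fin n} → ι Preserves F._<_ ⟶ F._<_ → ∀ {L} → Sorted L ⇔ Sorted (map (embed ι) L)
Sorted-embed mono = mk⇔ (λ s → AllPairsₚ.map⁺ (AllPairs.map (Equivalence.to (monotone-≤ mono)) s))
                        (λ s → AllPairs.map (Equivalence.from (monotone-≤ mono)) (AllPairsₚ.map⁻ s))

Nonempty-∣∣ : ∀ (e : Subset n) → 0 < ∣ e ∣ → Nonempty e
Nonempty-∣∣ {n} e 0< with nonempty? e
... | yes ne  = ne
... | no none = contradiction (trans (cong ∣_∣ (Empty-unique none)) (∣⊥∣≡0 n)) (ℕₚ.>⇒≢ 0<)

rooted : Subset n → List (RootedEdge n)
rooted e = map (e ,_) (members e)

module _ {ι : Fin k → Fin n} (injective : Injective _≡_ _≡_ ι) where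

  image-injective : Injective _≡_ _≡_ (image ι)
  image-injective eq = ⊆-antisym (sub eq) (sub (sym eq))
    where
    sub : ∀ {e e′} → image ι e ≡ image ι e′ → ∀ {i} → i ∈ˢ e → i ∈ˢ e′
    sub {e} {e′} eq {i} i∈ with ∈-image⁻ {ι = ι} {e′} (subst (ι i ∈ˢ_) eq (∈-image⁺ i∈))
    ... | j , j∈ , e≡ = subst (_∈ˢ e′) (injective e≡) j∈

  members-image : ∀ e → members (image ι e) ↭ map ι (members e)
  members-image e = unique-set-↭ (members-unique _) (Uniqueₚ.map⁺ injective (members-unique e)) to from
    where
    to : ∀ {x} → x ∈ members (image ι e) → x ∈ map ι (members e)
    to x∈ with ∈-image⁻ {ι = ι} {e} (∈-members⁻ x∈)
    ... | i , i∈ , refl = ∈-map⁺ ι (∈-members⁺ i∈)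
    from : ∀ {x} → x ∈ map ι (members e) → x ∈ members (image ι e)
    from x∈ with ∈-map⁻ ι x∈
    ... | i , i∈ , refl = ∈-members⁺ (∈-image⁺ (∈-members⁻ {e = e} i∈))

  rooted-image : ∀ E → concatMap rooted (map (image ι) E) ↭ map (embed ι) (concatMap rooted E)
  rooted-image []      = refl
  rooted-image (e ∷ E) = ↭-trans (↭ₚ.++⁺ one (rooted-image E)) (↭-reflexive (sym (Listₚ.map-++ (embed ι) (rooted e) _)))
    where
    one : rooted (image ι e) ↭ map (embed ι) (rooted e)
    one = ↭-trans (↭ₚ.map⁺ (image ι e ,_) (members-image e))
            (↭-reflexive (trans (sym (Listₚ.map-∘ (members e))) (Listₚ.map-∘ (members e))))

rootedEdges-valid : ∀ {m} → 2 ≤ m → (H : Hypergraph m n) → ∀ {f} → f ∈ rootedEdges H → Valid f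
rootedEdges-valid 2≤m H f∈ with find (∈-concatMap⁻ rooted {xs = edges H} f∈)
... | e , e∈ , i with ∈-map⁻ (e ,_) i
...   | v , v∈ , refl = valid-∈ (∈-members⁻ {e = e} v∈) (subst (2 ≤_) (sym (All.lookup (uniform H) e∈)) 2≤m)

-- Every entry lies in exactly one fibre of `size`. The weight may depend on `t`, as the binomial
-- coefficient and the quotients do.
∑-fibre : ∀ {A : Set} (size : A → ℕ) bound (xs : List A) (g : ℕ → A → ℚ) → (∀ {x} → x ∈ xs → size x ≤ bound) →
          ∑ (upTo (suc bound)) (λ t → ∑ (filter (λ x → size x ℕₚ.≟ t) xs) (g t)) ≡ ∑ xs (λ x → g (size x) x)
∑-fibre size bound xs g ≤bound = begin
  ∑ (upTo (suc bound)) (λ t → ∑ (filter (λ x → size x ℕₚ.≟ t) xs) (g t))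
    ≡⟨ ∑-cong (upTo (suc bound)) (λ t → ∑-filter (λ x → size x ℕₚ.≟ t) xs (g t)) ⟩
  ∑ (upTo (suc bound)) (λ t → ∑ xs (λ x → g t x when does (size x ℕₚ.≟ t)))
    ≡⟨ ∑-swap (upTo (suc bound)) xs _ ⟩
  ∑ xs (λ x → ∑ (upTo (suc bound)) (λ t → g t x when does (size x ℕₚ.≟ t)))
    ≡⟨ ∑-cong-∈ xs (λ {x} x∈ → single (upTo (suc bound)) (Uniqueₚ.upTo⁺ (suc bound)) (∈-upTo⁺ (s≤s (≤bound x∈))) (λ t → g t x)) ⟩
  ∑ xs (λ x → g (size x) x) ∎
  where
  open ≡-Reasoning
  absent : ∀ s ts (h : ℕ → ℚ) → s ∉ ts → ∑ ts (λ t → h t when does (s ℕₚ.≟ t)) ≡ 0ℚ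
  absent s ts h s∉ = trans (∑-cong-∈ ts (λ {t} t∈ → cong (h t when_) (dec-false (s ℕₚ.≟ t) λ { refl → s∉ t∈ }))) (∑-0 ts)
  single : ∀ ts → Unique ts → ∀ {s} → s ∈ ts → (h : ℕ → ℚ) → ∑ ts (λ t → h t when does (s ℕₚ.≟ t)) ≡ h s
  single (t ∷ ts) us (here refl) h = trans
    (cong₂ ℚ._+_ (cong (h t when_) (dec-true (t ℕₚ.≟ t) refl)) (absent t ts h (Unique[x∷xs]⇒x∉xs us)))
    (ℚₚ.+-identityʳ (h t))
  single (t ∷ ts) us@(_ ∷ us′) {s} (there i) h = trans
    (cong₂ ℚ._+_ (cong (h t when_) (dec-false (s ℕₚ.≟ t) λ { refl → Unique[x∷xs]⇒x∉xs us i })) (single ts us′ i h))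
    (ℚₚ.+-identityˡ (h s))

Eulerian⇔List : ∀ {d} (F : Vec (RootedEdge n) d) → Eulerian (R F) ⇔ EulerianList (toList F)
Eulerian⇔List F = mk⇔ (λ (w , w↭ , v , walk) → v , w , w↭ , walk) (λ (v , w , w↭ , walk) → w , w↭ , v , walk)

-- Turns the convention for Tr_{0;0} into an ordinary sum: the empty sequence is Eulerian by the
-- empty walk at `u`, and it is the only term.
Trₜ-as-∑ : ∀ {m} (H : Hypergraph m n) u d t → t ≤ d →
           Trₜ H d t u ≡ ∑ (filter (λ F → r F u ℕₚ.≟ t) (𝓕ᵋ H d)) (ω⁺ m)
Trₜ-as-∑ H u (suc d) t       _ = refl
Trₜ-as-∑ {n} {m} H u zero    zero    _ = sym (begin
  ∑ (filter (λ F → r F u ℕₚ.≟ 0) (𝓕ᵋ H 0)) (ω⁺ m)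
    ≡⟨ cong (λ Fs → ∑ (filter (λ F → r F u ℕₚ.≟ 0) Fs) (ω⁺ m))
         (Listₚ.filter-accept (λ F → eulerian? (R F)) {x = []} {xs = []} ([] , refl , u , refl)) ⟩
  ω⁺ {n} m [] ℚ.+ 0ℚ
    ≡⟨ ℚₚ.+-identityʳ (ω⁺ {n} m []) ⟩
  ω⁺ {n} m [] ∎)
  where open ≡-Reasoning

∑-𝓕ᵋ : ∀ {m} (H : Hypergraph m n) d (f : Vec (RootedEdge n) d → ℚ) → ∑ (𝓕ᵋ H d) f ≡
       ∑ (sequences (rootedEdges H) d) (λ F → (f F when does (eulerian? (R F))) when does (linked? _≼?_ F))
∑-𝓕ᵋ H d f = trans (∑-filter (λ F → eulerian? (R F)) (𝓕 H d) f) (∑-filter (linked? _≼?_) (sequences (rootedEdges H) d) _)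

fromℕ-+ : ∀ a b → fromℕ (a + b) ≡ fromℕ a ℚ.+ fromℕ b
fromℕ-+ a b = ℚₚ.toℚᵘ-injective (begin
  ℚ.toℚᵘ (fromℕ (a + b))                 ≈⟨ ℚₚ.toℚᵘ-fromℚᵘ (mkℚᵘ (ℤ.+ (a + b)) 0) ⟩
  mkℚᵘ (ℤ.+ (a + b)) 0                     ≈⟨ *≡* (cong (ℤ._* ℤ.+ 1) numerators) ⟩
  mkℚᵘ (ℤ.+ a) 0 ℚᵘ.+ mkℚᵘ (ℤ.+ b) 0         ≈⟨ ℚᵘₚ.+-cong (ℚᵘₚ.≃-sym (ℚₚ.toℚᵘ-fromℚᵘ (mkℚᵘ (ℤ.+ a) 0)))
                                                        (ℚᵘₚ.≃-sym (ℚₚ.toℚᵘ-fromℚᵘ (mkℚᵘ (ℤ.+ b) 0))) ⟩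
  ℚ.toℚᵘ (fromℕ a) ℚᵘ.+ ℚ.toℚᵘ (fromℕ b) ≈⟨ ℚᵘₚ.≃-sym (ℚₚ.toℚᵘ-homo-+ (fromℕ a) (fromℕ b)) ⟩
  ℚ.toℚᵘ (fromℕ a ℚ.+ fromℕ b)           ∎)
  where
  open ℚᵘₚ.≃-Reasoning
  numerators : ℤ.+ (a + b) ≡ ℤ.+ a ℤ.* ℤ.+ 1 ℤ.+ ℤ.+ b ℤ.* ℤ.+ 1
  numerators = sym (cong₂ ℤ._+_ (ℤₚ.*-identityʳ (ℤ.+ a)) (ℤₚ.*-identityʳ (ℤ.+ b)))

∑-constant : ∀ {A : Set} c (xs : List A) (b : A → Bool) →
             ∑ xs (λ x → c when b x) ≡ c * fromℕ (Sum.⨁ xs (λ x → 1 Sum.when b x))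
∑-constant c []       b = sym (ℚₚ.*-zeroʳ c)
∑-constant c (x ∷ xs) b with b x
... | false = trans (ℚₚ.+-identityˡ _) (∑-constant c xs b)
... | true  = begin
  c ℚ.+ ∑ xs (λ x → c when b x)     ≡⟨ cong₂ ℚ._+_ (sym (ℚₚ.*-identityʳ c)) (∑-constant c xs b) ⟩
  c * 1ℚ ℚ.+ c * fromℕ N            ≡⟨ sym (ℚₚ.*-distribˡ-+ c 1ℚ (fromℕ N)) ⟩
  c * (1ℚ ℚ.+ fromℕ N)              ≡⟨ cong (c *_) (sym (fromℕ-+ 1 N)) ⟩
  c * fromℕ (suc N)                 ∎
  where
  open ≡-Reasoning
  N = Sum.⨁ xs (λ x → 1 Sum.when b x)

when-none : ∀ {P Q S : Set} (p? : Dec P) (q? : Dec Q) (s? : Dec S) c → ¬ (P × Q × S) →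
            ((c when does s?) when does q?) when does p? ≡ 0ℚ
when-none (no _)  _       _       c _    = refl
when-none (yes _) (no _)  _       c _    = refl
when-none (yes _) (yes _) (no _)  c _    = refl
when-none (yes p) (yes q) (yes s) c none = contradiction (p , q , s) none

by-cases : ∀ {O P Q S : Set} (o? : Dec O) (p? : Dec P) (q? : Dec Q) (s? : Dec S) {x y} →
           (O → P → Q → S → x ≡ y) → (¬ (O × P × Q × S) → x ≡ 0ℚ) →
           x ≡ (((y when does s?) when does q?) when does p?) when does o?
by-cases (no ¬o) _       _       _       _ none = none (λ (o , _) → ¬o o)
by-cases (yes _) (no ¬p) _       _       _ none = none (λ (_ , p , _) → ¬p p)
by-cases (yes _) (yes _) (no ¬q) _       _ none = none (λ (_ , _ , q , _) → ¬q q)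
by-cases (yes _) (yes _) (yes _) (no ¬s) _ none = none (λ (_ , _ , _ , s) → ¬s s)
by-cases (yes o) (yes p) (yes q) (yes s) all _  = all o p q s

zero-factor₀ : ∀ x y z → x ≡ 0ℚ → x * y * z ≡ 0ℚ
zero-factor₀ x y z refl = trans (cong (_* z) (ℚₚ.*-zeroˡ y)) (ℚₚ.*-zeroˡ z)

zero-factor₁ : ∀ x y z w → y ≡ 0ℚ → x * (y * z) * w ≡ 0ℚ
zero-factor₁ x y z w refl = trans (cong (λ p → x * p * w) (ℚₚ.*-zeroˡ z)) (trans (cong (_* w) (ℚₚ.*-zeroʳ x)) (ℚₚ.*-zeroˡ w))

zero-factor₂ : ∀ x y z → y ≡ 0ℚ → x * (y * z) ≡ 0ℚ
zero-factor₂ x y z refl = trans (cong (x *_) (ℚₚ.*-zeroˡ z)) (ℚₚ.*-zeroʳ x)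

rearrange : ∀ c x y z → (x * (y * z)) * c ≡ (x * c) * y * z
rearrange c x y z = begin
  (x * (y * z)) * c   ≡⟨ ℚₚ.*-comm (x * (y * z)) c ⟩
  c * (x * (y * z))   ≡⟨ sym (ℚₚ.*-assoc c x (y * z)) ⟩
  (c * x) * (y * z)   ≡⟨ cong (_* (y * z)) (ℚₚ.*-comm c x) ⟩
  (x * c) * (y * z)   ≡⟨ sym (ℚₚ.*-assoc (x * c) y z) ⟩
  (x * c) * y * z     ∎
  where open ≡-Reasoning

-- The side condition of `multiplicities` is absorbed here, so that the sum can run over all pairs
-- of sequences.
coefficient : ℕ → ℕ → ℕ → ℚ
coefficient d t₁ t₂ = ((d // (t₁ + t₂)) * fromℕ ((t₁ + t₂) C t₁)) when does (0 ℕₚ.<? (t₁ + t₂))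

-- The share of one pair of sequences in the right-hand side of the theorem. A nonempty side without
-- root `u` is discarded by its quotient, not by a condition.
pairWeight : ∀ {n₁ n₂ d₁ d₂} → ℕ → ℕ → Fin n₁ → Fin n₂ → Vec (RootedEdge n₁) d₁ → Vec (RootedEdge n₂) d₂ → ℚ
pairWeight {d₁ = d₁} {d₂} m d u₁ u₂ F₁ F₂ =
  coefficient d t₁ t₂ * ((t₁ // d₁) * ω⁺ m F₁) * ((t₂ // d₂) * ω⁺ m F₂)
  where
  t₁ = rootCount (toList F₁) u₁
  t₂ = rootCount (toList F₂) u₂

splittings-sum : ∀ d {a b} → (a , b) ∈ splittings d → a + b ≡ d
splittings-sum d ab∈ with ∈-map⁻ (λ a → a , d ℕ.∸ a) ab∈
... | a , a∈ , refl = ℕₚ.m+[n∸m]≡n (ℕₚ.≤-pred (∈-upTo⁻ a∈))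

module _ {m n₁ n₂ n : ℕ} (2≤m : 2 ≤ m)
         {H₁ : Hypergraph m n₁} {u₁ : Fin n₁} {H₂ : Hypergraph m n₂} {u₂ : Fin n₂}
         {H : Hypergraph m n} (coalescence : Coalescence H₁ u₁ H₂ u₂ H) where
  open Coalescence coalescence renaming (vertex to u)

  gluing : Gluing ι₁ u₁ ι₂ u₂
  gluing = record
    { injective₁ = monotone⇒injective monotone₁
    ; injective₂ = monotone⇒injective monotone₂
    ; glued      = glued
    ; separated  = separated _ _
    }

  open Gluing gluing using (injective₁; injective₂)

  -- The glued vertex is in both images, hence the extra `u`. Once one copy is set aside, the images
  -- are disjoint and still cover all vertices.
  vertices-↭ : u ∷ allFin n ↭ map ι₁ (allFin n₁) ++ map ι₂ (allFin n₂)
  vertices-↭ with ∈-∃↭ (∈-allFin u₂)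
  ... | rest , rest↭ = ↭-sym (begin
    map ι₁ (allFin n₁) ++ map ι₂ (allFin n₂)   ↭⟨ ↭ₚ.++⁺ˡ _ (↭ₚ.map⁺ ι₂ rest↭) ⟩
    map ι₁ (allFin n₁) ++ ι₂ u₂ ∷ map ι₂ rest  ↭⟨ shift (ι₂ u₂) (map ι₁ (allFin n₁)) _ ⟩
    ι₂ u₂ ∷ map ι₁ (allFin n₁) ++ map ι₂ rest  ≡⟨ cong (_∷ map ι₁ (allFin n₁) ++ map ι₂ rest) (sym glued) ⟩
    u ∷ map ι₁ (allFin n₁) ++ map ι₂ rest      ↭⟨ prep u (unique-set-↭ distinct (Uniqueₚ.allFin⁺ n) (λ _ → ∈-allFin _) (λ _ → all _)) ⟩
    u ∷ allFin n                               ∎)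
    where
    open PermutationReasoning
    rest-unique : Unique (u₂ ∷ rest)
    rest-unique = Unique-↭ rest↭ (Uniqueₚ.allFin⁺ n₂)
    disjoint : ∀ {v} → v ∈ map ι₁ (allFin n₁) × v ∈ map ι₂ rest → ⊥
    disjoint (p , q) with ∈-map⁻ ι₁ p | ∈-map⁻ ι₂ q
    ... | i , _ , refl | j , j∈ , e with separated i j e
    ...   | _ , refl = Unique[x∷xs]⇒x∉xs rest-unique j∈
    distinct : Unique (map ι₁ (allFin n₁) ++ map ι₂ rest)
    distinct = Uniqueₚ.++⁺ (Uniqueₚ.map⁺ injective₁ (Uniqueₚ.allFin⁺ n₁))
               (Uniqueₚ.map⁺ injective₂ (tail rest-unique)) disjoint
      where
      tail : ∀ {x} {xs : List (Fin n₂)} → Unique (x ∷ xs) → Unique xs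
      tail (_ ∷ us) = us
    all : ∀ v → v ∈ map ι₁ (allFin n₁) ++ map ι₂ rest
    all v with covers v
    ... | inj₁ (i , refl) = ∈-++⁺ˡ (∈-map⁺ ι₁ (∈-allFin i))
    ... | inj₂ (j , refl) with ∈-resp-↭ rest↭ (∈-allFin j)
    ...   | here refl = ∈-++⁺ˡ (subst (_∈ map ι₁ (allFin n₁)) glued (∈-map⁺ ι₁ (∈-allFin u₁)))
    ...   | there j∈  = ∈-++⁺ʳ _ (∈-map⁺ ι₂ j∈)

  -- An edge in both images could contain only the glued vertex, but it has at least two vertices.
  edges-↭ : edges H ↭ map (image ι₁) (edges H₁) ++ map (image ι₂) (edges H₂)
  edges-↭ = unique-set-↭ (simple H)
    (Uniqueₚ.++⁺ (Uniqueₚ.map⁺ (image-injective injective₁) (simple H₁))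
                 (Uniqueₚ.map⁺ (image-injective injective₂) (simple H₂)) disjoint)
    (λ {e} e∈ → join (Equivalence.to (edges-⇔ e) e∈))
    (λ {e} e∈ → Equivalence.from (edges-⇔ e) (∈-++⁻ (map (image ι₁) (edges H₁)) e∈))
    where
    join : ∀ {e} → e ∈ map (image ι₁) (edges H₁) ⊎ e ∈ map (image ι₂) (edges H₂) → e ∈ _
    join (inj₁ i) = ∈-++⁺ˡ i
    join (inj₂ i) = ∈-++⁺ʳ _ i
    disjoint : ∀ {e} → e ∈ map (image ι₁) (edges H₁) × e ∈ map (image ι₂) (edges H₂) → ⊥
    disjoint (p , q) with ∈-map⁻ (image ι₁) p | ∈-map⁻ (image ι₂) q
    ... | e₁ , e₁∈ , refl | e₂ , e₂∈ , eq = two (Nonempty-∣∣ e₁ (ℕₚ.≤-trans (s≤s z≤n) 2≤∣e₁∣))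
      where
      2≤∣e₁∣ : 2 ≤ ∣ e₁ ∣
      2≤∣e₁∣ = subst (2 ≤_) (sym (All.lookup (uniform H₁) e₁∈)) 2≤m
      only-u₁ : ∀ {i} → i ∈ˢ e₁ → i ≡ u₁
      only-u₁ {i} i∈ with ∈-image⁻ {ι = ι₂} {e₂} (subst (ι₁ i ∈ˢ_) eq (∈-image⁺ i∈))
      ... | j , _ , e = proj₁ (separated i j (sym e))
      two : Nonempty e₁ → ⊥
      two (i , i∈) with Valid.second (valid-∈ i∈ 2≤∣e₁∣)
      ... | w , w∈ , w≢ = w≢ (trans (only-u₁ w∈) (sym (only-u₁ i∈)))

  rootedEdges-↭ : rootedEdges H ↭ map (embed ι₁) (rootedEdges H₁) ++ map (embed ι₂) (rootedEdges H₂)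
  rootedEdges-↭ = ↭-trans (concatMap-↭ rooted edges-↭)
    (↭-trans (↭-reflexive (Listₚ.concatMap-++ rooted (map (image ι₁) (edges H₁)) _))
             (↭ₚ.++⁺ (rooted-image injective₁ (edges H₁)) (rooted-image injective₂ (edges H₂))))

  module _ {d : ℕ} .{{_ : NonZero d}} {d₁ d₂ : ℕ} (d₁+d₂≡d : d₁ + d₂ ≡ d)
           (F₁ : Vec (RootedEdge n₁) d₁) (F₂ : Vec (RootedEdge n₂) d₂)
           (vs₁ : All Valid (toList F₁)) (vs₂ : All Valid (toList F₂)) where

    private
      L₁ = toList F₁
      L₂ = toList F₂
      t₁ = rootCount L₁ u₁
      t₂ = rootCount L₂ u₂

      shuffles : List (Vec (RootedEdge n) d)
      shuffles = interleave d (toList (Vec.map (embed ι₁) F₁)) (toList (Vec.map (embed ι₂) F₂))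

      shuffles≡ : shuffles ≡ interleave d (map (embed ι₁) L₁) (map (embed ι₂) L₂)
      shuffles≡ = cong₂ (interleave d) (Vecₚ.toList-map (embed ι₁) F₁) (Vecₚ.toList-map (embed ι₂) F₂)

      shuffle-↭ : ∀ {F} → F ∈ shuffles → toList F ↭ glueEdges gluing L₁ L₂
      shuffle-↭ F∈ = interleave-↭ d (subst (_ ∈_) shuffles≡ F∈)

      summand : Vec (RootedEdge n) d → ℚ
      summand F = ((ω m F when does (0 ℕₚ.<? r F u)) when does (eulerian? (R F))) when does (linked? _≼?_ F)

      r-shuffle : ∀ {F} → F ∈ shuffles → r F u ≡ t₁ + t₂
      r-shuffle {F} F∈ = trans (r≡rootCount F u) (trans (rootCount-↭ (shuffle-↭ F∈) u) (rootCount-glue gluing L₁ L₂))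

      -- What a contributing shuffle requires of the pair itself, whatever the order of its entries;
      -- for a compatible pair, being sorted is the only condition left on a shuffle.
      Compatible : Set
      Compatible = (Linked _≼_ F₁ × Linked _≼_ F₂) ×
        (Eulerian (R F₁) × Anchored L₁ u₁) × (Eulerian (R F₂) × Anchored L₂ u₂) × 0 < t₁ + t₂

      sorted-shuffle⁻ : ∀ {F} → F ∈ shuffles → Linked _≼_ F → Linked _≼_ F₁ × Linked _≼_ F₂
      sorted-shuffle⁻ F∈ lk with Sorted-interleave⁻ d (subst (_ ∈_) shuffles≡ F∈) (Linked⇒Sorted lk)
      ... | s₁ , s₂ = Sorted⇒Linked (Equivalence.from (Sorted-embed monotone₁) s₁) ,
                      Sorted⇒Linked (Equivalence.from (Sorted-embed monotone₂) s₂)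

      compatible : ∀ {F} → F ∈ shuffles → Linked _≼_ F → Eulerian (R F) → 0 < r F u → Compatible
      compatible {F} F∈ lk e 0<
        with EulerianList-unglue gluing {L₁} {L₂} vs₁ vs₂ (EulerianList-↭ (shuffle-↭ F∈) (Equivalence.to (Eulerian⇔List F) e))
               (subst (0 <_) (trans (r≡rootCount F u) (rootCount-↭ (shuffle-↭ F∈) u)) 0<)
      ... | (e₁ , a₁) , (e₂ , a₂) = sorted-shuffle⁻ F∈ lk , (Equivalence.from (Eulerian⇔List F₁) e₁ , a₁) ,
        (Equivalence.from (Eulerian⇔List F₂) e₂ , a₂) , subst (0 <_) (r-shuffle F∈) 0<

      incompatible : ¬ Compatible → ∑ shuffles summand ≡ 0ℚ
      incompatible none = trans (∑-cong-∈ shuffles vanishing) (∑-0 shuffles)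
        where
        vanishing : ∀ {F} → F ∈ shuffles → summand F ≡ 0ℚ
        vanishing {F} F∈ = when-none (linked? _≼?_ F) (eulerian? (R F)) (0 ℕₚ.<? r F u) (ω m F)
          (λ (lk , e , 0<) → none (compatible F∈ lk e 0<))

      weight : ℚ
      weight = (d // (t₁ + t₂)) * (((t₁ // d₁) * ω⁺ m F₁) * ((t₂ // d₂) * ω⁺ m F₂))

      -- The shuffles are permutations of one glued list and so have the same weight; only the
      -- number of sorted ones matters.
      compatible-sum : Compatible → ∑ shuffles summand ≡ weight * fromℕ ((t₁ + t₂) C t₁)
      compatible-sum ((lk₁ , lk₂) , (e₁ , a₁) , (e₂ , a₂) , 0<t) = begin
        ∑ shuffles summand
          ≡⟨ ∑-cong-∈ shuffles constant ⟩
        ∑ shuffles (λ F → weight when does (sorted? (toList F)))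
          ≡⟨ cong (λ Fs → ∑ Fs (λ F → weight when does (sorted? (toList F)))) shuffles≡ ⟩
        ∑ (interleave d (map (embed ι₁) L₁) (map (embed ι₂) L₂)) (λ F → weight when does (sorted? (toList F)))
          ≡⟨ ∑-constant weight (interleave d (map (embed ι₁) L₁) (map (embed ι₂) L₂)) (λ F → does (sorted? (toList F))) ⟩
        weight * fromℕ (Sum.⨁ (interleave d (map (embed ι₁) L₁) (map (embed ι₂) L₂)) (λ F → 1 Sum.when does (sorted? (toList F))))
          ≡⟨ cong (λ c → weight * fromℕ c) (sorted-interleavings u d lengths meet
               (Equivalence.to (Sorted-embed monotone₁) (Linked⇒Sorted lk₁)) (Equivalence.to (Sorted-embed monotone₂) (Linked⇒Sorted lk₂))) ⟩
        weight * fromℕ ((rootCount (map (embed ι₁) L₁) u + rootCount (map (embed ι₂) L₂) u) C rootCount (map (embed ι₁) L₁) u)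
          ≡⟨ cong₂ (λ a b → weight * fromℕ ((a + b) C a)) (rootCount-embed injective₁ L₁ u₁)
               (trans (cong (rootCount (map (embed ι₂) L₂)) glued) (rootCount-embed injective₂ L₂ u₂)) ⟩
        weight * fromℕ ((t₁ + t₂) C t₁) ∎
        where
        open ≡-Reasoning
        el₁ = Equivalence.to (Eulerian⇔List F₁) e₁
        el₂ = Equivalence.to (Eulerian⇔List F₂) e₂
        lengths : length (map (embed ι₁) L₁) + length (map (embed ι₂) L₂) ≡ d
        lengths = trans (cong₂ _+_ (trans (Listₚ.length-map (embed ι₁) L₁) (Vecₚ.length-toList F₁))
                                   (trans (Listₚ.length-map (embed ι₂) L₂) (Vecₚ.length-toList F₂))) d₁+d₂≡d
        meet : Meet u (map (embed ι₁) L₁) (map (embed ι₂) L₂)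
        meet f∈ g∈ eq with ∈-map⁻ (embed ι₁) f∈ | ∈-map⁻ (embed ι₂) g∈
        ... | f , _ , refl | g , _ , refl = cong ι₁ (proj₁ (separated _ _ eq))
        constant : ∀ {F} → F ∈ shuffles → summand F ≡ (weight when does (sorted? (toList F)))
        constant {F} F∈ =
          cong₂ _when_ value (does-⇔ (mk⇔ Linked⇒Sorted Sorted⇒Linked) (linked? _≼?_ F) (sorted? (toList F)))
          where
          value : ((ω m F when does (0 ℕₚ.<? r F u)) when does (eulerian? (R F))) ≡ weight
          value = trans
            (cong₂ (λ b c → (ω m F when b) when c)
              (dec-true (0 ℕₚ.<? r F u) (subst (0 <_) (sym (r-shuffle F∈)) 0<t))
              (dec-true (eulerian? (R F)) (Equivalence.from (Eulerian⇔List F)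
                (EulerianList-↭ (↭-sym (shuffle-↭ F∈)) (EulerianList-glue gluing vs₁ vs₂ a₁ a₂ el₁ el₂)))))
            (ω-glue 2≤m gluing vertices-↭ F F₁ F₂ (shuffle-↭ F∈) vs₁ vs₂ el₁ el₂ a₁ a₂ 0<t)

    private
      term : ℚ
      term = pairWeight m d u₁ u₂ F₁ F₂

      -- The two readings of a zero multiplicity: `0 // 0 = 1ℚ` keeps an empty side, while
      -- `0 // d = 0ℚ` with `d > 0` removes a nonempty side that the glued vertex does not anchor.
      anchored? : ∀ {n d} (F : Vec (RootedEdge n) d) v →
                  Anchored (toList F) v ⊎ (¬ Anchored (toList F) v × rootCount (toList F) v // d ≡ 0ℚ)
      anchored? []                    v = inj₁ (inj₁ refl)
      anchored? {d = suc d} F@(_ ∷ _) v with rootCount (toList F) v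
      ... | zero  = inj₂ ((λ { (inj₂ ()) }) , //-cross 0 (suc d) 0 1 (s≤s z≤n) (s≤s z≤n) refl)
      ... | suc k = inj₁ (inj₂ (s≤s z≤n))

      term-compatible : Compatible → weight * fromℕ ((t₁ + t₂) C t₁) ≡ term
      term-compatible (_ , _ , _ , 0<t) = trans
        (rearrange (fromℕ ((t₁ + t₂) C t₁)) (d // (t₁ + t₂)) ((t₁ // d₁) * ω⁺ m F₁) ((t₂ // d₂) * ω⁺ m F₂))
        (cong (λ c → c * ((t₁ // d₁) * ω⁺ m F₁) * ((t₂ // d₂) * ω⁺ m F₂))
          (cong (((d // (t₁ + t₂)) * fromℕ ((t₁ + t₂) C t₁)) when_) (sym (dec-true (0 ℕₚ.<? (t₁ + t₂)) 0<t))))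

      vanish₁ : t₁ // d₁ ≡ 0ℚ → term ≡ 0ℚ
      vanish₁ = zero-factor₁ (coefficient d t₁ t₂) (t₁ // d₁) (ω⁺ m F₁) ((t₂ // d₂) * ω⁺ m F₂)

      vanish₂ : t₂ // d₂ ≡ 0ℚ → term ≡ 0ℚ
      vanish₂ = zero-factor₂ (coefficient d t₁ t₂ * ((t₁ // d₁) * ω⁺ m F₁)) (t₂ // d₂) (ω⁺ m F₂)

      vanish₀ : ¬ 0 < t₁ + t₂ → term ≡ 0ℚ
      vanish₀ 0≮ = zero-factor₀ (coefficient d t₁ t₂) ((t₁ // d₁) * ω⁺ m F₁) ((t₂ // d₂) * ω⁺ m F₂)
        (cong (((d // (t₁ + t₂)) * fromℕ ((t₁ + t₂) C t₁)) when_) (dec-false (0 ℕₚ.<? (t₁ + t₂)) 0≮))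

    -- For an incompatible pair both sides vanish: on the left no shuffle contributes, on the right
    -- a condition fails or a factor is zero. The conditions are nested so that `∑-𝓕ᵋ` can be
    -- applied backwards, once for each side.
    shuffle-sum : ∑ (interleave d (toList (Vec.map (embed ι₁) F₁)) (toList (Vec.map (embed ι₂) F₂)))
        (λ F → ((ω m F when does (0 ℕₚ.<? r F u)) when does (eulerian? (R F))) when does (linked? _≼?_ F)) ≡
      (((pairWeight m d u₁ u₂ F₁ F₂ when does (eulerian? (R F₂))) when does (linked? _≼?_ F₂))
        when does (eulerian? (R F₁))) when does (linked? _≼?_ F₁)
    shuffle-sum = by-cases (linked? _≼?_ F₁) (eulerian? (R F₁)) (linked? _≼?_ F₂) (eulerian? (R F₂))
      (λ lk₁ e₁ lk₂ e₂ → all-hold lk₁ e₁ lk₂ e₂ (anchored? F₁ u₁) (anchored? F₂ u₂) (0 ℕₚ.<? (t₁ + t₂)))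
      (λ none → incompatible (λ ((lk₁ , lk₂) , (e₁ , _) , (e₂ , _) , _) → none (lk₁ , e₁ , lk₂ , e₂)))
      where
      dichotomy : Compatible ⊎ (¬ Compatible × term ≡ 0ℚ) → ∑ shuffles summand ≡ term
      dichotomy (inj₁ c)        = trans (compatible-sum c) (term-compatible c)
      dichotomy (inj₂ (¬c , z)) = trans (incompatible ¬c) (sym z)
      all-hold : Linked _≼_ F₁ → Eulerian (R F₁) → Linked _≼_ F₂ → Eulerian (R F₂) →
                 Anchored L₁ u₁ ⊎ (¬ Anchored L₁ u₁ × t₁ // d₁ ≡ 0ℚ) →
                 Anchored L₂ u₂ ⊎ (¬ Anchored L₂ u₂ × t₂ // d₂ ≡ 0ℚ) →
                 Dec (0 < t₁ + t₂) → ∑ shuffles summand ≡ term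
      all-hold _ _ _ _ _                 _                (no 0≮)  = dichotomy (inj₂ ((λ (_ , _ , _ , 0<) → 0≮ 0<) , vanish₀ 0≮))
      all-hold _ _ _ _ (inj₂ (¬a₁ , z)) _                (yes 0<) = dichotomy (inj₂ ((λ (_ , (_ , a₁) , _) → ¬a₁ a₁) , vanish₁ z))
      all-hold _ _ _ _ (inj₁ a₁)        (inj₂ (¬a₂ , z)) (yes 0<) = dichotomy (inj₂ ((λ (_ , _ , (_ , a₂) , _) → ¬a₂ a₂) , vanish₂ z))
      all-hold lk₁ e₁ lk₂ e₂ (inj₁ a₁)        (inj₁ a₂)        (yes 0<) = dichotomy (inj₁ ((lk₁ , lk₂) , (e₁ , a₁) , (e₂ , a₂) , 0<))

-- The right-hand side as a sum over pairs of sequences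

module _ {m n₁ n₂ : ℕ} (H₁ : Hypergraph m n₁) (u₁ : Fin n₁) (H₂ : Hypergraph m n₂) (u₂ : Fin n₂) (d d₁ d₂ : ℕ) where
  open ≡-Reasoning

  private
    ts₁ = upTo (suc d₁)
    ts₂ = upTo (suc d₂)

    X : ℕ → Vec (RootedEdge n₁) d₁ → ℚ
    X t F = (t // d₁) * ω⁺ m F

    Y : ℕ → Vec (RootedEdge n₂) d₂ → ℚ
    Y t F = (t // d₂) * ω⁺ m F

    fibre₁ : ℕ → List (Vec (RootedEdge n₁) d₁)
    fibre₁ t = filter (λ F → r F u₁ ℕₚ.≟ t) (𝓕ᵋ H₁ d₁)

    fibre₂ : ℕ → List (Vec (RootedEdge n₂) d₂)
    fibre₂ t = filter (λ F → r F u₂ ℕₚ.≟ t) (𝓕ᵋ H₂ d₂)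

    summand : ℕ × ℕ → ℚ
    summand (t₁ , t₂) =
      (d // (t₁ + t₂)) * fromℕ ((t₁ + t₂) C t₁) * (t₁ // d₁) * Trₜ H₁ d₁ t₁ u₁ * (t₂ // d₂) * Trₜ H₂ d₂ t₂ u₂

    group : ∀ x c p q s t b → (x * c * p * q * s * t) when b ≡ ((x * c) when b) * (p * q) * (s * t)
    group x c p q s t true = begin
      x * c * p * q * s * t       ≡⟨ ℚₚ.*-assoc (x * c * p * q) s t ⟩
      x * c * p * q * (s * t)     ≡⟨ cong (_* (s * t)) (ℚₚ.*-assoc (x * c) p q) ⟩
      x * c * (p * q) * (s * t)   ∎
    group x c p q s t false = sym (zero-factor₀ 0ℚ (p * q) (s * t) refl)

    scaled-Trₜ : ∀ {n d} (H : Hypergraph m n) u t → t ∈ upTo (suc d) →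
                 (t // d) * Trₜ H d t u ≡ ∑ (filter (λ F → r F u ℕₚ.≟ t) (𝓕ᵋ H d)) (λ F → (t // d) * ω⁺ m F)
    scaled-Trₜ {d = d} H u t t∈ = trans (cong ((t // d) *_) (Trₜ-as-∑ H u d t (ℕₚ.≤-pred (∈-upTo⁻ t∈))))
                                        (*-distribˡ-∑ (t // d) (filter (λ F → r F u ℕₚ.≟ t) (𝓕ᵋ H d)) (ω⁺ m))

    product-of-sums : ∀ {A B : Set} c (xs : List A) (ys : List B) f g →
                      c * ∑ xs f * ∑ ys g ≡ ∑ xs (λ x → ∑ ys (λ y → c * f x * g y))
    product-of-sums c xs ys f g = begin
      c * ∑ xs f * ∑ ys g                       ≡⟨ cong (_* ∑ ys g) (*-distribˡ-∑ c xs f) ⟩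
      ∑ xs (λ x → c * f x) * ∑ ys g             ≡⟨ *-distribʳ-∑ (∑ ys g) xs (λ x → c * f x) ⟩
      ∑ xs (λ x → c * f x * ∑ ys g)             ≡⟨ ∑-cong xs (λ x → *-distribˡ-∑ (c * f x) ys g) ⟩
      ∑ xs (λ x → ∑ ys (λ y → c * f x * g y))   ∎

    r≤d : ∀ {n d} (F : Vec (RootedEdge n) d) v → r F v ≤ d
    r≤d F v = Vecₚ.count≤n (λ f → root f Finₚ.≟ v) F

  -- A pair of sequences belongs to exactly one `(t₁ , t₂)`, its multiplicities at the glued
  -- vertices, and these are within range because a sequence of length `d` has `d` roots.
  ∑-multiplicities : ∑ (multiplicities d₁ d₂) (λ (t₁ , t₂) →
      (d // (t₁ + t₂)) * fromℕ ((t₁ + t₂) C t₁) * (t₁ // d₁) * Trₜ H₁ d₁ t₁ u₁ * (t₂ // d₂) * Trₜ H₂ d₂ t₂ u₂) ≡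
    ∑ (𝓕ᵋ H₁ d₁) (λ F₁ → ∑ (𝓕ᵋ H₂ d₂) (pairWeight m d u₁ u₂ F₁))
  ∑-multiplicities = begin
    ∑ (multiplicities d₁ d₂) summand
      ≡⟨ ∑-filter (λ (t₁ , t₂) → 0 ℕₚ.<? (t₁ + t₂)) (cartesianProduct ts₁ ts₂) summand ⟩
    ∑ (cartesianProduct ts₁ ts₂) (λ (t₁ , t₂) → summand (t₁ , t₂) when does (0 ℕₚ.<? (t₁ + t₂)))
      ≡⟨ ∑-cartesianProductWith _,_ ts₁ ts₂ (λ (t₁ , t₂) → summand (t₁ , t₂) when does (0 ℕₚ.<? (t₁ + t₂))) ⟩
    ∑ ts₁ (λ t₁ → ∑ ts₂ (λ t₂ → summand (t₁ , t₂) when does (0 ℕₚ.<? (t₁ + t₂))))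
      ≡⟨ ∑-cong-∈ ts₁ (λ {t₁} t₁∈ → ∑-cong-∈ ts₂ (λ {t₂} t₂∈ → split t₁ t₂ t₁∈ t₂∈)) ⟩
    ∑ ts₁ (λ t₁ → ∑ ts₂ (λ t₂ → ∑ (fibre₁ t₁) (λ F₁ → ∑ (fibre₂ t₂) (λ F₂ → g t₁ t₂ F₁ F₂))))
      ≡⟨ ∑-cong ts₁ (λ t₁ → ∑-swap ts₂ (fibre₁ t₁) (λ t₂ F₁ → ∑ (fibre₂ t₂) (g t₁ t₂ F₁))) ⟩
    ∑ ts₁ (λ t₁ → ∑ (fibre₁ t₁) (λ F₁ → ∑ ts₂ (λ t₂ → ∑ (fibre₂ t₂) (g t₁ t₂ F₁))))
      ≡⟨ ∑-fibre (λ F → r F u₁) d₁ (𝓕ᵋ H₁ d₁) (λ t₁ F₁ → ∑ ts₂ (λ t₂ → ∑ (fibre₂ t₂) (g t₁ t₂ F₁))) (λ {F} _ → r≤d F u₁) ⟩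
    ∑ (𝓕ᵋ H₁ d₁) (λ F₁ → ∑ ts₂ (λ t₂ → ∑ (fibre₂ t₂) (g (r F₁ u₁) t₂ F₁)))
      ≡⟨ ∑-cong (𝓕ᵋ H₁ d₁) (λ F₁ → ∑-fibre (λ F → r F u₂) d₂ (𝓕ᵋ H₂ d₂) (λ t₂ → g (r F₁ u₁) t₂ F₁) (λ {F} _ → r≤d F u₂)) ⟩
    ∑ (𝓕ᵋ H₁ d₁) (λ F₁ → ∑ (𝓕ᵋ H₂ d₂) (λ F₂ → g (r F₁ u₁) (r F₂ u₂) F₁ F₂))
      ≡⟨ ∑-cong (𝓕ᵋ H₁ d₁) (λ F₁ → ∑-cong (𝓕ᵋ H₂ d₂) (λ F₂ →
           cong₂ (λ t₁ t₂ → g t₁ t₂ F₁ F₂) (r≡rootCount F₁ u₁) (r≡rootCount F₂ u₂))) ⟩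
    ∑ (𝓕ᵋ H₁ d₁) (λ F₁ → ∑ (𝓕ᵋ H₂ d₂) (pairWeight m d u₁ u₂ F₁)) ∎
    where
    g : ℕ → ℕ → Vec (RootedEdge n₁) d₁ → Vec (RootedEdge n₂) d₂ → ℚ
    g t₁ t₂ F₁ F₂ = coefficient d t₁ t₂ * X t₁ F₁ * Y t₂ F₂
    split : ∀ t₁ t₂ → t₁ ∈ ts₁ → t₂ ∈ ts₂ → summand (t₁ , t₂) when does (0 ℕₚ.<? (t₁ + t₂)) ≡
            ∑ (fibre₁ t₁) (λ F₁ → ∑ (fibre₂ t₂) (λ F₂ → g t₁ t₂ F₁ F₂))
    split t₁ t₂ t₁∈ t₂∈ = begin
      summand (t₁ , t₂) when does (0 ℕₚ.<? (t₁ + t₂))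
        ≡⟨ group (d // (t₁ + t₂)) (fromℕ ((t₁ + t₂) C t₁)) (t₁ // d₁) (Trₜ H₁ d₁ t₁ u₁) (t₂ // d₂) (Trₜ H₂ d₂ t₂ u₂)
             (does (0 ℕₚ.<? (t₁ + t₂))) ⟩
      coefficient d t₁ t₂ * ((t₁ // d₁) * Trₜ H₁ d₁ t₁ u₁) * ((t₂ // d₂) * Trₜ H₂ d₂ t₂ u₂)
        ≡⟨ cong₂ (λ p q → coefficient d t₁ t₂ * p * q) (scaled-Trₜ H₁ u₁ t₁ t₁∈) (scaled-Trₜ H₂ u₂ t₂ t₂∈) ⟩
      coefficient d t₁ t₂ * ∑ (fibre₁ t₁) (X t₁) * ∑ (fibre₂ t₂) (Y t₂)
        ≡⟨ product-of-sums (coefficient d t₁ t₂) (fibre₁ t₁) (fibre₂ t₂) (X t₁) (Y t₂) ⟩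
      ∑ (fibre₁ t₁) (λ F₁ → ∑ (fibre₂ t₂) (λ F₂ → g t₁ t₂ F₁ F₂)) ∎

lemma3p1 : ∀ {m n₁ n₂ n : ℕ} → 2 ≤ m →
    (H₁ : Hypergraph m n₁) (u₁ : Fin n₁) (H₂ : Hypergraph m n₂) (u₂ : Fin n₂) →
    Nontrivial H₁ → Connected H₁ → Nontrivial H₂ → Connected H₂ →
    (H : Hypergraph m n) (coalescence : Coalescence H₁ u₁ H₂ u₂ H) →
    (d : ℕ) .{{_ : NonZero d}} →
    Tr H d (Coalescence.vertex coalescence) ≡
    ∑ (splittings d) (λ (d₁ , d₂) →
    ∑ (multiplicities d₁ d₂) (λ (t₁ , t₂) →
    (d // (t₁ + t₂)) * fromℕ ((t₁ + t₂) C t₁) *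
    (t₁ // d₁) * Trₜ H₁ d₁ t₁ u₁ *
    (t₂ // d₂) * Trₜ H₂ d₂ t₂ u₂))
lemma3p1 {m} {n₁} {n₂} {n} 2≤m H₁ u₁ H₂ u₂ _ _ _ _ H coalescence d = begin
  ∑ (filter (λ F → 0 ℕₚ.<? r F u) (𝓕ᵋ H d)) (ω m)
    ≡⟨ ∑-filter (λ F → 0 ℕₚ.<? r F u) (𝓕ᵋ H d) (ω m) ⟩
  ∑ (𝓕ᵋ H d) (λ F → ω m F when does (0 ℕₚ.<? r F u))
    ≡⟨ ∑-𝓕ᵋ H d (λ F → ω m F when does (0 ℕₚ.<? r F u)) ⟩
  ∑ (sequences (rootedEdges H) d) summand
    -- `H` may list its edges in any order; after this step every entry of a sequence visibly comes
    -- from one side.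
    ≡⟨ ∑-sequences-↭ (rootedEdges-↭ 2≤m coalescence) d summand ⟩
  ∑ (sequences (map (embed ι₁) (rootedEdges H₁) ++ map (embed ι₂) (rootedEdges H₂)) d) summand
    ≡⟨ ∑-sequences-++ (map (embed ι₁) (rootedEdges H₁)) (map (embed ι₂) (rootedEdges H₂)) d summand ⟩
  ∑ (splittings d) (λ (d₁ , d₂) →
    ∑ (sequences (map (embed ι₁) (rootedEdges H₁)) d₁) λ F₁ →
    ∑ (sequences (map (embed ι₂) (rootedEdges H₂)) d₂) λ F₂ → ∑ (interleave d (toList F₁) (toList F₂)) summand)
    ≡⟨ ∑-cong-∈ (splittings d) (λ {(d₁ , d₂)} ∈s → trans (by-sizes d₁ d₂ (splittings-sum d ∈s))
         (sym (∑-multiplicities H₁ u₁ H₂ u₂ d d₁ d₂))) ⟩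
  _ ∎
  where
  open ≡-Reasoning
  open Coalescence coalescence renaming (vertex to u)

  summand : Vec (RootedEdge n) d → ℚ
  summand F = ((ω m F when does (0 ℕₚ.<? r F u)) when does (eulerian? (R F))) when does (linked? _≼?_ F)

  by-sizes : ∀ d₁ d₂ → d₁ + d₂ ≡ d →
    (∑ (sequences (map (embed ι₁) (rootedEdges H₁)) d₁) λ F₁ →
     ∑ (sequences (map (embed ι₂) (rootedEdges H₂)) d₂) λ F₂ → ∑ (interleave d (toList F₁) (toList F₂)) summand) ≡
    ∑ (𝓕ᵋ H₁ d₁) (λ F₁ → ∑ (𝓕ᵋ H₂ d₂) (pairWeight m d u₁ u₂ F₁))
  by-sizes d₁ d₂ d₁+d₂≡d = begin
    (∑ (sequences (map (embed ι₁) (rootedEdges H₁)) d₁) λ F₁ →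
     ∑ (sequences (map (embed ι₂) (rootedEdges H₂)) d₂) λ F₂ → ∑ (interleave d (toList F₁) (toList F₂)) summand)
      ≡⟨ ∑-sequences-map (embed ι₁) (rootedEdges H₁) d₁
           (λ F₁ → ∑ (sequences (map (embed ι₂) (rootedEdges H₂)) d₂) λ F₂ → ∑ (interleave d (toList F₁) (toList F₂)) summand) ⟩
    (∑ S₁ λ F₁ → ∑ (sequences (map (embed ι₂) (rootedEdges H₂)) d₂) λ F₂ →
      ∑ (interleave d (toList (Vec.map (embed ι₁) F₁)) (toList F₂)) summand)
      ≡⟨ ∑-cong S₁ (λ F₁ → ∑-sequences-map (embed ι₂) (rootedEdges H₂) d₂
           (λ F₂ → ∑ (interleave d (toList (Vec.map (embed ι₁) F₁)) (toList F₂)) summand)) ⟩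
    (∑ S₁ λ F₁ → ∑ S₂ λ F₂ → ∑ (interleave d (toList (Vec.map (embed ι₁) F₁)) (toList (Vec.map (embed ι₂) F₂))) summand)
      ≡⟨ ∑-cong-∈ S₁ (λ {F₁} F₁∈ → ∑-cong-∈ S₂ (λ {F₂} F₂∈ →
           shuffle-sum 2≤m coalescence d₁+d₂≡d F₁ F₂ (valid-sequence H₁ F₁∈) (valid-sequence H₂ F₂∈))) ⟩
    (∑ S₁ λ F₁ → ∑ S₂ λ F₂ → (inner F₁ F₂ when does (eulerian? (R F₁))) when does (linked? _≼?_ F₁))
      -- The conditions on `F₁` do not involve `F₂` and can be taken out of the inner sum.
      ≡⟨ ∑-cong S₁ (λ F₁ → trans
           (∑-when S₂ (λ F₂ → inner F₁ F₂ when does (eulerian? (R F₁))) (does (linked? _≼?_ F₁)))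
           (cong (_when does (linked? _≼?_ F₁)) (∑-when S₂ (inner F₁) (does (eulerian? (R F₁)))))) ⟩
    (∑ S₁ λ F₁ → (∑ S₂ (inner F₁) when does (eulerian? (R F₁))) when does (linked? _≼?_ F₁))
      ≡⟨ sym (∑-𝓕ᵋ H₁ d₁ (λ F₁ → ∑ S₂ (inner F₁))) ⟩
    ∑ (𝓕ᵋ H₁ d₁) (λ F₁ → ∑ S₂ (inner F₁))
      ≡⟨ ∑-cong (𝓕ᵋ H₁ d₁) (λ F₁ → sym (∑-𝓕ᵋ H₂ d₂ (pairWeight m d u₁ u₂ F₁))) ⟩
    ∑ (𝓕ᵋ H₁ d₁) (λ F₁ → ∑ (𝓕ᵋ H₂ d₂) (pairWeight m d u₁ u₂ F₁)) ∎
    where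
    S₁ = sequences (rootedEdges H₁) d₁
    S₂ = sequences (rootedEdges H₂) d₂
    inner : Vec (RootedEdge n₁) d₁ → Vec (RootedEdge n₂) d₂ → ℚ
    inner F₁ F₂ = (pairWeight m d u₁ u₂ F₁ F₂ when does (eulerian? (R F₂))) when does (linked? _≼?_ F₂)
    valid-sequence : ∀ {n d} (H : Hypergraph m n) {F : Vec (RootedEdge n) d} → F ∈ sequences (rootedEdges H) d → All Valid (toList F)
    valid-sequence {d = d} H F∈ = All.map (rootedEdges-valid 2≤m H) (∈-sequences⁻ (rootedEdges H) d F∈)
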